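{- For $d>2$ let $f(d)=\max_{C}\max_{T}|T|$, where $C$ ranges over all combinatorial $d$-cubes, $T$ ranges over all triangulations of $C$, and $|T|$ is the number of $d$-simplices in $T$. Then there is a constant $c\ge 1.031$ such that $f(d)\ge c^d\, d!$ for every $d>2$.
   Context: A combinatorial $d$-cube is a convex $d$-polytope whose face lattice is isomorphic to that of the cube $[0,1]^d$. A triangulation of a convex $d$-polytope $C$ is a set of $d$-simplices whose vertices are among the vertices of $C$, with union $C$, such that no two of them share an interior point and any two of them intersect in a common face (possibly empty). -}

module Defs where

open import Algebra.Bundles using (CommutativeRing; Semiring)
open import Data.Fin.Base using (Fin)
open import Data.Nat.Base as ℕ using (ℕ; suc)
open import Data.Product.Base using (∃; ∃-syntax; Σ-syntax; _×_)
open import Data.Vec.Functional using (Vector)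
open import Level using (0ℓ)
open import Relation.Binary.Bundles using (Poset)
open import Relation.Binary.Core using (Rel)
open import Relation.Binary.Morphism.Structures using (IsOrderIsomorphism)
open import Relation.Binary.PropositionalEquality.Core using (_≡_; _≢_)
open import Relation.Binary.Structures using (IsTotalOrder)
open import Relation.Nullary.Negation.Core using (¬_)
open import Relation.Unary using (Pred; _∈_; _⊆_; _≐_; _∩_; ⋃)
open import Relation.Unary.Relation.Binary.Subset using (⊆-poset)
import Algebra.Definitions.RawMonoid as RawMonoidDefs
import Algebra.Definitions.RawSemiring as RawSemiringDefs
import Relation.Binary.Construct.NonStrictToStrict as ToStrict
import Relation.Binary.Construct.On as On

-- The library has no real numbers.  Classically, complete ordered fields are
-- exactly the copies of ℝ (any two are uniquely isomorphic).
record CompleteOrderedField : Set₁ where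
  infix 4 _≤_ _<_
  field
    commutativeRing : CommutativeRing 0ℓ 0ℓ

  open CommutativeRing commutativeRing public

  field
    _≤_          : Rel Carrier 0ℓ
    isTotalOrder : IsTotalOrder _≈_ _≤_
    0≉1          : ¬ (0# ≈ 1#)
    inverse      : ∀ x → ¬ (x ≈ 0#) → ∃[ y ] x * y ≈ 1#
    +-monoʳ-≤    : ∀ x {y z} → y ≤ z → x + y ≤ x + z
    *-nonNeg     : ∀ {x y} → 0# ≤ x → 0# ≤ y → 0# ≤ x * y

  UpperBound : Pred Carrier 0ℓ → Pred Carrier 0ℓ
  UpperBound S b = ∀ x → x ∈ S → x ≤ b

  field
    supremum : (S : Pred Carrier 0ℓ) → ∃ S → ∃ (UpperBound S) →
               ∃[ s ] UpperBound S s × (∀ b → UpperBound S b → s ≤ b)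

  _<_ : Rel Carrier 0ℓ
  _<_ = ToStrict._<_ _≈_ _≤_

  open RawMonoidDefs +-rawMonoid public using (sum)
  open RawSemiringDefs (Semiring.rawSemiring semiring) public using (_^_)

  fromℕ : ℕ → Carrier
  fromℕ n = n · 1#
    where open RawMonoidDefs +-rawMonoid renaming (_×_ to _·_)

module Polytopes (ℝ : CompleteOrderedField) where

  open CompleteOrderedField ℝ

  Point : ℕ → Set
  Point n = Vector Carrier n

  infix 4 _≋_
  _≋_ : ∀ {n} → Rel (Point n) 0ℓ
  x ≋ y = ∀ i → x i ≈ y i

  infix 8 _∙_
  _∙_ : ∀ {n} → Point n → Point n → Carrier
  x ∙ y = sum (λ i → x i * y i)

  combination : ∀ {m n} → Vector Carrier m → Vector (Point n) m → Point n
  combination w p k = sum (λ i → w i * p i k)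

  affineHull : ∀ {m n} → Vector (Point n) m → Pred (Point n) 0ℓ
  affineHull p x = ∃[ w ] sum w ≈ 1# × x ≋ combination w p

  convexHull : ∀ {m n} → Vector (Point n) m → Pred (Point n) 0ℓ
  convexHull p x =
    ∃[ w ] (∀ i → 0# ≤ w i) × sum w ≈ 1# × x ≋ combination w p

  AffinelyIndependent : ∀ {m n} → Vector (Point n) m → Set
  AffinelyIndependent p =
    ∀ w → sum w ≈ 0# → combination w p ≋ (λ _ → 0#) → ∀ i → w i ≈ 0#

  -- A polytope is the convex hull of a finite family of points.  The family
  -- may contain repetitions and points that are not vertices.
  record Polytope (n : ℕ) : Set where
    field
      {generatorCount} : ℕ
      generator        : Vector (Point n) generatorCount

    body : Pred (Point n) 0ℓ
    body = convexHull generator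

  open Polytope public using (body)

  -- The affine hull of P has dimension d: it has an affine basis of d + 1
  -- points.  The ambient dimension n may be larger than d.
  HasDimension : ∀ {n} → ℕ → Polytope n → Set
  HasDimension {n} d P =
    ∃[ b ] AffinelyIndependent {suc d} {n} b
         × (∀ i → b i ∈ body P)
         × body P ⊆ affineHull b

  -- A face of K is the set of points of K at which a linear inequality valid
  -- on K is tight.  A zero normal yields K itself and the empty face.
  record Face {n} (K : Pred (Point n) 0ℓ) : Set where
    field
      normal : Point n
      offset : Carrier
      valid  : ∀ x → x ∈ K → normal ∙ x ≤ offset

    points : Pred (Point n) 0ℓ
    points x = x ∈ K × normal ∙ x ≈ offset

  open Face public using (points)

  -- Faces are compared as point sets, so two supporting inequalities that cut
  -- out the same set are the same element.
  faceLattice : ∀ {n} → Pred (Point n) 0ℓ → Poset 0ℓ 0ℓ 0ℓ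
  faceLattice {n} K = On.poset (⊆-poset (Point n) 0ℓ) (points {K = K})

  -- Isomorphism of lattices is the same as isomorphism of the underlying
  -- posets.
  infix 4 _≅_
  _≅_ : (L M : Poset 0ℓ 0ℓ 0ℓ) → Set
  L ≅ M = ∃ (IsOrderIsomorphism L._≈_ M._≈_ L._≤_ M._≤_)
    where
    module L = Poset L
    module M = Poset M

  unitCube : ∀ d → Pred (Point d) 0ℓ
  unitCube d x = ∀ i → 0# ≤ x i × x i ≤ 1#

  IsCombinatorialCube : ∀ {n} → ℕ → Polytope n → Set
  IsCombinatorialCube d C =
    HasDimension d C × faceLattice (body C) ≅ faceLattice (unitCube d)

  IsVertex : ∀ {n} → Pred (Point n) 0ℓ → Point n → Set
  IsVertex K v = ∃[ F ] points {K = K} F ≐ (_≋ v)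

  record Simplex (d n : ℕ) : Set where
    field
      vertex      : Vector (Point n) (suc d)
      independent : AffinelyIndependent vertex

    hull : Pred (Point n) 0ℓ
    hull = convexHull vertex

    -- Interior relative to the affine hull, for the sup norm.  When n = d this
    -- is the interior in ℝᵈ.
    interior : Pred (Point n) 0ℓ
    interior x = x ∈ hull × (∃[ ε ] 0# < ε
      × (∀ y → y ∈ affineHull vertex →
         (∀ k → y k < x k + ε × x k < y k + ε) → y ∈ hull))

  open Simplex public using (vertex; hull; interior)

  IsFaceOf : ∀ {n} → Pred (Point n) 0ℓ → Pred (Point n) 0ℓ → Set
  IsFaceOf S K = ∃[ F ] points {K = K} F ≐ S

  record Triangulation {n} (d : ℕ) (C : Polytope n) : Set where
    field
      size    : ℕ
      simplex : Fin size → Simplex d n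

      distinct : ∀ {i j} → i ≢ j → ¬ (hull (simplex i) ≐ hull (simplex j))

      vertices : ∀ i k → IsVertex (body C) (vertex (simplex i) k)

      union : ⋃ (Fin size) (λ i → hull (simplex i)) ≐ body C

      interiorDisjoint : ∀ {i j} → i ≢ j →
        ¬ (∃[ x ] x ∈ interior (simplex i) × x ∈ interior (simplex j))

      commonFace : ∀ {i j} → i ≢ j →
        let S = hull (simplex i) ; T = hull (simplex j) in
        IsFaceOf (S ∩ T) S × IsFaceOf (S ∩ T) T

  open Triangulation public using (size)

  IsMaxTriangulationSize : ℕ → ℕ → Set
  IsMaxTriangulationSize d m =
      (∃[ n ] ∃[ C ] IsCombinatorialCube {n} d C
        × (Σ[ T ∈ Triangulation d C ] size T ≡ m))
    × (∀ {n} (C : Polytope n) → IsCombinatorialCube d C →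
       (T : Triangulation d C) → size T ℕ.≤ m)

-- Each product Δᵏ × Δˡ of simplices splits into C(k + l , k) simplices indexed by
-- lattice paths.  Hence for triangulated cubes the number of simplices divided by d!
-- is multiplicative under products, and a combinatorial 3-cube with 7 > 3! tetrahedra,
-- together with products with intervals in dimensions 4 and 5, gives
-- f(d) / d! ≥ (7/6)^⌊d/3⌋ ≥ (7/6)^(d/5), where 1.031⁵ < 7/6.  The pieces of different
-- products fit together because the weights of a point on the vertices of its simplex
-- are determined by the weights of quadrants, which depend on the point only.  The
-- maximum f(d) exists since a combinatorial d-cube has at most 2ᵈ vertices.

module Submission where

open import Defs
open import Axiom.ExcludedMiddle using (ExcludedMiddle)
open import Data.Nat.Base using (ℕ; _>_; _!)
open import Data.Product.Base using (Σ-syntax; _×_)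
open import Level using (0ℓ)

import Algebra.Definitions.RawMonoid as RawMonoidDefs
import Algebra.Properties.CommutativeMonoid.Sum as CMSum
import Algebra.Properties.Monoid.Mult as MonoidMult
import Algebra.Properties.Ring as RingProperties
import Algebra.Properties.Semiring.Mult as SemiringMult
import Algebra.Properties.Semiring.Sum as SemiringSum
import Algebra.Solver.Ring as RingSolver
open import Algebra.Solver.Ring.AlmostCommutativeRing
  using (fromCommutativeRing; _-Raw-AlmostCommutative⟶_)
open import Data.Bool.Base using (Bool; true; false; not; if_then_else_)
import Data.Bool.Properties as Bool
open import Data.Empty using (⊥)
open import Data.Fin.Base as Fin
  using (Fin; zero; suc; _↑ˡ_; _↑ʳ_; splitAt; join; remQuot; combine; funToFin; finToFun)
open import Data.Fin.Patterns using (0F; 1F; 2F; 3F; 4F; 5F; 6F; 7F)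
open import Data.Fin.Properties as Fin
  using (all?; any?; suc-injective; injective⇒≤; +↔⊎; *↔×; 2↔Bool; splitAt-join; join-splitAt;
         remQuot-combine; funToFin-finToFin; finToFun-funToFin)
open import Data.Integer.Base as ℤ using (ℤ; -[1+_]; -1ℤ) renaming (+_ to pos)
import Data.Integer.Properties as ℤ
open import Data.Maybe.Base using (Maybe; just; nothing)
open import Data.Nat.Base as ℕ using (zero; suc)
import Data.Nat.Properties as ℕ
import Data.Nat.Solver as ℕSolver
open import Data.Product.Base using (_,_; ∃; ∃-syntax; proj₁; proj₂)
open import Data.Product.Function.NonDependent.Propositional using (_×-↔_)
open import Data.Sum.Base using (_⊎_; inj₁; inj₂; [_,_])
open import Data.Sum.Function.Propositional using (_⊎-↔_)
open import Data.Vec.Base using (Vec; lookup)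
open import Data.Vec.Functional using (Vector; _++_)
open import Data.Vec.Functional.Properties using (lookup-++ˡ; lookup-++ʳ)
open import Function.Base using (_∘_)
open import Function.Bundles using (_↔_; Inverse; mk↔ₛ′)
open import Function.Construct.Composition using (_↔-∘_)
open import Function.Construct.Identity using (↔-id)
open import Function.Construct.Symmetry using (↔-sym)
open import Relation.Binary.Morphism.Structures using (IsOrderIsomorphism)
open import Relation.Binary.PropositionalEquality
  using (_≡_; _≢_; refl; cong; cong₂; subst; sym; trans; module ≡-Reasoning)
import Relation.Binary.PropositionalEquality.Properties as ≡
import Relation.Binary.Reasoning.Setoid as SetoidReasoning
open import Relation.Binary.Structures using (IsPartialOrder; IsTotalOrder)
open import Relation.Nullary.Decidable
  using (Dec; yes; no; ⌊_⌋; map′; from-yes; decidable-stable; ¬?; _×-dec_; _⊎-dec_; _→-dec_)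
open import Relation.Nullary.Negation using (¬_; contradiction)
open import Relation.Unary using (Pred; _∈_; _⊆_; _≐_; _∩_)

-- No volumes are computed: every geometric condition is reduced to signs of affine functions. For
-- the two starting cubes a convex height function does this. A point is covered by the simplex
-- whose affine interpolation of the heights is largest there, and two interpolations that agree at
-- a common point leave weight on common vertices only. The hypotheses of this argument form a
-- finite check on integers. For products, one order of the vertices that increases along every
-- simplex makes the staircases in neighbouring cells agree on their common faces. On pairs of
-- vertices the order is only partial, and the weight of a single vertex is recovered from four
-- quadrants by inclusion and exclusion. The constant is forced by dimension 5: products with
-- intervals leave the ratio to d! at 7/6, and `(7/6)^(1/5) = 1.0313...` is rounded down.

-- Lattice paths and their number

-- Monotone lattice paths from (0 , 0) to (k , l), with n = k + l steps.
data Path : ℕ → ℕ → ℕ → Set where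
  done  : Path 0 0 0
  right : ∀ {k l n} → Path k l n → Path (suc k) l (suc n)
  up    : ∀ {k l n} → Path k l n → Path k (suc l) (suc n)

row : ∀ {k l n} → Path k l n → Fin (suc n) → Fin (suc k)
row done      _       = zero
row (right p) zero    = zero
row (right p) (suc r) = suc (row p r)
row (up p)    zero    = zero
row (up p)    (suc r) = row p r

col : ∀ {k l n} → Path k l n → Fin (suc n) → Fin (suc l)
col done      _       = zero
col (right p) zero    = zero
col (right p) (suc r) = col p r
col (up p)    zero    = zero
col (up p)    (suc r) = suc (col p r)

row-start : ∀ {k l n} (p : Path k l n) → row p zero ≡ zero
row-start done      = refl
row-start (right p) = refl
row-start (up p)    = refl

col-start : ∀ {k l n} (p : Path k l n) → col p zero ≡ zero
col-start done      = refl
col-start (right p) = refl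
col-start (up p)    = refl

row-mono : ∀ {k l n} (p : Path k l n) {r r′} → r Fin.≤ r′ → row p r Fin.≤ row p r′
row-mono done      _ = ℕ.z≤n
row-mono (right p) {zero}  _ = ℕ.z≤n
row-mono (right p) {suc r} {suc r′} (ℕ.s≤s r≤r′) = ℕ.s≤s (row-mono p r≤r′)
row-mono (up p)    {zero}  _ = ℕ.z≤n
row-mono (up p)    {suc r} {suc r′} (ℕ.s≤s r≤r′) = row-mono p r≤r′

col-mono : ∀ {k l n} (p : Path k l n) {r r′} → r Fin.≤ r′ → col p r Fin.≤ col p r′
col-mono done      _ = ℕ.z≤n
col-mono (right p) {zero}  _ = ℕ.z≤n
col-mono (right p) {suc r} {suc r′} (ℕ.s≤s r≤r′) = col-mono p r≤r′
col-mono (up p)    {zero}  _ = ℕ.z≤n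
col-mono (up p)    {suc r} {suc r′} (ℕ.s≤s r≤r′) = ℕ.s≤s (col-mono p r≤r′)

row-surjective : ∀ {k l n} (p : Path k l n) i → ∃[ r ] row p r ≡ i
row-surjective done      zero    = zero , refl
row-surjective (right p) zero    = zero , refl
row-surjective (right p) (suc i) = let (r , eq) = row-surjective p i in suc r , cong suc eq
row-surjective (up p)    i       = let (r , eq) = row-surjective p i in suc r , eq

col-surjective : ∀ {k l n} (p : Path k l n) j → ∃[ r ] col p r ≡ j
col-surjective done      zero    = zero , refl
col-surjective (up p)    zero    = zero , refl
col-surjective (up p)    (suc j) = let (r , eq) = col-surjective p j in suc r , cong suc eq
col-surjective (right p) j       = let (r , eq) = col-surjective p j in suc r , eq

-- The first step leaves row 0 or column 0 for good, so no later position can return to the initial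
-- cell; then induct on the rest of the path.
rowcol-injective : ∀ {k l n} (p : Path k l n) {r r′} → row p r ≡ row p r′ → col p r ≡ col p r′ → r ≡ r′
rowcol-injective done      {zero}  {zero}   _ _   = refl
rowcol-injective (right p) {zero}  {zero}   _ _   = refl
rowcol-injective (right p) {suc r} {suc r′} e₁ e₂ = cong suc (rowcol-injective p (suc-injective e₁) e₂)
rowcol-injective (right p) {zero}  {suc r′} () _
rowcol-injective (right p) {suc r} {zero}   () _
rowcol-injective (up p)    {zero}  {zero}   _ _   = refl
rowcol-injective (up p)    {suc r} {suc r′} e₁ e₂ = cong suc (rowcol-injective p e₁ (suc-injective e₂))
rowcol-injective (up p)    {zero}  {suc r′} _ ()
rowcol-injective (up p)    {suc r} {zero}   _ ()

-- Where the two paths first separate, one goes right and the other up. The cell reached by `p` in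
-- that step is avoided by `q` for ever, since `q` has already left the row or column in question.
-- This cell becomes a vertex of one staircase simplex that the other lacks.
path-distinct : ∀ {k l n} {p q : Path k l n} → p ≢ q →
                ∃[ r ] ∀ r′ → row p r ≡ row q r′ → col p r ≡ col q r′ → ⊥
path-distinct {p = done}    {done}    p≢q = contradiction refl p≢q
path-distinct {p = right p} {right q} p≢q =
  let (r , off) = path-distinct (p≢q ∘ cong right) in
  suc r , λ { zero () _ ; (suc r′) e₁ e₂ → off r′ (suc-injective e₁) e₂ }
path-distinct {p = up p}    {up q}    p≢q =
  let (r , off) = path-distinct (p≢q ∘ cong up) in
  suc r , λ { zero _ () ; (suc r′) e₁ e₂ → off r′ e₁ (suc-injective e₂) }
path-distinct {p = right p} {up q}    _ =
  suc zero , λ { zero () _ ; (suc r′) _ e₂ → contradiction (trans (sym (col-start p)) e₂) λ () }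
path-distinct {p = up p}    {right q} _ =
  suc zero , λ { zero _ () ; (suc r′) e₁ _ → contradiction (trans (sym (row-start p)) e₁) λ () }

pathCount : ℕ → ℕ → ℕ
pathCount zero    zero    = 1
pathCount (suc k) zero    = pathCount k zero
pathCount zero    (suc l) = pathCount zero l
pathCount (suc k) (suc l) = pathCount k (suc l) ℕ.+ pathCount (suc k) l

-- The length is a free index tied by an equation because removing an `up` step from `k + suc l`
-- gives the right length only up to `ℕ.+-suc`.
Path↔Fin : ∀ k l {n} → k ℕ.+ l ≡ n → Path k l n ↔ Fin (pathCount k l)
Path↔Fin zero zero refl = mk↔ₛ′ (λ _ → zero) (λ _ → done) (λ { zero → refl }) (λ { done → refl })
Path↔Fin (suc k) zero refl = Path↔Fin k zero refl ↔-∘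
  mk↔ₛ′ (λ { (right p) → p }) right (λ _ → refl) (λ { (right p) → refl })
Path↔Fin zero (suc l) refl = Path↔Fin zero l refl ↔-∘
  mk↔ₛ′ (λ { (up p) → p }) up (λ _ → refl) (λ { (up p) → refl })
Path↔Fin (suc k) (suc l) refl = ↔-sym +↔⊎ ↔-∘
  ((Path↔Fin k (suc l) refl ⊎-↔ Path↔Fin (suc k) l (sym (ℕ.+-suc k l))) ↔-∘
  mk↔ₛ′ (λ { (right p) → inj₁ p ; (up p) → inj₂ p }) (λ { (inj₁ p) → right p ; (inj₂ p) → up p })
    (λ { (inj₁ p) → refl ; (inj₂ p) → refl }) (λ { (right p) → refl ; (up p) → refl }))

-- The binomial formula without division. Pascal's rule, multiplied by the factorials, collects the
-- factors `suc k` and `suc l` into the top factor of the next factorial.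
pathCount-! : ∀ k l → pathCount k l ℕ.* (k ! ℕ.* l !) ≡ (k ℕ.+ l) !
pathCount-! zero zero = refl
pathCount-! (suc k) zero = trans
  (ℕsolve 3 (λ n s f → n :* (s :* f :* con 1) := s :* (n :* (f :* con 1))) refl (pathCount k zero) (suc k) (k !))
  (trans (cong (suc k ℕ.*_) (pathCount-! k zero)) (cong (λ n → suc n ℕ.* (k ℕ.+ 0) !) (sym (ℕ.+-identityʳ k))))
  where open ℕSolver.+-*-Solver renaming (solve to ℕsolve)
pathCount-! zero (suc l) = trans
  (ℕsolve 3 (λ n s f → n :* (con 1 :* (s :* f)) := s :* (n :* (con 1 :* f))) refl (pathCount zero l) (suc l) (l !))
  (cong (suc l ℕ.*_) (pathCount-! zero l))
  where open ℕSolver.+-*-Solver renaming (solve to ℕsolve)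
pathCount-! (suc k) (suc l) = begin
  (N₁ ℕ.+ N₂) ℕ.* (suc k ℕ.* k ! ℕ.* (suc l ℕ.* l !))
    ≡⟨ ℕsolve 6 (λ m n s f t g → (m :+ n) :* (s :* f :* (t :* g)) := s :* (m :* (f :* (t :* g))) :+ t :* (n :* (s :* f :* g)))
         refl N₁ N₂ (suc k) (k !) (suc l) (l !) ⟩
  suc k ℕ.* (N₁ ℕ.* (k ! ℕ.* (suc l) !)) ℕ.+ suc l ℕ.* (N₂ ℕ.* ((suc k) ! ℕ.* l !))
    ≡⟨ cong₂ (λ x y → suc k ℕ.* x ℕ.+ suc l ℕ.* y) (pathCount-! k (suc l)) (pathCount-! (suc k) l) ⟩
  suc k ℕ.* (k ℕ.+ suc l) ! ℕ.+ suc l ℕ.* (suc (k ℕ.+ l)) !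
    ≡⟨ cong (λ n → suc k ℕ.* (k ℕ.+ suc l) ! ℕ.+ suc l ℕ.* n !) (ℕ.+-suc k l) ⟨
  suc k ℕ.* (k ℕ.+ suc l) ! ℕ.+ suc l ℕ.* (k ℕ.+ suc l) !
    ≡⟨ ℕ.*-distribʳ-+ ((k ℕ.+ suc l) !) (suc k) (suc l) ⟨
  (suc k ℕ.+ suc l) ℕ.* (k ℕ.+ suc l) !
    ∎
  where
  open ≡-Reasoning
  open ℕSolver.+-*-Solver renaming (solve to ℕsolve)
  N₁ = pathCount k (suc l)
  N₂ = pathCount (suc k) l

-- Integral certificates for regular triangulations of cubes

open RawMonoidDefs ℤ.+-0-rawMonoid using () renaming (sum to sumℤ)

-- Corners of the cube are numbered in binary, the first coordinate being the
-- most significant bit.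
bits : ∀ {d} → Fin (2 ℕ.^ d) → Fin d → Bool
bits v i = Inverse.to 2↔Bool (finToFun v i)

fromBits : ∀ {d} → (Fin d → Bool) → Fin (2 ℕ.^ d)
fromBits ε = funToFin (λ i → Inverse.from 2↔Bool (ε i))

bits-fromBits : ∀ {d} (ε : Fin d → Bool) i → bits {d} (fromBits ε) i ≡ ε i
bits-fromBits {d} ε i = trans (cong (Inverse.to 2↔Bool) (finToFun-funToFin _ i)) (Inverse.strictlyInverseˡ 2↔Bool (ε i))

funToFin-cong : ∀ {m n} {f g : Fin m → Fin n} → (∀ i → f i ≡ g i) → funToFin f ≡ funToFin g
funToFin-cong {zero}  f≗g = refl
funToFin-cong {suc m} f≗g = cong₂ Fin.combine (f≗g zero) (funToFin-cong (f≗g ∘ suc))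

bits-injective : ∀ d {u v : Fin (2 ℕ.^ d)} → (∀ i → bits {d} u i ≡ bits {d} v i) → u ≡ v
bits-injective d {u} {v} same = begin
  u                                 ≡⟨ funToFin-finToFin {d} u ⟨
  funToFin (finToFun {2} {d} u)     ≡⟨ funToFin-cong (λ i → to-injective (finToFun u i) (finToFun v i) (same i)) ⟩
  funToFin (finToFun {2} {d} v)     ≡⟨ funToFin-finToFin {d} v ⟩
  v                                 ∎
  where
  open ≡-Reasoning
  to-injective : ∀ x y → Inverse.to 2↔Bool x ≡ Inverse.to 2↔Bool y → x ≡ y
  to-injective x y eq = trans (sym (Inverse.strictlyInverseʳ 2↔Bool x))
    (trans (cong (Inverse.from 2↔Bool) eq) (Inverse.strictlyInverseʳ 2↔Bool y))

-- Coefficients and constant term of an affine function.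
Form : ℕ → Set
Form d = Vec ℤ d × ℤ

eval : ∀ {d} → Form d → (Fin d → ℤ) → ℤ
eval (a , c) x = sumℤ (λ i → lookup a i ℤ.* x i) ℤ.+ c

-- An integral cube with a list of simplices and their barycentric coordinates,
-- which are multiplied by 2, the largest normalised volume in the examples below.
record LatticeCube (d n : ℕ) : Set where
  field
    corner  : Fin (2 ℕ.^ d) → Fin d → ℤ
    facet   : Fin d → Bool → Form d
    simplex : Fin n → Fin (suc d) → Fin (2 ℕ.^ d)
    2β      : Fin n → Fin (suc d) → Form d
    height  : Fin (2 ℕ.^ d) → ℤ

  -- Twice the affine function that agrees with `height` at the vertices of the simplex.
  2lift : Fin n → (Fin d → ℤ) → ℤ
  2lift s x = sumℤ (λ k → height (simplex s k) ℤ.* eval (2β s k) x)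

  _∉ˢ_ : Fin (2 ℕ.^ d) → Fin n → Set
  v ∉ˢ s = ∀ k → v ≢ simplex s k

  -- The facet of simplex `s` opposite its vertex `k` lies in the facet `(i , b)` of the cube, and
  -- that vertex does not.
  Wall : Fin n → Fin (suc d) → Fin d → Bool → Set
  Wall s k i b = (∀ l → l ≢ k → bits {d} (simplex s l) i ≡ b) × bits {d} (simplex s k) i ≢ b

  Neighbour : Fin n → Fin (suc d) → Fin n → Set
  Neighbour s k t = (∀ l → l ≢ k → ∃[ m ] simplex s l ≡ simplex t m) × simplex s k ∉ˢ t

  -- The triangulation is regular: the simplices are the domains of linearity of the
  -- convex piecewise affine function that interpolates height, and crossing a facet
  -- of a simplex leads into another simplex or out of the cube.
  record IsRegular : Set where
    field
      facet-on          : ∀ v i → eval (facet i (bits {d} v i)) (corner v) ≡ pos 0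
      facet-off         : ∀ v i → pos 0 ℤ.< eval (facet i (not (bits {d} v i))) (corner v)
      -- One numbering of the corners orders all simplices at once. The staircase triangulations
      -- over neighbouring simplices need this in order to match.
      simplex-mono      : ∀ s k l → k Fin.≤ l → simplex s k Fin.≤ simplex s l
      simplex-injective : ∀ s k l → simplex s k ≡ simplex s l → k ≡ l
      simplex-distinct  : ∀ s t → s ≢ t → ∃[ k ] simplex s k ∉ˢ t
      2β-on             : ∀ s k → eval (2β s k) (corner (simplex s k)) ≡ pos 2
      2β-off            : ∀ s k l → k ≢ l → eval (2β s k) (corner (simplex s l)) ≡ pos 0
      -- This and the next four equations compare coefficients in the identities "the weights sum to
      -- 1" and "the weighted vertices sum to x", doubled. They are therefore checked on integers
      -- and hold at every real point.
      2β-sum            : ∀ s i → sumℤ (λ k → pos 1 ℤ.* lookup (proj₁ (2β s k)) i) ≡ pos 0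
      2β-sum₀           : ∀ s → sumℤ (λ k → pos 1 ℤ.* proj₂ (2β s k)) ≡ pos 2
      2β-corner-on      : ∀ s i → sumℤ (λ k → corner (simplex s k) i ℤ.* lookup (proj₁ (2β s k)) i) ≡ pos 2
      2β-corner-off     : ∀ s i j → i ≢ j → sumℤ (λ k → corner (simplex s k) j ℤ.* lookup (proj₁ (2β s k)) i) ≡ pos 0
      2β-corner₀        : ∀ s j → sumℤ (λ k → corner (simplex s k) j ℤ.* proj₂ (2β s k)) ≡ pos 0
      2lift-below       : ∀ s v → v ∉ˢ s → 2lift s (corner v) ℤ.< pos 2 ℤ.* height v
      adjacent          : ∀ s k → (∃[ i ] Wall s k i false) ⊎ (∃[ i ] Wall s k i true) ⊎ ∃ (Neighbour s k)

  _∉ˢ?_ : ∀ v s → Dec (v ∉ˢ s)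
  v ∉ˢ? s = all? λ k → ¬? (v Fin.≟ simplex s k)

  wall? : ∀ s k i b → Dec (Wall s k i b)
  wall? s k i b = (all? λ l → ¬? (l Fin.≟ k) →-dec (bits {d} (simplex s l) i Bool.≟ b))
    ×-dec ¬? (bits {d} (simplex s k) i Bool.≟ b)

  neighbour? : ∀ s k t → Dec (Neighbour s k t)
  neighbour? s k t = (all? λ l → ¬? (l Fin.≟ k) →-dec any? λ m → simplex s l Fin.≟ simplex t m)
    ×-dec (simplex s k ∉ˢ? t)

  -- Every quantifier runs over a finite type and every atom is a comparison of integers, truth
  -- values or indices, so a concrete cube is certified by evaluation.
  isRegular? : Dec IsRegular
  isRegular? = map′
    (λ (a , b , c , d , e , f , g , h , i , j , k , l , m , n) → record
      { facet-on = a ; facet-off = b ; simplex-mono = c ; simplex-injective = d ; simplex-distinct = e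
      ; 2β-on = f ; 2β-off = g ; 2β-sum = h ; 2β-sum₀ = i ; 2β-corner-on = j ; 2β-corner-off = k
      ; 2β-corner₀ = l ; 2lift-below = m ; adjacent = n })
    (λ r → let open IsRegular r in
      facet-on , facet-off , simplex-mono , simplex-injective , simplex-distinct , 2β-on , 2β-off , 2β-sum
      , 2β-sum₀ , 2β-corner-on , 2β-corner-off , 2β-corner₀ , 2lift-below , adjacent)
    (     (all? λ v → all? λ i → eval (facet i (bits {d} v i)) (corner v) ℤ.≟ pos 0)
    ×-dec (all? λ v → all? λ i → pos 0 ℤ.<? eval (facet i (not (bits {d} v i))) (corner v))
    ×-dec (all? λ s → all? λ k → all? λ l → (k Fin.≤? l) →-dec (simplex s k Fin.≤? simplex s l))
    ×-dec (all? λ s → all? λ k → all? λ l → (simplex s k Fin.≟ simplex s l) →-dec (k Fin.≟ l))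
    ×-dec (all? λ s → all? λ t → ¬? (s Fin.≟ t) →-dec any? λ k → simplex s k ∉ˢ? t)
    ×-dec (all? λ s → all? λ k → eval (2β s k) (corner (simplex s k)) ℤ.≟ pos 2)
    ×-dec (all? λ s → all? λ k → all? λ l → ¬? (k Fin.≟ l) →-dec (eval (2β s k) (corner (simplex s l)) ℤ.≟ pos 0))
    ×-dec (all? λ s → all? λ i → sumℤ (λ k → pos 1 ℤ.* lookup (proj₁ (2β s k)) i) ℤ.≟ pos 0)
    ×-dec (all? λ s → sumℤ (λ k → pos 1 ℤ.* proj₂ (2β s k)) ℤ.≟ pos 2)
    ×-dec (all? λ s → all? λ i → sumℤ (λ k → corner (simplex s k) i ℤ.* lookup (proj₁ (2β s k)) i) ℤ.≟ pos 2)
    ×-dec (all? λ s → all? λ i → all? λ j → ¬? (i Fin.≟ j) →-dec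
            (sumℤ (λ k → corner (simplex s k) j ℤ.* lookup (proj₁ (2β s k)) i) ℤ.≟ pos 0))
    ×-dec (all? λ s → all? λ j → sumℤ (λ k → corner (simplex s k) j ℤ.* proj₂ (2β s k)) ℤ.≟ pos 0)
    ×-dec (all? λ s → all? λ v → (v ∉ˢ? s) →-dec (2lift s (corner v) ℤ.<? pos 2 ℤ.* height v))
    ×-dec (all? λ s → all? λ k → (any? λ i → wall? s k i false) ⊎-dec (any? λ i → wall? s k i true)
            ⊎-dec any? (neighbour? s k)))

-- The two building blocks: an interval and a prism with seven tetrahedra

module Examples where
  open import Data.Vec.Base using ([]; _∷_)

  interval : LatticeCube 1 1
  interval = record
    { corner  = λ v _ → pos (Fin.toℕ v)
    ; facet   = λ { _ false → (pos 1 ∷ []) , pos 0 ; _ true → (-1ℤ ∷ []) , pos 1 }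
    ; simplex = λ _ k → k
    ; 2β      = λ { _ 0F → (-2ℤ ∷ []) , pos 2 ; _ 1F → (pos 2 ∷ []) , pos 0 }
    ; height  = λ _ → pos 0
    }
    where
    -2ℤ : ℤ
    -2ℤ = -[1+ 1 ]

  -- { 0 ≤ x ≤ 1 , 0 ≤ y ≤ 1 + x , 0 ≤ z ≤ 1 }: the edges on the lines y = z = 0 and
  -- y = 1 + x , z = 1 span a simplex (the fourth below), which makes room for a
  -- seventh tetrahedron.
  trapezoidalPrism : LatticeCube 3 7
  trapezoidalPrism = record
    { corner  = λ v → lookup (lookup corners v)
    ; facet   = facet
    ; simplex = λ s → lookup (lookup simplices s)
    ; 2β      = λ s → lookup (lookup 2βs s)
    -- Height 0 on the corners 0, 3, 4, 7 makes the central simplex a domain of linearity. The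
    -- interpolation on the third simplex takes the value 2 at corner 1, and that on the fifth the
    -- value 2 at corner 2, so these corners are raised to 3.
    ; height  = lookup (pos 0 ∷ pos 3 ∷ pos 3 ∷ pos 0 ∷ pos 0 ∷ pos 2 ∷ pos 2 ∷ pos 0 ∷ [])
    }
    where
    -2ℤ -4ℤ : ℤ
    -2ℤ = -[1+ 1 ]
    -4ℤ = -[1+ 3 ]
    corners : Vec (Vec ℤ 3) 8
    corners
      = (pos 0 ∷ pos 0 ∷ pos 0 ∷ []) ∷ (pos 0 ∷ pos 0 ∷ pos 1 ∷ [])
      ∷ (pos 0 ∷ pos 1 ∷ pos 0 ∷ []) ∷ (pos 0 ∷ pos 1 ∷ pos 1 ∷ [])
      ∷ (pos 1 ∷ pos 0 ∷ pos 0 ∷ []) ∷ (pos 1 ∷ pos 0 ∷ pos 1 ∷ [])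
      ∷ (pos 1 ∷ pos 2 ∷ pos 0 ∷ []) ∷ (pos 1 ∷ pos 2 ∷ pos 1 ∷ []) ∷ []
    facet : Fin 3 → Bool → Form 3
    facet 0F false = (pos 1 ∷ pos 0 ∷ pos 0 ∷ []) , pos 0
    facet 0F true  = (-1ℤ   ∷ pos 0 ∷ pos 0 ∷ []) , pos 1
    facet 1F false = (pos 0 ∷ pos 1 ∷ pos 0 ∷ []) , pos 0
    facet 1F true  = (pos 1 ∷ -1ℤ   ∷ pos 0 ∷ []) , pos 1
    facet 2F false = (pos 0 ∷ pos 0 ∷ pos 1 ∷ []) , pos 0
    facet 2F true  = (pos 0 ∷ pos 0 ∷ -1ℤ   ∷ []) , pos 1
    simplices : Vec (Vec (Fin 8) 4) 7
    simplices
      = (0F ∷ 1F ∷ 3F ∷ 5F ∷ []) ∷ (0F ∷ 2F ∷ 3F ∷ 6F ∷ [])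
      ∷ (0F ∷ 3F ∷ 4F ∷ 5F ∷ []) ∷ (0F ∷ 3F ∷ 4F ∷ 7F ∷ [])
      ∷ (0F ∷ 3F ∷ 6F ∷ 7F ∷ []) ∷ (0F ∷ 4F ∷ 6F ∷ 7F ∷ [])
      ∷ (3F ∷ 4F ∷ 5F ∷ 7F ∷ []) ∷ []
    2βs : Vec (Vec (Form 3) 4) 7
    2βs
      = ( ((pos 0 ∷ pos 0 ∷ -2ℤ   ∷ []) , pos 2)
        ∷ ((-2ℤ   ∷ -2ℤ   ∷ pos 2 ∷ []) , pos 0)
        ∷ ((pos 0 ∷ pos 2 ∷ pos 0 ∷ []) , pos 0)
        ∷ ((pos 2 ∷ pos 0 ∷ pos 0 ∷ []) , pos 0)
        ∷ [])
      ∷ ( ((pos 2 ∷ -2ℤ   ∷ pos 0 ∷ []) , pos 2)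
        ∷ ((-4ℤ   ∷ pos 2 ∷ -2ℤ   ∷ []) , pos 0)
        ∷ ((pos 0 ∷ pos 0 ∷ pos 2 ∷ []) , pos 0)
        ∷ ((pos 2 ∷ pos 0 ∷ pos 0 ∷ []) , pos 0)
        ∷ [])
      ∷ ( ((-2ℤ   ∷ -2ℤ   ∷ pos 0 ∷ []) , pos 2)
        ∷ ((pos 0 ∷ pos 2 ∷ pos 0 ∷ []) , pos 0)
        ∷ ((pos 2 ∷ pos 2 ∷ -2ℤ   ∷ []) , pos 0)
        ∷ ((pos 0 ∷ -2ℤ   ∷ pos 2 ∷ []) , pos 0)
        ∷ [])
      ∷ ( ((-2ℤ   ∷ pos 2 ∷ -4ℤ   ∷ []) , pos 2)
        ∷ ((pos 0 ∷ -2ℤ   ∷ pos 4 ∷ []) , pos 0)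
        ∷ ((pos 2 ∷ -2ℤ   ∷ pos 2 ∷ []) , pos 0)
        ∷ ((pos 0 ∷ pos 2 ∷ -2ℤ   ∷ []) , pos 0)
        ∷ [])
      ∷ ( ((pos 2 ∷ -2ℤ   ∷ pos 0 ∷ []) , pos 2)
        ∷ ((-4ℤ   ∷ pos 2 ∷ pos 0 ∷ []) , pos 0)
        ∷ ((-2ℤ   ∷ pos 2 ∷ -2ℤ   ∷ []) , pos 0)
        ∷ ((pos 4 ∷ -2ℤ   ∷ pos 2 ∷ []) , pos 0)
        ∷ [])
      ∷ ( ((-2ℤ   ∷ pos 0 ∷ pos 0 ∷ []) , pos 2)
        ∷ ((pos 2 ∷ -1ℤ   ∷ pos 0 ∷ []) , pos 0)
        ∷ ((pos 0 ∷ pos 1 ∷ -2ℤ   ∷ []) , pos 0)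
        ∷ ((pos 0 ∷ pos 0 ∷ pos 2 ∷ []) , pos 0)
        ∷ [])
      ∷ ( ((-2ℤ   ∷ pos 0 ∷ pos 0 ∷ []) , pos 2)
        ∷ ((pos 0 ∷ pos 0 ∷ -2ℤ   ∷ []) , pos 2)
        ∷ ((pos 1 ∷ -1ℤ   ∷ pos 2 ∷ []) , -1ℤ)
        ∷ ((pos 1 ∷ pos 1 ∷ pos 0 ∷ []) , -1ℤ)
        ∷ [])
      ∷ []

  interval-regular : LatticeCube.IsRegular interval
  interval-regular = from-yes (LatticeCube.isRegular? interval)

  trapezoidalPrism-regular : LatticeCube.IsRegular trapezoidalPrism
  trapezoidalPrism-regular = from-yes (LatticeCube.isRegular? trapezoidalPrism)

open Examples

module Construction (em : ExcludedMiddle 0ℓ) (ℝ : CompleteOrderedField) where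

  open import Data.Vec.Functional using ([]; _∷_)

  open CompleteOrderedField ℝ
    renaming (refl to ≈-refl; sym to ≈-sym; trans to ≈-trans; zero to *-zero)
    hiding (isEquivalence; reflexive; isPartialEquivalence)
  open IsTotalOrder isTotalOrder
    using (total; antisym)
    renaming (refl to ≤-refl; reflexive to ≤-reflexive; trans to ≤-trans)
  open CMSum +-commutativeMonoid using (∑-distrib-+; ∑-comm)
  open SemiringSum semiring using (*-distribˡ-sum; *-distribʳ-sum)
  private module ≈-Reasoning = SetoidReasoning setoid

  -- Integers in the field and a ring solver

  ι : ℤ → Carrier
  ι (ℤ.+ n)  = fromℕ n
  ι -[1+ n ] = - fromℕ (suc n)

  module Ring = RingProperties ring
  open Ring using (-0#≈0#; -‿involutive; -‿distribˡ-*; -‿distribʳ-*; -‿+-comm)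

  fromℕ-+ : ∀ m n → fromℕ (m ℕ.+ n) ≈ fromℕ m + fromℕ n
  fromℕ-+ = MonoidMult.×-homo-+ +-monoid 1#

  fromℕ-* : ∀ m n → fromℕ (m ℕ.* n) ≈ fromℕ m * fromℕ n
  fromℕ-* = SemiringMult.×1-homo-* semiring

  ι-neg : ∀ i → ι (ℤ.- i) ≈ - ι i
  ι-neg (ℤ.+ zero)  = ≈-sym -0#≈0#
  ι-neg (ℤ.+ suc n) = ≈-refl
  ι-neg -[1+ n ]    = ≈-sym (-‿involutive _)

  ι-⊖ : ∀ m n → ι (m ℤ.⊖ n) ≈ fromℕ m + - fromℕ n
  ι-⊖ m       zero    = ≈-sym (≈-trans (+-congˡ -0#≈0#) (+-identityʳ _))
  ι-⊖ zero    (suc n) = ≈-sym (+-identityˡ _)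
  ι-⊖ (suc m) (suc n) = begin
    ι (suc m ℤ.⊖ suc n)                 ≡⟨ cong ι (ℤ.[1+m]⊖[1+n]≡m⊖n m n) ⟩
    ι (m ℤ.⊖ n)                         ≈⟨ ι-⊖ m n ⟩
    a + - b                             ≈⟨ +-congʳ (+-identityʳ a) ⟨
    (a + 0#) + - b                      ≈⟨ +-congʳ (+-congˡ (-‿inverseʳ 1#)) ⟨
    (a + (1# + - 1#)) + - b             ≈⟨ +-congʳ (+-assoc a 1# (- 1#)) ⟨
    ((a + 1#) + - 1#) + - b             ≈⟨ +-assoc (a + 1#) (- 1#) (- b) ⟩
    (a + 1#) + (- 1# + - b)             ≈⟨ +-cong (+-comm a 1#) (-‿+-comm 1# b) ⟩
    (1# + a) + - (1# + b)               ∎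
    where
    open ≈-Reasoning
    a = fromℕ m
    b = fromℕ n

  ι-+ : ∀ i j → ι (i ℤ.+ j) ≈ ι i + ι j
  ι-+ (ℤ.+ m)  (ℤ.+ n)  = fromℕ-+ m n
  ι-+ (ℤ.+ m)  -[1+ n ] = ι-⊖ m (suc n)
  ι-+ -[1+ m ] (ℤ.+ n)  = ≈-trans (ι-⊖ n (suc m)) (+-comm _ _)
  ι-+ -[1+ m ] -[1+ n ] = begin
    - fromℕ (suc (suc (m ℕ.+ n)))        ≡⟨ cong (-_ ∘ fromℕ ∘ suc) (ℕ.+-suc m n) ⟨
    - fromℕ (suc m ℕ.+ suc n)            ≈⟨ -‿cong (fromℕ-+ (suc m) (suc n)) ⟩
    - (fromℕ (suc m) + fromℕ (suc n))    ≈⟨ -‿+-comm _ _ ⟨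
    - fromℕ (suc m) + - fromℕ (suc n)    ∎
    where
    open ≈-Reasoning

  ≡⇒≈ : ∀ {x y} → x ≡ y → x ≈ y
  ≡⇒≈ refl = ≈-refl

  ι-* : ∀ i j → ι (i ℤ.* j) ≈ ι i * ι j
  ι-* (ℤ.+ m) (ℤ.+ n) = ≈-trans (≡⇒≈ (cong ι (sym (ℤ.pos-* m n)))) (fromℕ-* m n)
  ι-* -[1+ m ] j = begin
    ι (-[1+ m ] ℤ.* j)          ≡⟨ cong ι (ℤ.neg-distribˡ-* (ℤ.+ suc m) j) ⟨
    ι (ℤ.- (ℤ.+ suc m ℤ.* j))   ≈⟨ ι-neg (ℤ.+ suc m ℤ.* j) ⟩
    - ι (ℤ.+ suc m ℤ.* j)       ≈⟨ -‿cong (ι-+* (suc m) j) ⟩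
    - (fromℕ (suc m) * ι j)     ≈⟨ -‿distribˡ-* _ _ ⟩
    ι -[1+ m ] * ι j            ∎
    where
    open ≈-Reasoning
    ι-+* : ∀ m j → ι (ℤ.+ m ℤ.* j) ≈ fromℕ m * ι j
    ι-+* m (ℤ.+ n) = ≈-trans (≡⇒≈ (cong ι (sym (ℤ.pos-* m n)))) (fromℕ-* m n)
    ι-+* m -[1+ n ] = begin
      ι (ℤ.+ m ℤ.* -[1+ n ])          ≡⟨ cong ι (ℤ.neg-distribʳ-* (ℤ.+ m) (ℤ.+ suc n)) ⟨
      ι (ℤ.- (ℤ.+ m ℤ.* ℤ.+ suc n))   ≈⟨ ι-neg (ℤ.+ m ℤ.* ℤ.+ suc n) ⟩
      - ι (ℤ.+ m ℤ.* ℤ.+ suc n)       ≈⟨ -‿cong (ι-+* m (ℤ.+ suc n)) ⟩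
      - (fromℕ m * fromℕ (suc n))     ≈⟨ -‿distribʳ-* _ _ ⟩
      fromℕ m * - fromℕ (suc n)       ∎
  ι-* (ℤ.+ m) -[1+ n ] = begin
    ι (ℤ.+ m ℤ.* -[1+ n ])          ≡⟨ cong ι (ℤ.*-comm (ℤ.+ m) -[1+ n ]) ⟩
    ι (-[1+ n ] ℤ.* ℤ.+ m)          ≈⟨ ι-* -[1+ n ] (ℤ.+ m) ⟩
    ι -[1+ n ] * fromℕ m            ≈⟨ *-comm _ _ ⟩
    fromℕ m * ι -[1+ n ]            ∎
    where open ≈-Reasoning

  -- The solver's constants: unlike ι, κ sends 1 to 1# on the nose.
  κ : ℤ → Carrier
  κ (ℤ.+ 1) = 1#
  κ i       = ι i

  κ≈ι : ∀ i → κ i ≈ ι i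
  κ≈ι (ℤ.+ 0)           = ≈-refl
  κ≈ι (ℤ.+ 1)           = ≈-sym (+-identityʳ 1#)
  κ≈ι (ℤ.+ suc (suc n)) = ≈-refl
  κ≈ι -[1+ n ]          = ≈-refl

  _κ-≟_ : ∀ i j → Maybe (κ i ≈ κ j)
  i κ-≟ j with i ℤ.≟ j
  ... | yes i≡j = just (≡⇒≈ (cong κ i≡j))
  ... | no  _   = nothing

  κ-morphism : ℤ.+-*-rawRing -Raw-AlmostCommutative⟶ fromCommutativeRing commutativeRing
  κ-morphism = record
    { ⟦_⟧    = κ
    ; +-homo = λ i j → ≈-trans (κ≈ι (i ℤ.+ j))
        (≈-trans (ι-+ i j) (≈-sym (+-cong (κ≈ι i) (κ≈ι j))))
    ; *-homo = λ i j → ≈-trans (κ≈ι (i ℤ.* j))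
        (≈-trans (ι-* i j) (≈-sym (*-cong (κ≈ι i) (κ≈ι j))))
    ; -‿homo = λ i → ≈-trans (κ≈ι (ℤ.- i)) (≈-trans (ι-neg i) (≈-sym (-‿cong (κ≈ι i))))
    ; 0-homo = ≈-refl
    ; 1-homo = ≈-refl
    }

  module Solver = RingSolver ℤ.+-*-rawRing (fromCommutativeRing commutativeRing) κ-morphism _κ-≟_
  open Solver using (solve; _:+_; _:*_; _:-_; :-_; _:=_; con)

  :0 :1 : ∀ {n} → Solver.Polynomial n
  :0 = con (ℤ.+ 0)
  :1 = con (ℤ.+ 1)

  -- Arithmetic of ordered fields

  abstract

    ≤-resp : ∀ {x x′ y y′} → x ≈ x′ → y ≈ y′ → x ≤ y → x′ ≤ y′
    ≤-resp x≈x′ y≈y′ x≤y = ≤-trans (≤-reflexive (≈-sym x≈x′)) (≤-trans x≤y (≤-reflexive y≈y′))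

    ≤⇒0≤ : ∀ {x y} → x ≤ y → 0# ≤ y - x
    ≤⇒0≤ {x} {y} x≤y = ≤-resp (-‿inverseˡ x) (+-comm (- x) y) (+-monoʳ-≤ (- x) x≤y)

    0≤⇒≤ : ∀ {x y} → 0# ≤ y - x → x ≤ y
    0≤⇒≤ {x} {y} 0≤ = ≤-resp (+-identityʳ x)
      (solve 2 (λ x y → x :+ (y :- x) := y) ≈-refl x y) (+-monoʳ-≤ x 0≤)

    +-mono-≤ : ∀ {x y u v} → x ≤ y → u ≤ v → x + u ≤ y + v
    +-mono-≤ {x} {y} {u} {v} x≤y u≤v = ≤-trans (+-monoʳ-≤ x u≤v)
      (≤-resp (+-comm v x) (+-comm v y) (+-monoʳ-≤ v x≤y))

    +-nonNeg : ∀ {x y} → 0# ≤ x → 0# ≤ y → 0# ≤ x + y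
    +-nonNeg 0≤x 0≤y = ≤-resp (+-identityˡ 0#) ≈-refl (+-mono-≤ 0≤x 0≤y)

    ≤-by : ∀ {x y z} → 0# ≤ z → z ≈ y - x → x ≤ y
    ≤-by 0≤z z≈ = 0≤⇒≤ (≤-resp ≈-refl z≈ 0≤z)

    *-monoˡ-≤ : ∀ {x y z} → 0# ≤ x → y ≤ z → x * y ≤ x * z
    *-monoˡ-≤ {x} {y} {z} 0≤x y≤z = ≤-by (*-nonNeg 0≤x (≤⇒0≤ y≤z))
      (solve 3 (λ x y z → x :* (z :- y) := x :* z :- x :* y) ≈-refl x y z)

    0≤-neg : ∀ {x} → x ≤ 0# → 0# ≤ - x
    0≤-neg {x} x≤0 = ≤-resp ≈-refl (+-identityˡ (- x)) (≤⇒0≤ x≤0)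

    0≤1 : 0# ≤ 1#
    0≤1 with total 0# 1#
    ... | inj₁ 0≤1 = 0≤1
    ... | inj₂ 1≤0 = ≤-resp ≈-refl (solve 0 (:- :1 :* :- :1 := :1) ≈-refl)
                       (*-nonNeg (0≤-neg 1≤0) (0≤-neg 1≤0))

    _≈?_ : ∀ x y → Dec (x ≈ y)
    x ≈? y = em

    0<1 : 0# < 1#
    0<1 = 0≤1 , 0≉1

    ≉-sym : ∀ {x y} → ¬ (x ≈ y) → ¬ (y ≈ x)
    ≉-sym x≉y y≈x = x≉y (≈-sym y≈x)

    <⊎≥ : ∀ x y → x < y ⊎ y ≤ x
    <⊎≥ x y with total x y | x ≈? y
    ... | inj₂ y≤x | _       = inj₂ y≤x
    ... | inj₁ x≤y | yes x≈y = inj₂ (≤-reflexive (≈-sym x≈y))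
    ... | inj₁ x≤y | no x≉y  = inj₁ (x≤y , x≉y)

    <⇒≱ : ∀ {x y} → x < y → ¬ (y ≤ x)
    <⇒≱ (x≤y , x≉y) y≤x = x≉y (antisym x≤y y≤x)

    <-≤-trans : ∀ {x y z} → x < y → y ≤ z → x < z
    <-≤-trans {x} {y} {z} x<y@(x≤y , _) y≤z =
      ≤-trans x≤y y≤z , λ x≈z → <⇒≱ x<y (≤-trans y≤z (≤-reflexive (≈-sym x≈z)))

    ≤-<-trans : ∀ {x y z} → x ≤ y → y < z → x < z
    ≤-<-trans x≤y y<z@(y≤z , _) =
      ≤-trans x≤y y≤z , λ x≈z → <⇒≱ y<z (≤-trans (≤-reflexive (≈-sym x≈z)) x≤y)

    <-resp : ∀ {x x′ y y′} → x ≈ x′ → y ≈ y′ → x < y → x′ < y′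
    <-resp x≈x′ y≈y′ (x≤y , x≉y) =
      ≤-resp x≈x′ y≈y′ x≤y , λ x′≈y′ → x≉y (≈-trans x≈x′ (≈-trans x′≈y′ (≈-sym y≈y′)))

    pos+nonNeg : ∀ {x y} → 0# < x → 0# ≤ y → 0# < x + y
    pos+nonNeg {x} {y} 0<x 0≤y =
      <-≤-trans 0<x (≤-by 0≤y (solve 2 (λ x y → y := (x :+ y) :- x) ≈-refl x y))

    nonNeg+pos : ∀ {x y} → 0# ≤ x → 0# < y → 0# < x + y
    nonNeg+pos 0≤x 0<y = <-resp ≈-refl (+-comm _ _) (pos+nonNeg 0<y 0≤x)

    +-monoʳ-< : ∀ x {y z} → y < z → x + y < x + z
    +-monoʳ-< x {y} {z} (y≤z , y≉z) = +-monoʳ-≤ x y≤z , λ x+y≈x+z → y≉z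
      (≈-trans (solve 2 (λ x y → y := x :+ y :- x) ≈-refl x y)
        (≈-trans (+-congʳ x+y≈x+z) (solve 2 (λ x z → x :+ z :- x := z) ≈-refl x z)))

    *-cancelˡ-0 : ∀ {x y} → ¬ (x ≈ 0#) → x * y ≈ 0# → y ≈ 0#
    *-cancelˡ-0 {x} {y} x≉0 xy≈0 with inverse x x≉0
    ... | z , xz≈1 = begin
      y            ≈⟨ *-identityˡ y ⟨
      1# * y       ≈⟨ *-congʳ xz≈1 ⟨
      x * z * y    ≈⟨ solve 3 (λ x z y → x :* z :* y := z :* (x :* y)) ≈-refl x z y ⟩
      z * (x * y)  ≈⟨ *-congˡ xy≈0 ⟩
      z * 0#       ≈⟨ zeroʳ z ⟩
      0#           ∎
      where open ≈-Reasoning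

    *-pos : ∀ {x y} → 0# < x → 0# < y → 0# < x * y
    *-pos (0≤x , 0≉x) (0≤y , 0≉y) =
      *-nonNeg 0≤x 0≤y , λ 0≈xy → 0≉y (≈-sym (*-cancelˡ-0 (≉-sym 0≉x) (≈-sym 0≈xy)))

    *-monoˡ-< : ∀ {x y z} → 0# < x → y < z → x * y < x * z
    *-monoˡ-< {x} {y} {z} (0≤x , 0≉x) (y≤z , y≉z) = *-monoˡ-≤ 0≤x y≤z , λ xy≈xz → y≉z
      (≈-trans (solve 2 (λ y z → y := z :- (z :- y)) ≈-refl y z)
        (≈-trans (+-congˡ (-‿cong (*-cancelˡ-0 (≉-sym 0≉x)
          (≈-trans (solve 3 (λ x y z → x :* (z :- y) := x :* z :- x :* y) ≈-refl x y z)
            (≈-trans (+-congˡ (-‿cong xy≈xz)) (-‿inverseʳ _))))))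
          (solve 1 (λ z → z :- :0 := z) ≈-refl z)))

    *-cancelˡ-0≤ : ∀ {x y} → 0# < x → 0# ≤ x * y → 0# ≤ y
    *-cancelˡ-0≤ {x} {y} 0<x 0≤xy with <⊎≥ y 0#
    ... | inj₂ 0≤y       = 0≤y
    ... | inj₁ y<0@(y≤0 , y≉0) = contradiction 0≤xy (<⇒≱ xy<0)
      where
      xy<0 : x * y < 0#
      xy<0 = ≤-by (*-nonNeg (proj₁ 0<x) (0≤-neg y≤0))
               (solve 2 (λ x y → x :* :- y := :0 :- x :* y) ≈-refl x y)
           , λ xy≈0 → y≉0 (*-cancelˡ-0 (≉-sym (proj₂ 0<x)) xy≈0)

    *-cancelˡ-≤ : ∀ {x y z} → 0# < x → x * y ≤ x * z → y ≤ z
    *-cancelˡ-≤ {x} {y} {z} 0<x xy≤xz = 0≤⇒≤ (*-cancelˡ-0≤ 0<x (≤-resp ≈-refl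
      (solve 3 (λ x y z → x :* z :- x :* y := x :* (z :- y)) ≈-refl x y z) (≤⇒0≤ xy≤xz)))

    pos-inverse : ∀ {x} → 0# < x → ∃[ y ] 0# < y × x * y ≈ 1#
    pos-inverse {x} 0<x with inverse x (≉-sym (proj₂ 0<x))
    ... | y , xy≈1 = y , (*-cancelˡ-0≤ 0<x (≤-resp ≈-refl (≈-sym xy≈1) 0≤1) , 0≉y) , xy≈1
      where
      0≉y : ¬ (0# ≈ y)
      0≉y 0≈y = 0≉1 (≈-trans (≈-sym (zeroʳ x)) (≈-trans (*-congˡ 0≈y) xy≈1))

    nonNeg-sum≈0 : ∀ {x y} → 0# ≤ x → 0# ≤ y → x + y ≈ 0# → x ≈ 0# × y ≈ 0#
    nonNeg-sum≈0 {x} {y} 0≤x 0≤y x+y≈0 =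
        antisym (≤-resp (+-identityʳ x) x+y≈0 (+-monoʳ-≤ x 0≤y)) 0≤x
      , antisym (≤-resp (+-identityˡ y) x+y≈0 (+-mono-≤ 0≤x ≤-refl)) 0≤y

    fromℕ-nonNeg : ∀ n → 0# ≤ fromℕ n
    fromℕ-nonNeg zero    = ≤-refl
    fromℕ-nonNeg (suc n) = +-nonNeg 0≤1 (fromℕ-nonNeg n)

    fromℕ-pos : ∀ n → 0# < fromℕ (suc n)
    fromℕ-pos n = pos+nonNeg 0<1 (fromℕ-nonNeg n)

    fromℕ-mono : ∀ {m n} → m ℕ.≤ n → fromℕ m ≤ fromℕ n
    fromℕ-mono {n = n} ℕ.z≤n = fromℕ-nonNeg n
    fromℕ-mono (ℕ.s≤s m≤n) = +-monoʳ-≤ 1# (fromℕ-mono m≤n)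

  -- Finite sums

  sum-cong : ∀ {n} {f g : Vector Carrier n} → (∀ i → f i ≈ g i) → sum f ≈ sum g
  sum-cong = CMSum.sum-cong-≋ +-commutativeMonoid

  sum-zero : ∀ {n} {f : Vector Carrier n} → (∀ i → f i ≈ 0#) → sum f ≈ 0#
  sum-zero {n} f≈0 = ≈-trans (sum-cong f≈0) (CMSum.sum-replicate-zero +-commutativeMonoid n)

  sum-neg : ∀ {n} (f : Vector Carrier n) → sum (λ i → - f i) ≈ - sum f
  sum-neg {zero}  f = ≈-sym -0#≈0#
  sum-neg {suc n} f = ≈-trans (+-congˡ (sum-neg (f ∘ suc))) (-‿+-comm _ _)

  sum-sub : ∀ {n} (f g : Vector Carrier n) → sum (λ i → f i - g i) ≈ sum f - sum g
  sum-sub f g = ≈-trans (∑-distrib-+ f (λ i → - g i)) (+-congˡ (sum-neg g))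

  sum-nonNeg : ∀ {n} {f : Vector Carrier n} → (∀ i → 0# ≤ f i) → 0# ≤ sum f
  sum-nonNeg {zero}  0≤f = ≤-refl
  sum-nonNeg {suc n} 0≤f = +-nonNeg (0≤f zero) (sum-nonNeg (0≤f ∘ suc))

  sum-mono : ∀ {n} {f g : Vector Carrier n} → (∀ i → f i ≤ g i) → sum f ≤ sum g
  sum-mono {zero}  f≤g = ≤-refl
  sum-mono {suc n} f≤g = +-mono-≤ (f≤g zero) (sum-mono (f≤g ∘ suc))

  term≤sum : ∀ {n} {f : Vector Carrier n} → (∀ i → 0# ≤ f i) → ∀ i → f i ≤ sum f
  term≤sum {suc n} {f} 0≤f zero = ≤-resp (+-identityʳ _) ≈-refl
    (+-monoʳ-≤ (f zero) (sum-nonNeg (0≤f ∘ suc)))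
  term≤sum {suc n} {f} 0≤f (suc i) = ≤-resp (+-identityˡ _) ≈-refl
    (+-mono-≤ (0≤f zero) (term≤sum (0≤f ∘ suc) i))

  sum≈0⇒term≈0 : ∀ {n} {f : Vector Carrier n} → (∀ i → 0# ≤ f i) → sum f ≈ 0# → ∀ i → f i ≈ 0#
  sum≈0⇒term≈0 0≤f Σ≈0 i = antisym (≤-trans (term≤sum 0≤f i) (≤-reflexive Σ≈0)) (0≤f i)

  sum-single : ∀ {n} {f : Vector Carrier n} j → (∀ i → i ≢ j → f i ≈ 0#) → sum f ≈ f j
  sum-single zero    f≈0 = ≈-trans (+-congˡ (sum-zero (λ i → f≈0 (suc i) λ ()))) (+-identityʳ _)
  sum-single (suc j) f≈0 = ≈-trans (+-cong (f≈0 zero λ ())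
      (sum-single j (λ i i≢j → f≈0 (suc i) λ { refl → i≢j refl }))) (+-identityˡ _)

  -- The indicator of a proposition. It turns conditions on vertices into coefficients of sums, so
  -- that the weight of a set of vertices becomes an affine function.
  χ : Set → Carrier
  χ P with em {P}
  ... | yes _ = 1#
  ... | no  _ = 0#

  χ-yes : ∀ {P} → P → χ P ≈ 1#
  χ-yes {P} p with em {P}
  ... | yes _ = ≈-refl
  ... | no ¬p = contradiction p ¬p

  χ-no : ∀ {P} → ¬ P → χ P ≈ 0#
  χ-no {P} ¬p with em {P}
  ... | yes p = contradiction p ¬p
  ... | no  _ = ≈-refl

  χ-nonNeg : ∀ P → 0# ≤ χ P
  χ-nonNeg P with em {P}
  ... | yes _ = 0≤1
  ... | no  _ = ≤-refl

  χ≤1 : ∀ P → χ P ≤ 1#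
  χ≤1 P with em {P}
  ... | yes _ = ≤-refl
  ... | no  _ = 0≤1

  χ-*-zero : ∀ {P x} → (P → x ≈ 0#) → χ P * x ≈ 0#
  χ-*-zero {P} {x} x≈0 with em {P}
  ... | yes p = ≈-trans (*-congˡ (x≈0 p)) (zeroʳ 1#)
  ... | no _  = zeroˡ x

  sum-δ : ∀ {n} (f : Vector Carrier n) j → sum (λ i → χ (i ≡ j) * f i) ≈ f j
  sum-δ f j = ≈-trans
    (sum-single j (λ i i≢j → ≈-trans (*-congʳ (χ-no i≢j)) (zeroˡ (f i))))
    (≈-trans (*-congʳ (χ-yes refl)) (*-identityˡ (f j)))

  open Polytopes ℝ

  ≋-sym : ∀ {n} {x y : Point n} → x ≋ y → y ≋ x
  ≋-sym x≋y i = ≈-sym (x≋y i)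

  ≋-trans : ∀ {n} {x y z : Point n} → x ≋ y → y ≋ z → x ≋ z
  ≋-trans x≋y y≋z i = ≈-trans (x≋y i) (y≋z i)

  ∙-cong : ∀ {n} (a : Point n) {x y} → x ≋ y → a ∙ x ≈ a ∙ y
  ∙-cong a x≋y = sum-cong (λ i → *-congˡ (x≋y i))

  sum-comm-* : ∀ {m n} (a : Vector Carrier n) (w : Vector Carrier m) (p : Fin m → Fin n → Carrier) →
               sum (λ k → a k * sum (λ i → w i * p i k)) ≈ sum (λ i → w i * sum (λ k → a k * p i k))
  sum-comm-* a w p = begin
    sum (λ k → a k * sum (λ i → w i * p i k))
      ≈⟨ sum-cong (λ k → *-distribˡ-sum (a k) (λ i → w i * p i k)) ⟩
    sum (λ k → sum (λ i → a k * (w i * p i k)))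
      ≈⟨ ∑-comm (λ k i → a k * (w i * p i k)) ⟩
    sum (λ i → sum (λ k → a k * (w i * p i k)))
      ≈⟨ sum-cong (λ i → sum-cong (λ k →
           solve 3 (λ a w p → a :* (w :* p) := w :* (a :* p)) ≈-refl (a k) (w i) (p i k))) ⟩
    sum (λ i → sum (λ k → w i * (a k * p i k)))
      ≈⟨ sum-cong (λ i → *-distribˡ-sum (w i) (λ k → a k * p i k)) ⟨
    sum (λ i → w i * sum (λ k → a k * p i k))
      ∎
    where open ≈-Reasoning

  ∙-combination : ∀ {m n} (a : Point n) (w : Vector Carrier m) (p : Vector (Point n) m) →
                  a ∙ combination w p ≈ sum (λ i → w i * (a ∙ p i))
  ∙-combination = sum-comm-*

  -- Affine functions

  record IsAffine {n} (f : Point n → Carrier) : Set where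
    field
      normal : Point n
      offset : Carrier
      expand : ∀ x → f x ≈ normal ∙ x + offset

    cong-≋ : ∀ {x y} → x ≋ y → f x ≈ f y
    cong-≋ {x} {y} x≋y = ≈-trans (expand x)
      (≈-trans (+-congʳ (∙-cong normal x≋y)) (≈-sym (expand y)))

    -- The offset is multiplied by the total weight, so the formula also covers weights of sum 0, as
    -- they occur in affine dependences.
    on-combination′ : ∀ {m} (w : Vector Carrier m) (p : Vector (Point n) m) →
      normal ∙ combination w p + sum w * offset ≈ sum (λ i → w i * f (p i))
    on-combination′ w p = begin
      normal ∙ combination w p + sum w * offset
        ≈⟨ +-cong (∙-combination normal w p) (*-distribʳ-sum offset w) ⟩
      sum (λ i → w i * (normal ∙ p i)) + sum (λ i → w i * offset)
        ≈⟨ ∑-distrib-+ (λ i → w i * (normal ∙ p i)) (λ i → w i * offset) ⟨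
      sum (λ i → w i * (normal ∙ p i) + w i * offset)
        ≈⟨ sum-cong (λ i → distribˡ (w i) (normal ∙ p i) offset) ⟨
      sum (λ i → w i * (normal ∙ p i + offset))
        ≈⟨ sum-cong (λ i → *-congˡ (expand (p i))) ⟨
      sum (λ i → w i * f (p i))
        ∎
      where open ≈-Reasoning

    on-combination : ∀ {m} (w : Vector Carrier m) (p : Vector (Point n) m) → sum w ≈ 1# →
      f (combination w p) ≈ sum (λ i → w i * f (p i))
    on-combination w p Σw≈1 = begin
      f (combination w p)                        ≈⟨ expand _ ⟩
      normal ∙ combination w p + offset          ≈⟨ +-congˡ (*-identityˡ offset) ⟨
      normal ∙ combination w p + 1# * offset     ≈⟨ +-congˡ (*-congʳ Σw≈1) ⟨
      normal ∙ combination w p + sum w * offset  ≈⟨ on-combination′ w p ⟩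
      sum (λ i → w i * f (p i))                  ∎
      where open ≈-Reasoning

  open IsAffine using (on-combination)

  affine-≈ : ∀ {n} {f g : Point n → Carrier} → (∀ x → f x ≈ g x) → IsAffine f → IsAffine g
  affine-≈ f≈g F = record
    { expand = λ x → ≈-trans (≈-sym (f≈g x)) (IsAffine.expand F x) }

  ∙-affine : ∀ {n} (a : Point n) → IsAffine (a ∙_)
  ∙-affine a = record { normal = a ; offset = 0# ; expand = λ x → ≈-sym (+-identityʳ _) }

  affine-const : ∀ {n} c → IsAffine {n} (λ _ → c)
  affine-const c = record
    { normal = λ _ → 0# ; offset = c
    ; expand = λ x → ≈-sym (≈-trans (+-congʳ (sum-zero (λ i → zeroˡ (x i)))) (+-identityˡ c)) }

  affine-coordinate : ∀ {n} (i : Fin n) → IsAffine (λ x → x i)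
  affine-coordinate i = affine-≈ (λ x → sum-δ x i) (∙-affine (λ k → χ (k ≡ i)))

  affine-+ : ∀ {n} {f g : Point n → Carrier} → IsAffine f → IsAffine g → IsAffine (λ x → f x + g x)
  affine-+ {_} {f} {g} F G = record
    { normal = λ i → F.normal i + G.normal i
    ; offset = F.offset + G.offset
    ; expand = λ x → begin
        f x + g x
          ≈⟨ +-cong (F.expand x) (G.expand x) ⟩
        (F.normal ∙ x + F.offset) + (G.normal ∙ x + G.offset)
          ≈⟨ solve 4 (λ a b c d → (a :+ b) :+ (c :+ d) := (a :+ c) :+ (b :+ d)) ≈-refl
               (F.normal ∙ x) F.offset (G.normal ∙ x) G.offset ⟩
        (F.normal ∙ x + G.normal ∙ x) + (F.offset + G.offset)
          ≈⟨ +-congʳ (∑-distrib-+ (λ i → F.normal i * x i) (λ i → G.normal i * x i)) ⟨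
        sum (λ i → F.normal i * x i + G.normal i * x i) + (F.offset + G.offset)
          ≈⟨ +-congʳ (sum-cong (λ i → distribʳ (x i) (F.normal i) (G.normal i))) ⟨
        sum (λ i → (F.normal i + G.normal i) * x i) + (F.offset + G.offset)
          ∎ }
    where
    open ≈-Reasoning
    module F = IsAffine F
    module G = IsAffine G

  affine-* : ∀ {n} c {f : Point n → Carrier} → IsAffine f → IsAffine (λ x → c * f x)
  affine-* c {f} F = record
    { normal = λ i → c * F.normal i
    ; offset = c * F.offset
    ; expand = λ x → begin
        c * f x
          ≈⟨ *-congˡ (F.expand x) ⟩
        c * (F.normal ∙ x + F.offset)
          ≈⟨ distribˡ c _ _ ⟩
        c * F.normal ∙ x + c * F.offset
          ≈⟨ +-congʳ (*-distribˡ-sum c (λ i → F.normal i * x i)) ⟩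
        sum (λ i → c * (F.normal i * x i)) + c * F.offset
          ≈⟨ +-congʳ (sum-cong (λ i → *-assoc c (F.normal i) (x i))) ⟨
        sum (λ i → c * F.normal i * x i) + c * F.offset
          ∎ }
    where
    open ≈-Reasoning
    module F = IsAffine F

  affine-neg : ∀ {n} {f : Point n → Carrier} → IsAffine f → IsAffine (λ x → - f x)
  affine-neg {f = f} F = affine-≈
    (λ x → solve 1 (λ a → :- :1 :* a := :- a) ≈-refl (f x)) (affine-* (- 1#) F)

  affine-sub : ∀ {n} {f g : Point n → Carrier} → IsAffine f → IsAffine g → IsAffine (λ x → f x - g x)
  affine-sub F G = affine-+ F (affine-neg G)

  affine-sum : ∀ {m n} {f : Fin m → Point n → Carrier} → (∀ i → IsAffine (f i)) →
               IsAffine (λ x → sum (λ i → f i x))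
  affine-sum {zero}  F = affine-const 0#
  affine-sum {suc m} F = affine-+ (F zero) (affine-sum (F ∘ suc))

  -- The parameter may leave the unit interval: with `- δ` the point moves from `x` directly away
  -- from `y`.
  line : ∀ {n} → Carrier → Point n → Point n → Point n
  line t x y = combination ((1# - t) ∷ t ∷ []) (x ∷ y ∷ [])

  affine-line : ∀ {n} {f : Point n → Carrier} → IsAffine f → ∀ t x y →
                f (line t x y) ≈ (1# - t) * f x + t * f y
  affine-line F t x y = ≈-trans
    (on-combination F ((1# - t) ∷ t ∷ []) (x ∷ y ∷ [])
      (solve 1 (λ t → (:1 :- t) :+ (t :+ :0) := :1) ≈-refl t))
    (+-congˡ (+-identityʳ _))

  line-coordinate : ∀ {n} t (x y : Point n) k → line t x y k ≈ x k + t * (y k - x k)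
  line-coordinate t x y k =
    solve 3 (λ t x y → (:1 :- t) :* x :+ (t :* y :+ :0) := x :+ t :* (y :- x)) ≈-refl t (x k) (y k)

  -- Convex hulls

  convexHull-≋ : ∀ {m n} {p : Vector (Point n) m} {x y} → x ≋ y → x ∈ convexHull p → y ∈ convexHull p
  convexHull-≋ x≋y (w , 0≤w , Σw , x≋) = w , 0≤w , Σw , ≋-trans (≋-sym x≋y) x≋

  unit : ∀ {m} → Fin m → Vector Carrier m
  unit i k = χ (k ≡ i)

  sum-unit : ∀ {m} (i : Fin m) → sum (unit i) ≈ 1#
  sum-unit i = ≈-trans (sum-single i (λ k k≢i → χ-no k≢i)) (χ-yes refl)

  combination-unit : ∀ {m n} (p : Vector (Point n) m) i → p i ≋ combination (unit i) p
  combination-unit p i k = ≈-sym (sum-δ (λ j → p j k) i)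

  generator∈convexHull : ∀ {m n} (p : Vector (Point n) m) i → p i ∈ convexHull p
  generator∈convexHull p i =
    unit i , (λ k → χ-nonNeg _) , sum-unit i , combination-unit p i

  -- A vanishing weight excuses its point from lying in the hull.
  convexHull-mix : ∀ {m l n} (w : Vector Carrier m) (p : Vector (Point n) m) (q : Vector (Point n) l) →
                   (∀ i → 0# ≤ w i) → sum w ≈ 1# → (∀ i → w i ≈ 0# ⊎ p i ∈ convexHull q) →
                   combination w p ∈ convexHull q
  convexHull-mix {m} {l} {n} w p q 0≤w Σw w0⊎p∈ =
    v , (λ j → sum-nonNeg (λ i → *-nonNeg (0≤w i) (u-nonNeg i j))) , Σv , λ k → comb k
    where
    open ≈-Reasoning
    u : Fin m → Vector Carrier l
    u i with w0⊎p∈ i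
    ... | inj₁ _       = λ _ → 0#
    ... | inj₂ (u , _) = u
    u-nonNeg : ∀ i j → 0# ≤ u i j
    u-nonNeg i j with w0⊎p∈ i
    ... | inj₁ _                 = ≤-refl
    ... | inj₂ (_ , 0≤u , _ , _) = 0≤u j
    Σu : ∀ i → w i * sum (u i) ≈ w i
    Σu i with w0⊎p∈ i
    ... | inj₁ w0 = ≈-trans (*-congʳ w0) (≈-trans (zeroˡ _) (≈-sym w0))
    ... | inj₂ (_ , _ , Σu≈1 , _) = ≈-trans (*-congˡ Σu≈1) (*-identityʳ _)
    u-comb : ∀ i k → w i * p i k ≈ w i * sum (λ j → u i j * q j k)
    u-comb i k with w0⊎p∈ i
    ... | inj₁ w0 = ≈-trans (*-congʳ w0) (≈-trans (zeroˡ _) (≈-sym (≈-trans (*-congʳ w0) (zeroˡ _))))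
    ... | inj₂ (_ , _ , _ , p≋) = *-congˡ (p≋ k)
    v : Vector Carrier l
    v j = sum (λ i → w i * u i j)
    Σv : sum v ≈ 1#
    Σv = begin
      sum (λ j → sum (λ i → w i * u i j))  ≈⟨ ∑-comm (λ j i → w i * u i j) ⟩
      sum (λ i → sum (λ j → w i * u i j))  ≈⟨ sum-cong (λ i → *-distribˡ-sum (w i) (u i)) ⟨
      sum (λ i → w i * sum (u i))          ≈⟨ sum-cong Σu ⟩
      sum w                                ≈⟨ Σw ⟩
      1#                                   ∎
    comb : ∀ k → combination w p k ≈ combination v q k
    comb k = begin
      sum (λ i → w i * p i k)
        ≈⟨ sum-cong (λ i → u-comb i k) ⟩
      sum (λ i → w i * sum (λ j → u i j * q j k))
        ≈⟨ sum-cong (λ i → *-congˡ (sum-cong (λ j → *-comm (u i j) (q j k)))) ⟩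
      sum (λ i → w i * sum (λ j → q j k * u i j))
        ≈⟨ sum-comm-* (λ j → q j k) w u ⟨
      sum (λ j → q j k * v j)
        ≈⟨ sum-cong (λ j → *-comm (q j k) (v j)) ⟩
      sum (λ j → v j * q j k)
        ∎

  affine-nonNeg-hull : ∀ {m n} {f : Point n → Carrier} → IsAffine f → (p : Vector (Point n) m) →
                       (∀ i → 0# ≤ f (p i)) → ∀ {x} → x ∈ convexHull p → 0# ≤ f x
  affine-nonNeg-hull F p 0≤f (w , 0≤w , Σw , x≋) = ≤-resp ≈-refl
    (≈-sym (≈-trans (IsAffine.cong-≋ F x≋) (on-combination F w p Σw)))
    (sum-nonNeg (λ i → *-nonNeg (0≤w i) (0≤f i)))

  -- Faces

  ∙-neg : ∀ {n} (a x : Point n) → (λ i → - a i) ∙ x ≈ - (a ∙ x)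
  ∙-neg a x = ≈-trans
    (sum-cong (λ i → solve 2 (λ a x → :- a :* x := :- (a :* x)) ≈-refl (a i) (x i)))
    (sum-neg (λ i → a i * x i))

  -- A sum of nonnegative affine functions vanishes only where all of them do, so intersections of
  -- faces are again of this form. All faces below are built in this way.
  zeroFace : ∀ {n} {K : Pred (Point n) 0ℓ} {f} → IsAffine f → (∀ {x} → x ∈ K → 0# ≤ f x) → Face K
  zeroFace F 0≤f = record
    { normal = λ i → - F.normal i
    ; offset = F.offset
    ; valid  = λ x x∈K → ≤-by (0≤f x∈K) (≈-trans (F.expand x)
        (≈-trans (solve 2 (λ a b → a :+ b := b :- :- a) ≈-refl (F.normal ∙ x) F.offset)
          (+-congˡ (-‿cong (≈-sym (∙-neg F.normal x))))))
    }
    where module F = IsAffine F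

  abstract
    zeroFace-points : ∀ {n} {K : Pred (Point n) 0ℓ} {f} (F : IsAffine f) (0≤f : ∀ {x} → x ∈ K → 0# ≤ f x) →
                      points (zeroFace {K = K} F 0≤f) ≐ (λ x → x ∈ K × f x ≈ 0#)
    zeroFace-points {f = f} F 0≤f =
      (λ {x} (x∈K , tight) → x∈K , (begin
         f x                                      ≈⟨ F.expand x ⟩
         F.normal ∙ x + F.offset                  ≈⟨ +-congˡ tight ⟨
         F.normal ∙ x + (λ i → - F.normal i) ∙ x  ≈⟨ +-congˡ (∙-neg F.normal x) ⟩
         F.normal ∙ x - F.normal ∙ x              ≈⟨ -‿inverseʳ _ ⟩
         0#                                       ∎)) ,
      (λ {x} (x∈K , fx≈0) → x∈K , (begin
         (λ i → - F.normal i) ∙ x                 ≈⟨ ∙-neg F.normal x ⟩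
         - (F.normal ∙ x)                         ≈⟨ solve 2 (λ a b → :- a := b :- (a :+ b)) ≈-refl (F.normal ∙ x) F.offset ⟩
         F.offset - (F.normal ∙ x + F.offset)     ≈⟨ +-congˡ (-‿cong (F.expand x)) ⟨
         F.offset - f x                           ≈⟨ +-congˡ (-‿cong fx≈0) ⟩
         F.offset - 0#                            ≈⟨ solve 1 (λ a → a :- :0 := a) ≈-refl F.offset ⟩
         F.offset                                 ∎))
      where
      open ≈-Reasoning
      module F = IsAffine F

  -- The point `x` lies strictly between `y` and a further point of K. A linear function that
  -- attains its maximum over K at such an `x` is constant along the whole segment.
  tight-beyond : ∀ {n} {K : Pred (Point n) 0ℓ} (F : Face K) {x y δ} → x ∈ points F → y ∈ K →
                 0# < δ → line (- δ) x y ∈ K → y ∈ points F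
  tight-beyond F {x} {y} {δ} (x∈K , nx≈) y∈K 0<δ z∈K =
    y∈K , antisym (F.valid y y∈K) (*-cancelˡ-≤ 0<δ (≤-by (≤⇒0≤ (≤-resp z≈ ≈-refl (F.valid _ z∈K)))
      (solve 3 (λ c δ b → c :- ((:1 :- :- δ) :* c :+ :- δ :* b) := δ :* b :- δ :* c) ≈-refl F.offset δ (F.normal ∙ y))))
    where
    module F = Face F
    z≈ : F.normal ∙ line (- δ) x y ≈ (1# - - δ) * F.offset + - δ * F.normal ∙ y
    z≈ = ≈-trans (affine-line (∙-affine F.normal) (- δ) x y) (+-congʳ (*-congˡ nx≈))

  -- Interior points

  ∣_∣-bound : ∀ x → ∃[ b ] 0# ≤ b × x ≤ b × - x ≤ b
  ∣ x ∣-bound with total 0# x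
  ... | inj₁ 0≤x = x , 0≤x , ≤-refl , ≤-by (+-nonNeg 0≤x 0≤x) (solve 1 (λ x → x :+ x := x :- :- x) ≈-refl x)
  ... | inj₂ x≤0 = - x , 0≤-neg x≤0 , ≤-by (+-nonNeg (0≤-neg x≤0) (0≤-neg x≤0)) (solve 1 (λ x → :- x :+ :- x := :- x :- x) ≈-refl x) , ≤-refl

  scale-below : ∀ {S ε} → 0# ≤ S → 0# < ε → ∃[ δ ] 0# < δ × (∀ {c} → c ≤ S → δ * c < ε)
  scale-below {S} {ε} 0≤S 0<ε with pos-inverse (pos+nonNeg 0<1 0≤S)
  -- Here `δ = ε / (1 + S)`: the summand 1 makes the denominator positive and the resulting
  -- inequality strict.
  ... | M , 0<M , SM≈1 = ε * M , *-pos 0<ε 0<M , λ c≤S →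
    ≤-<-trans (*-monoˡ-≤ (proj₁ (*-pos 0<ε 0<M)) c≤S)
      (<-resp (+-identityʳ _) εMS+εM≈ε (+-monoʳ-< (ε * M * S) (*-pos 0<ε 0<M)))
    where
    εMS+εM≈ε : ε * M * S + ε * M ≈ ε
    εMS+εM≈ε = ≈-trans
      (solve 2 (λ a s → a :* s :+ a := a :* (:1 :+ s)) ≈-refl (ε * M) S)
      (≈-trans (solve 3 (λ e m t → e :* m :* t := e :* (t :* m)) ≈-refl ε M (1# + S))
        (≈-trans (*-congˡ SM≈1) (*-identityʳ ε)))

  small-multiple : ∀ {n} (f : Vector Carrier n) {ε} → 0# < ε →
                   ∃[ δ ] 0# < δ × (∀ k → δ * f k < ε × δ * - f k < ε)
  small-multiple f 0<ε =
    let (δ , 0<δ , below) = scale-below (sum-nonNeg 0≤b) 0<ε in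
    δ , 0<δ , λ k → let (_ , f≤b , -f≤b) = proj₂ ∣ f k ∣-bound in
      below (≤-trans f≤b (term≤sum 0≤b k)) , below (≤-trans -f≤b (term≤sum 0≤b k))
    where
    0≤b = λ k → proj₁ (proj₂ ∣ f k ∣-bound)

  -- From an interior point one can step away from any `y` in S without leaving S, so a face of S
  -- through that point contains `y`. Apply this to the face that S shares with T.
  interior⇒⊆ : ∀ {d n} (S : Simplex d n) {T : Pred (Point n) 0ℓ} → IsFaceOf (hull S ∩ T) (hull S) →
               ∀ {x} → x ∈ interior S → x ∈ T → hull S ⊆ T
  interior⇒⊆ S (F , F⊆ , ⊆F) {x} (x∈S@(v , _ , Σv , x≋) , ε , 0<ε , ball) x∈T {y} y∈S@(w , _ , Σw , y≋) =
    proj₂ (F⊆ (tight-beyond F (⊆F (x∈S , x∈T)) y∈S 0<δ z∈S))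
    where
    p = vertex S
    step = small-multiple (λ k → x k - y k) 0<ε
    δ = proj₁ step
    0<δ = proj₁ (proj₂ step)
    small = proj₂ (proj₂ step)
    u = λ i → (1# - - δ) * v i + - δ * w i
    z∈aff : line (- δ) x y ∈ affineHull p
    z∈aff = u
      , (begin
          sum u
            ≈⟨ ∑-distrib-+ (λ i → (1# - - δ) * v i) (λ i → - δ * w i) ⟩
          sum (λ i → (1# - - δ) * v i) + sum (λ i → - δ * w i)
            ≈⟨ +-cong (*-distribˡ-sum (1# - - δ) v) (*-distribˡ-sum (- δ) w) ⟨
          (1# - - δ) * sum v + - δ * sum w
            ≈⟨ +-cong (*-congˡ Σv) (*-congˡ Σw) ⟩
          (1# - - δ) * 1# + - δ * 1#
            ≈⟨ solve 1 (λ δ → (:1 :- :- δ) :* :1 :+ :- δ :* :1 := :1) ≈-refl δ ⟩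
          1# ∎)
      , λ k → begin
          (1# - - δ) * x k + (- δ * y k + 0#)
            ≈⟨ +-cong (*-congˡ (x≋ k)) (≈-trans (+-identityʳ _) (*-congˡ (y≋ k))) ⟩
          (1# - - δ) * sum (λ i → v i * p i k) + - δ * sum (λ i → w i * p i k)
            ≈⟨ +-cong (*-distribˡ-sum (1# - - δ) (λ i → v i * p i k)) (*-distribˡ-sum (- δ) (λ i → w i * p i k)) ⟩
          sum (λ i → (1# - - δ) * (v i * p i k)) + sum (λ i → - δ * (w i * p i k))
            ≈⟨ ∑-distrib-+ (λ i → (1# - - δ) * (v i * p i k)) (λ i → - δ * (w i * p i k)) ⟨
          sum (λ i → (1# - - δ) * (v i * p i k) + - δ * (w i * p i k))
            ≈⟨ sum-cong (λ i → solve 5 (λ a v p b w → a :* (v :* p) :+ b :* (w :* p) := (a :* v :+ b :* w) :* p)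
                 ≈-refl (1# - - δ) (v i) (p i k) (- δ) (w i)) ⟩
          sum (λ i → u i * p i k)
            ∎
      where
      open ≈-Reasoning
    z∈S : line (- δ) x y ∈ hull S
    z∈S = ball _ z∈aff λ k →
        <-resp (≈-trans (solve 3 (λ δ x y → x :+ δ :* (x :- y) := x :+ :- δ :* (y :- x)) ≈-refl δ (x k) (y k))
                 (≈-sym (line-coordinate (- δ) x y k)))
          ≈-refl (+-monoʳ-< (x k) (proj₁ (small k)))
      , <-resp (≈-trans (+-congʳ (line-coordinate (- δ) x y k))
                 (solve 3 (λ δ x y → (x :+ :- δ :* (y :- x)) :+ δ :* :- (x :- y) := x) ≈-refl δ (x k) (y k)))
          ≈-refl (+-monoʳ-< (line (- δ) x y k) (proj₂ (small k)))

  -- Faces of polyhedra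

  by-contradiction : {P : Set} → ¬ ¬ P → P
  by-contradiction = decidable-stable em

  ¬∀⇒∃¬ : {A : Set} {P : A → Set} → ¬ (∀ x → P x) → ∃[ x ] ¬ P x
  ¬∀⇒∃¬ ¬∀ = by-contradiction λ ¬∃ → ¬∀ λ x → by-contradiction λ ¬Px → ¬∃ (x , ¬Px)

  nonNeg∧≉0⇒pos : ∀ {x} → 0# ≤ x → ¬ (x ≈ 0#) → 0# < x
  nonNeg∧≉0⇒pos 0≤x x≉0 = 0≤x , ≉-sym x≉0

  half : ∃[ h ] 0# < h × fromℕ 2 * h ≈ 1#
  half = pos-inverse (fromℕ-pos 1)

  ½ : Carrier
  ½ = proj₁ half

  0<½ : 0# < ½
  0<½ = proj₁ (proj₂ half)

  ½*2≈1 : ½ * fromℕ 2 ≈ 1#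
  ½*2≈1 = ≈-trans (*-comm _ _) (proj₂ (proj₂ half))

  0<1-½ : 0# < 1# - ½
  0<1-½ = <-resp ≈-refl
    (≈-trans (solve 1 (λ h → h := h :* (:1 :+ (:1 :+ :0)) :- h) ≈-refl ½) (+-congʳ ½*2≈1)) 0<½

  -- Vacuous for the empty face: there even two opposite facet functions vanish, which is how the
  -- empty face is told apart later.
  Vanishes : ∀ {n} {K : Pred (Point n) 0ℓ} → Face K → (Point n → Carrier) → Set
  Vanishes F f = ∀ x → x ∈ points F → f x ≈ 0#

  -- A nonempty face is cut out by the inequalities that are tight on it: it has a
  -- point z at which all others are strict, and from which one can move a little
  -- away from any x that satisfies the tight ones.
  module Polyhedron {n m} {K : Pred (Point n) 0ℓ} (f : Fin m → Point n → Carrier)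
    (affine : ∀ k → IsAffine (f k))
    (K⊆ : ∀ {x} → x ∈ K → ∀ k → 0# ≤ f k x)
    (⊆K : ∀ {x} → (∀ k → 0# ≤ f k x) → x ∈ K)
    (F : Face K)
    where

    private module F = Face F

    midpoint∈ : ∀ {x y} → x ∈ points F → y ∈ points F → line ½ x y ∈ points F
    midpoint∈ {x} {y} (x∈K , x-tight) (y∈K , y-tight) =
        ⊆K (λ k → ≤-resp ≈-refl (≈-sym (affine-line (affine k) ½ x y))
          (+-nonNeg (*-nonNeg (proj₁ 0<1-½) (K⊆ x∈K k))
                    (*-nonNeg (proj₁ 0<½) (K⊆ y∈K k))))
      , ≈-trans (affine-line (∙-affine F.normal) ½ x y)
          (≈-trans (+-cong (*-congˡ x-tight) (*-congˡ y-tight))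
            (solve 2 (λ h c → (:1 :- h) :* c :+ h :* c := c) ≈-refl ½ F.offset))

    -- Induction on the number of selected inequalities. The midpoint of a point that is good for
    -- the others and a point where the new one is strict is good for all, since no term becomes
    -- negative on K.
    generic : ∀ {l} (σ : Fin l → Fin m) → ∃ (points F) →
              ∃[ z ] z ∈ points F × (∀ k → ¬ Vanishes F (f (σ k)) → 0# < f (σ k) z)
    generic {zero}  σ (z , z∈F) = z , z∈F , λ ()
    generic {suc l} σ ∃F with generic (σ ∘ suc) ∃F | em {Vanishes F (f (σ zero))}
    ... | z , z∈F , z-pos | yes vanishes = z , z∈F , λ
      { zero ¬v → contradiction vanishes ¬v ; (suc k) ¬v → z-pos k ¬v }
    ... | z , z∈F@(z∈K , _) , z-pos | no ¬vanishes = line ½ z y , midpoint∈ z∈F y∈F , λ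
      { zero ¬v    → <-resp ≈-refl (≈-sym (affine-line (affine (σ zero)) ½ z y))
          (nonNeg+pos (*-nonNeg (proj₁ 0<1-½) (K⊆ z∈K (σ zero))) (*-pos 0<½ 0<fy))
      ; (suc k) ¬v → <-resp ≈-refl (≈-sym (affine-line (affine (σ (suc k))) ½ z y))
          (pos+nonNeg (*-pos 0<1-½ (z-pos k ¬v)) (*-nonNeg (proj₁ 0<½) (K⊆ (proj₁ y∈F) (σ (suc k))))) }
      where
      witness : ∃[ y ] y ∈ points F × ¬ (f (σ zero) y ≈ 0#)
      witness = by-contradiction λ ¬∃ → ¬vanishes λ y y∈F →
        by-contradiction λ fy≉0 → ¬∃ (y , y∈F , fy≉0)
      y = proj₁ witness
      y∈F = proj₁ (proj₂ witness)
      0<fy = nonNeg∧≉0⇒pos (K⊆ (proj₁ y∈F) (σ zero)) (proj₂ (proj₂ witness))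

    ratio : ∀ {a b} → 0# ≤ a → ∃[ c ] 0# ≤ c × (0# < b → a ≈ c * b)
    ratio {a} {b} 0≤a with <⊎≥ 0# b
    ... | inj₂ b≤0 = 0# , ≤-refl , λ 0<b → contradiction b≤0 (<⇒≱ 0<b)
    ... | inj₁ 0<b = let (b⁻¹ , 0<b⁻¹ , bb⁻¹≈1) = pos-inverse 0<b in
      a * b⁻¹ , *-nonNeg 0≤a (proj₁ 0<b⁻¹) , λ _ → ≈-sym
        (≈-trans (solve 3 (λ a b c → a :* c :* b := a :* (b :* c)) ≈-refl a b b⁻¹)
          (≈-trans (*-congˡ bb⁻¹≈1) (*-identityʳ a)))

    cut-out : ∃ (points F) → ∀ {x} → x ∈ K → (∀ k → Vanishes F (f k) → f k x ≈ 0#) → x ∈ points F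
    cut-out ∃F {x} x∈K zero-at =
      tight-beyond F z∈F x∈K 0<δ (⊆K (λ k → ≤-resp ≈-refl (≈-sym (affine-line (affine k) (- δ) z x)) (nonNeg k)))
      where
      interior-point = generic (λ k → k) ∃F
      z = proj₁ interior-point
      z∈F = proj₁ (proj₂ interior-point)
      z-pos = proj₂ (proj₂ interior-point)
      0≤fx = K⊆ x∈K
      0≤fz = K⊆ (proj₁ z∈F)
      c : ∀ k → ∃[ c ] 0# ≤ c × (0# < f k z → f k x ≈ c * f k z)
      c k = ratio (0≤fx k)
      -- Each ratio of `f k x` to `f k z` is at most the sum of all of them, so a single `δ` makes
      -- `δ` times every ratio less than 1.
      scale = scale-below (sum-nonNeg (λ k → proj₁ (proj₂ (c k)))) 0<1
      δ = proj₁ scale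
      0<δ = proj₁ (proj₂ scale)
      nonNeg : ∀ k → 0# ≤ (1# - - δ) * f k z + - δ * f k x
      nonNeg k with em {Vanishes F (f k)}
      ... | yes v = ≤-reflexive (≈-sym (≈-trans (+-cong (*-congˡ (v z z∈F)) (*-congˡ (zero-at k v)))
              (solve 1 (λ δ → (:1 :- :- δ) :* :0 :+ :- δ :* :0 := :0) ≈-refl δ)))
      ... | no ¬v = ≤-resp ≈-refl
              (solve 3 (λ δ a b → (a :- δ :* b) :+ δ :* a := (:1 :- :- δ) :* a :+ :- δ :* b) ≈-refl δ (f k z) (f k x))
              (+-nonNeg (≤⇒0≤ δfx≤fz) (*-nonNeg (proj₁ 0<δ) (0≤fz k)))
        where
        ck = proj₁ (c k)
        δfx≤fz : δ * f k x ≤ f k z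
        δfx≤fz = ≤-resp
          (≈-trans (solve 3 (λ δ c a → a :* (δ :* c) := δ :* (c :* a)) ≈-refl δ ck (f k z))
            (*-congˡ (≈-sym (proj₂ (proj₂ (c k)) (z-pos k ¬v)))))
          (*-identityʳ (f k z))
          (*-monoˡ-≤ (0≤fz k) (proj₁ (proj₂ (proj₂ scale) (term≤sum (λ k → proj₁ (proj₂ (c k))) k))))

  -- Face lattices of cubes

  all-sides : ∀ {m n} {P : Fin m ⊎ Fin n → Set} → (∀ k → P (splitAt m k)) → ∀ s → P s
  all-sides {m} {n} {P} p s = subst P (splitAt-join m n s) (p (join m n s))

  -- The facets of K come in d opposite pairs, and each choice of one facet from
  -- every pair is the set of facets through some corner.
  record CubeShape d (K : Pred (Point d) 0ℓ) : Set where
    field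
      facet      : Fin d → Bool → Point d → Carrier
      affine     : ∀ i b → IsAffine (facet i b)
      K⊆         : ∀ {x} → x ∈ K → ∀ i b → 0# ≤ facet i b x
      ⊆K         : ∀ {x} → (∀ i b → 0# ≤ facet i b x) → x ∈ K
      corner     : (Fin d → Bool) → Point d
      corner-on  : ∀ ε i → facet i (ε i) (corner ε) ≈ 0#
      corner-off : ∀ ε {i b} → b ≢ ε i → 0# < facet i b (corner ε)
      disjoint   : ∀ {x} → x ∈ K → ∀ i → 0# < facet i false x + facet i true x

    corner∈K : ∀ ε → corner ε ∈ K
    corner∈K ε = ⊆K λ i b → nonNeg i b
      where
      nonNeg : ∀ i b → 0# ≤ facet i b (corner ε)
      nonNeg i b with em {b ≡ ε i}
      ... | yes refl = ≤-reflexive (≈-sym (corner-on ε i))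
      ... | no b≢    = proj₁ (corner-off ε b≢)

    side : Fin d ⊎ Fin d → Point d → Carrier
    side (inj₁ i) = facet i false
    side (inj₂ i) = facet i true

    -- A nonempty face is a case of the statement for polyhedra. For an empty one the hypothesis
    -- places `x` on two opposite facets, which `disjoint` forbids; the index `i₀` provides such a
    -- pair.
    cut-out : Fin d → (F : Face K) → ∀ {x} → x ∈ K →
              (∀ i b → Vanishes F (facet i b) → facet i b x ≈ 0#) → x ∈ points F
    cut-out i₀ F {x} x∈K zero-at with em {∃ (points F)}
    ... | yes ∃F = Polyhedron.cut-out (side ∘ splitAt d) (affine-side ∘ splitAt d)
            (λ y∈K → nonNeg-side y∈K ∘ splitAt d) from-sides F ∃F x∈K (zero-side ∘ splitAt d)
      where
      affine-side : ∀ s → IsAffine (side s)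
      affine-side (inj₁ i) = affine i false
      affine-side (inj₂ i) = affine i true
      nonNeg-side : ∀ {y} → y ∈ K → ∀ s → 0# ≤ side s y
      nonNeg-side y∈K (inj₁ i) = K⊆ y∈K i false
      nonNeg-side y∈K (inj₂ i) = K⊆ y∈K i true
      from-sides : ∀ {y} → (∀ k → 0# ≤ side (splitAt d k) y) → y ∈ K
      from-sides {y} 0≤ = ⊆K λ
        { i false → all-sides {P = λ s → 0# ≤ side s y} 0≤ (inj₁ i)
        ; i true  → all-sides {P = λ s → 0# ≤ side s y} 0≤ (inj₂ i) }
      zero-side : ∀ s → Vanishes F (side s) → side s x ≈ 0#
      zero-side (inj₁ i) = zero-at i false
      zero-side (inj₂ i) = zero-at i true
    ... | no ¬∃F = contradiction
            (≈-sym (≈-trans (+-cong (zero-at i₀ false λ y y∈F → contradiction (y , y∈F) ¬∃F)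
                                    (zero-at i₀ true  λ y y∈F → contradiction (y , y∈F) ¬∃F))
                            (+-identityʳ 0#)))
            (proj₂ (disjoint x∈K i₀))

  module _ {d} {K K′ : Pred (Point d) 0ℓ} (S : CubeShape d K) (S′ : CubeShape d K′) where
    private
      module S = CubeShape S
      module S′ = CubeShape S′

    private
      -- The sum of those facet functions of K′ whose counterparts on K vanish on F. Its zero set in
      -- K′ is the intersection of the corresponding facets, and this is the image of F under the
      -- isomorphism.
      tightness : Face K → Point d → Carrier
      tightness F x = sum (λ i → χ (Vanishes F (S.facet i false)) * S′.facet i false x
                               + χ (Vanishes F (S.facet i true)) * S′.facet i true x)

      tightness-affine : ∀ F → IsAffine (tightness F)
      tightness-affine F = affine-sum (λ i →
        affine-+ (affine-* _ (S′.affine i false)) (affine-* _ (S′.affine i true)))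

      term-nonNeg : ∀ (F : Face K) {x} → x ∈ K′ → ∀ i b → 0# ≤ χ (Vanishes F (S.facet i b)) * S′.facet i b x
      term-nonNeg F x∈K′ i b = *-nonNeg (χ-nonNeg _) (S′.K⊆ x∈K′ i b)

      tightness-nonNeg : ∀ F {x} → x ∈ K′ → 0# ≤ tightness F x
      tightness-nonNeg F x∈K′ = sum-nonNeg λ i → +-nonNeg (term-nonNeg F x∈K′ i false) (term-nonNeg F x∈K′ i true)

    abstract
      transfer : Face K → Face K′
      transfer F = zeroFace (tightness-affine F) (tightness-nonNeg F)

      transfer⇒ : ∀ (F : Face K) {x} → x ∈ points (transfer F) →
                  ∀ i b → Vanishes F (S.facet i b) → S′.facet i b x ≈ 0#
      transfer⇒ F {x} x∈ i b v = ≈-trans (≈-sym (≈-trans (*-congʳ (χ-yes v)) (*-identityˡ _))) (term≈0 b)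
        where
        zero-point : x ∈ K′ × tightness F x ≈ 0#
        zero-point = proj₁ (zeroFace-points (tightness-affine F) (tightness-nonNeg F)) x∈
        x∈K′ : x ∈ K′
        x∈K′ = proj₁ zero-point
        both : χ (Vanishes F (S.facet i false)) * S′.facet i false x
             + χ (Vanishes F (S.facet i true)) * S′.facet i true x ≈ 0#
        both = sum≈0⇒term≈0 (λ i → +-nonNeg (term-nonNeg F x∈K′ i false) (term-nonNeg F x∈K′ i true)) (proj₂ zero-point) i
        term≈0 : ∀ b → χ (Vanishes F (S.facet i b)) * S′.facet i b x ≈ 0#
        term≈0 false = proj₁ (nonNeg-sum≈0 (term-nonNeg F x∈K′ i false) (term-nonNeg F x∈K′ i true) both)
        term≈0 true  = proj₂ (nonNeg-sum≈0 (term-nonNeg F x∈K′ i false) (term-nonNeg F x∈K′ i true) both)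

      transfer⇐ : ∀ (F : Face K) {x} → x ∈ K′ → (∀ i b → Vanishes F (S.facet i b) → S′.facet i b x ≈ 0#) →
                  x ∈ points (transfer F)
      transfer⇐ F {x} x∈K′ zero-at = proj₂ (zeroFace-points (tightness-affine F) (tightness-nonNeg F))
        (x∈K′ , sum-zero (λ i → ≈-trans
          (+-cong (χ-*-zero (zero-at i false)) (χ-*-zero (zero-at i true))) (+-identityʳ 0#)))

    Vanishes-transfer⁺ : ∀ (F : Face K) {i b} → Vanishes F (S.facet i b) → Vanishes (transfer F) (S′.facet i b)
    Vanishes-transfer⁺ F {i} {b} v x x∈ = transfer⇒ F x∈ i b v

    -- If F is nonempty then the facets containing it are pairwise not opposite, so
    -- some corner of K′ lies on all their counterparts and on no further facet i b.
    Vanishes-transfer⁻ : ∀ (F : Face K) {i b} → Vanishes (transfer F) (S′.facet i b) → Vanishes F (S.facet i b)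
    Vanishes-transfer⁻ F {i} {b} v′ with em {∃ (points F)}
    ... | no ¬∃F       = λ y y∈F → contradiction (y , y∈F) ¬∃F
    ... | yes (z , z∈F) = by-contradiction λ ¬v →
      proj₂ (S′.corner-off ε {i} {b} (avoids ¬v)) (≈-sym (v′ (S′.corner ε)
        (transfer⇐ F (S′.corner∈K ε) λ j c v → subst (λ c → S′.facet j c (S′.corner ε) ≈ 0#) (through j c v) (S′.corner-on ε j))))
      where
      ε : Fin d → Bool
      ε j with em {Vanishes F (S.facet j true)} | em {Vanishes F (S.facet j false)}
      ... | yes _ | _     = true
      ... | no _  | yes _ = false
      -- A coordinate in which F lies on neither facet is free; the choice `not b` keeps the corner
      -- off the facet `i b` when `j` is `i`.
      ... | no _  | no _  = not b
      through : ∀ j c → Vanishes F (S.facet j c) → ε j ≡ c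
      through j c v with em {Vanishes F (S.facet j true)} | em {Vanishes F (S.facet j false)}
      through j true  v | yes _  | _     = refl
      through j false v | yes v′ | _     = contradiction
        (≈-sym (≈-trans (+-cong (v z z∈F) (v′ z z∈F)) (+-identityʳ 0#))) (proj₂ (S.disjoint (proj₁ z∈F) j))
      through j true  v | no ¬v  | _     = contradiction v ¬v
      through j false v | no _   | yes _ = refl
      through j false v | no _   | no ¬v = contradiction v ¬v
      avoids : ¬ Vanishes F (S.facet i b) → b ≢ ε i
      avoids ¬v with em {Vanishes F (S.facet i true)} | em {Vanishes F (S.facet i false)}
      avoids ¬v | yes v | _     = λ { refl → ¬v v }
      avoids ¬v | no _  | yes v = λ { refl → ¬v v }
      avoids ¬v | no _  | no _  = λ b≡not → not-fixed b b≡not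
        where
        not-fixed : ∀ b → b ≢ not b
        not-fixed true ()
        not-fixed false ()

  module _ {d} {K K′ : Pred (Point d) 0ℓ} (i₀ : Fin d) (S : CubeShape d K) (S′ : CubeShape d K′) where
    private
      module S = CubeShape S
      module S′ = CubeShape S′

    transfer-mono : ∀ {F G} → points F ⊆ points G → points (transfer S S′ F) ⊆ points (transfer S S′ G)
    transfer-mono {F} {G} F⊆G {x} x∈ = transfer⇐ S S′ G
      (proj₁ x∈) λ i b v → transfer⇒ S S′ F x∈ i b λ y y∈F → v y (F⊆G y∈F)

    transfer-cancel : ∀ {F G} → points (transfer S S′ F) ⊆ points (transfer S S′ G) → points F ⊆ points G
    transfer-cancel {F} {G} F⊆G {x} x∈F = S.cut-out i₀ G (proj₁ x∈F) λ i b v →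
      Vanishes-transfer⁻ S S′ F (λ y y∈ → Vanishes-transfer⁺ S S′ G v y (F⊆G y∈)) x x∈F

    transfer-inverse : ∀ G → points (transfer S S′ (transfer S′ S G)) ≐ points G
    transfer-inverse G =
        (λ {x} x∈ → S′.cut-out i₀ G (proj₁ x∈) λ i b v →
          transfer⇒ S S′ _ x∈ i b (Vanishes-transfer⁺ S′ S G v))
      , (λ {x} x∈G → transfer⇐ S S′ _ (proj₁ x∈G) λ i b v → Vanishes-transfer⁻ S′ S G v x x∈G)

    -- A face is determined by the set of facets that contain it, and `transfer` preserves and
    -- reflects membership in this set. Hence transferring back and forth returns the same point
    -- set.
    cubeShape-≅ : faceLattice K ≅ faceLattice K′
    cubeShape-≅ = transfer S S′ , record
      { isOrderMonomorphism = record
        { isOrderHomomorphism = record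
          { cong = λ {F} {G} (F⊆G , G⊆F) → transfer-mono {F} {G} F⊆G , transfer-mono {G} {F} G⊆F
          ; mono = λ {F} {G} → transfer-mono {F} {G} }
        ; injective = λ {F} {G} (F⊆G , G⊆F) → transfer-cancel {F} {G} F⊆G , transfer-cancel {G} {F} G⊆F
        ; cancel = λ {F} {G} → transfer-cancel {F} {G} }
      ; surjective = λ G → transfer S′ S G , λ {F} (F⊆ , ⊆F) →
          (λ x∈ → proj₁ (transfer-inverse G) (transfer-mono {F} {transfer S′ S G} F⊆ x∈))
        , (λ x∈G → transfer-mono {transfer S′ S G} {F} ⊆F (proj₂ (transfer-inverse G) x∈G)) }

  unitCube-shape : ∀ d → CubeShape d (unitCube d)
  unitCube-shape d = record
    { facet      = λ i b x → side b (x i)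
    ; affine     = affine
    ; K⊆         = λ { x∈ i false → proj₁ (x∈ i) ; x∈ i true → ≤⇒0≤ (proj₂ (x∈ i)) }
    ; ⊆K         = λ 0≤ i → 0≤ i false , 0≤⇒≤ (0≤ i true)
    ; corner     = λ ε i → bit (ε i)
    ; corner-on  = λ ε i → on (ε i)
    ; corner-off = λ ε {i} {b} → off b (ε i)
    ; disjoint   = λ {x} _ i → <-resp ≈-refl
        (solve 1 (λ x → :1 := x :+ (:1 :- x)) ≈-refl (x i)) 0<1
    }
    where
    side : Bool → Carrier → Carrier
    side false t = t
    side true  t = 1# - t
    affine : ∀ i b → IsAffine (λ (x : Point d) → side b (x i))
    affine i false = affine-coordinate i
    affine i true  = affine-sub (affine-const 1#) (affine-coordinate i)
    bit : Bool → Carrier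
    bit b = if b then 1# else 0#
    on : ∀ b → side b (bit b) ≈ 0#
    on false = ≈-refl
    on true  = -‿inverseʳ 1#
    off : ∀ b c → b ≢ c → 0# < side b (bit c)
    off false true  _   = 0<1
    off true  false _   = <-resp ≈-refl (solve 0 (:1 := :1 :- :0) ≈-refl) 0<1
    off false false b≢b = contradiction refl b≢b
    off true  true  b≢b = contradiction refl b≢b

  -- Triangulated cubes and the polytopes they define

  affine-pos-hull : ∀ {m n} {f : Point n → Carrier} → IsAffine f → (p : Vector (Point n) m) →
                    (∀ i → 0# < f (p i)) → ∀ {x} → x ∈ convexHull p → 0# < f x
  affine-pos-hull {f = f} F p 0<f {x} x∈@(w , 0≤w , Σw , x≋) =
    affine-nonNeg-hull F p (proj₁ ∘ 0<f) x∈ , λ 0≈fx → 0≉1 (≈-trans (≈-sym (sum-zero (λ i →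
      *-cancelˡ-0 (≉-sym (proj₂ (0<f i))) (≈-trans (*-comm _ _)
        (sum≈0⇒term≈0 (λ i → *-nonNeg (0≤w i) (proj₁ (0<f i))) (Σ≈0 0≈fx) i))))) Σw)
    where
    Σ≈0 : 0# ≈ f x → sum (λ i → w i * f (p i)) ≈ 0#
    Σ≈0 0≈fx = ≈-trans (≈-sym (on-combination F w p Σw)) (≈-trans (≈-sym (IsAffine.cong-≋ F x≋)) (≈-sym 0≈fx))

  -- The polytope is { x | all facet i b x ≥ 0 }.  A simplex is a chain σ s
  -- of vertices, and β s are its barycentric coordinates, extended to ℝᵈ.
  record TriangulatedCube (d size : ℕ) : Set₁ where
    field
      facet           : Fin d → Bool → Point d → Carrier
      facet-affine    : ∀ i b → IsAffine (facet i b)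
      V               : Set
      -- The order is only partial because the vertices of a product are pairs, compared
      -- componentwise.
      _⊑_             : V → V → Set
      ⊑-isPartialOrder : IsPartialOrder _≡_ _⊑_
      point           : V → Point d
      bit             : V → Fin d → Bool
      bit-injective   : ∀ {u v} → (∀ i → bit u i ≡ bit v i) → u ≡ v
      vertexOf        : (Fin d → Bool) → V
      bit-vertexOf    : ∀ ε i → bit (vertexOf ε) i ≡ ε i
      facet-on        : ∀ v i → facet i (bit v i) (point v) ≈ 0#
      facet-off       : ∀ v i {b} → b ≢ bit v i → 0# < facet i b (point v)
      Index           : Set
      index           : Index ↔ Fin size
      σ               : Index → Fin (suc d) → V
      σ-mono          : ∀ s {k l} → k Fin.≤ l → σ s k ⊑ σ s l
      σ-injective     : ∀ s {k l} → σ s k ≡ σ s l → k ≡ l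
      β               : Index → Fin (suc d) → Point d → Carrier
      β-affine        : ∀ s k → IsAffine (β s k)
      β-sum           : ∀ s x → sum (λ k → β s k x) ≈ 1#
      β-combination   : ∀ s x → x ≋ combination (λ k → β s k x) (point ∘ σ s)
      independent     : ∀ s → AffinelyIndependent (point ∘ σ s)

    Inside : Pred (Point d) 0ℓ
    Inside x = ∀ i b → 0# ≤ facet i b x

    _∈ₛ_ : Point d → Index → Set
    x ∈ₛ s = ∀ k → 0# ≤ β s k x

    _∉ₛ_ : V → Index → Set
    v ∉ₛ s = ∀ k → v ≢ σ s k

    field
      cover           : ∀ {x} → x ∈ Inside → ∃[ s ] x ∈ₛ s
      -- This stands for the condition on common faces: at a point shared by `s` and `t` all weight
      -- sits on shared vertices. In this form the condition passes to products.
      compatible      : ∀ {s t x} → x ∈ₛ s → x ∈ₛ t → ∀ k → σ s k ∉ₛ t → β s k x ≈ 0#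
      distinct        : ∀ {s t} → s ≢ t → ∃[ k ] σ s k ∉ₛ t

    β-unique : ∀ s w x → sum w ≈ 1# → x ≋ combination w (point ∘ σ s) → ∀ k → β s k x ≈ w k
    β-unique s w x Σw x≋ k = ≈-trans (≈-sym (+-identityʳ _)) (≈-trans (+-congˡ (≈-sym (-‿inverseˡ (w k))))
      (≈-trans (solve 2 (λ b w → b :+ (:- w :+ w) := w :+ (b :- w)) ≈-refl (β s k x) (w k))
        (≈-trans (+-congˡ (difference≈0 k)) (+-identityʳ _))))
      where
      difference≈0 : ∀ k → β s k x - w k ≈ 0#
      difference≈0 = independent s (λ k → β s k x - w k)
        (≈-trans (sum-sub (λ k → β s k x) w) (≈-trans (+-cong (β-sum s x) (-‿cong Σw)) (-‿inverseʳ 1#)))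
        λ j → ≈-trans
          (sum-cong (λ k → solve 3 (λ b w p → (b :- w) :* p := b :* p :- w :* p) ≈-refl (β s k x) (w k) (point (σ s k) j)))
          (≈-trans (sum-sub (λ k → β s k x * point (σ s k) j) (λ k → w k * point (σ s k) j))
            (≈-trans (+-cong (≈-sym (β-combination s x j)) (-‿cong (≈-sym (x≋ j)))) (-‿inverseʳ (x j))))

    β-at-vertex : ∀ s k l → β s k (point (σ s l)) ≈ unit l k
    β-at-vertex s k l = β-unique s (unit l) _ (sum-unit l) (combination-unit (point ∘ σ s) l) k

    Hull : Index → Pred (Point d) 0ℓ
    Hull s = convexHull (point ∘ σ s)

    ∈ₛ⇒∈Hull : ∀ s {x} → x ∈ₛ s → x ∈ Hull s
    ∈ₛ⇒∈Hull s {x} 0≤β = (λ k → β s k x) , 0≤β , β-sum s x , β-combination s x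

    ∈Hull⇒∈ₛ : ∀ s {x} → x ∈ Hull s → x ∈ₛ s
    ∈Hull⇒∈ₛ s {x} (w , 0≤w , Σw , x≋) k = ≤-resp ≈-refl (≈-sym (β-unique s w x Σw x≋ k)) (0≤w k)

    vertex∈ₛ : ∀ s k → point (σ s k) ∈ₛ s
    vertex∈ₛ s k = ∈Hull⇒∈ₛ s (generator∈convexHull (point ∘ σ s) k)

    expand-over : ∀ s {f} → IsAffine f → ∀ x → f x ≈ sum (λ k → β s k x * f (point (σ s k)))
    expand-over s F x = ≈-trans (IsAffine.cong-≋ F (β-combination s x))
      (on-combination F (λ k → β s k x) (point ∘ σ s) (β-sum s x))

    -- Two simplices containing x give it the same weights, read as a measure on V:
    -- the difference of the two sides is affine in x and vanishes at common vertices.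
    measure-unique : ∀ {s t x} → x ∈ₛ s → x ∈ₛ t → ∀ (g : V → Carrier) →
                     sum (λ k → β s k x * g (σ s k)) ≈ sum (λ k → β t k x * g (σ t k))
    measure-unique {s} {t} {x} x∈s x∈t g =
      ≈-trans (solve 2 (λ a b → a := (a :- b) :+ b) ≈-refl _ _)
        (≈-trans (+-congʳ (≈-trans (expand-over s difference-affine x) (sum-zero term≈0))) (+-identityˡ _))
      where
      total-of : Index → Point d → Carrier
      total-of s y = sum (λ k → β s k y * g (σ s k))
      total-affine : ∀ s → IsAffine (total-of s)
      total-affine s = affine-sum (λ k → affine-≈ (λ y → *-comm (g (σ s k)) (β s k y)) (affine-* (g (σ s k)) (β-affine s k)))
      difference-affine : IsAffine (λ y → total-of s y - total-of t y)
      difference-affine = affine-sub (total-affine s) (total-affine t)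
      total-at-vertex : ∀ s l → total-of s (point (σ s l)) ≈ g (σ s l)
      total-at-vertex s l = ≈-trans (sum-cong (λ k → *-congʳ {g (σ s k)} (β-at-vertex s k l))) (sum-δ (λ k → g (σ s k)) l)
      term≈0 : ∀ k → β s k x * (total-of s (point (σ s k)) - total-of t (point (σ s k))) ≈ 0#
      term≈0 k with em {∃[ l ] σ s k ≡ σ t l}
      ... | no ∄l = ≈-trans (*-congʳ (compatible x∈s x∈t k (λ l eq → ∄l (l , eq)))) (zeroˡ _)
      ... | yes (l , eq) = ≈-trans (*-congˡ (≈-trans (+-cong (total-at-vertex s k)
            (-‿cong (subst (λ v → total-of t (point v) ≈ g v) (sym eq) (total-at-vertex t l)))) (-‿inverseʳ _))) (zeroʳ _)

    facet-nonNeg : ∀ v i b → 0# ≤ facet i b (point v)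
    facet-nonNeg v i b with em {b ≡ bit v i}
    ... | yes refl = ≤-reflexive (≈-sym (facet-on v i))
    ... | no b≢    = proj₁ (facet-off v i b≢)

    facets-disjoint : ∀ {x} → x ∈ Inside → ∀ i → 0# < facet i false x + facet i true x
    facets-disjoint x∈ i = let (s , x∈s) = cover x∈ in
      affine-pos-hull (affine-+ (facet-affine i false) (facet-affine i true)) (point ∘ σ s)
        (λ k → at-vertex (σ s k)) (∈ₛ⇒∈Hull s x∈s)
      where
      at-vertex : ∀ v → 0# < facet i false (point v) + facet i true (point v)
      at-vertex v with bit v i in eq
      ... | false = nonNeg+pos (facet-nonNeg v i false) (facet-off v i λ t≡ → contradiction (trans t≡ eq) λ ())
      ... | true  = pos+nonNeg (facet-off v i λ f≡ → contradiction (trans f≡ eq) λ ()) (facet-nonNeg v i true)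

    fromIndex : Fin size → Index
    fromIndex = Inverse.from index

    vertexAt : Fin size × Fin (suc d) → Point d
    vertexAt (j , k) = point (σ (fromIndex j) k)

    polytope : Polytope d
    polytope = record { generator = vertexAt ∘ remQuot {size} (suc d) }

    σ∈body : ∀ s k → point (σ s k) ∈ body polytope
    σ∈body s k = subst (λ p → p ∈ body polytope)
      (trans (cong vertexAt (remQuot-combine (Inverse.to index s) k))
        (cong (λ s → point (σ s k)) (Inverse.strictlyInverseʳ index s)))
      (generator∈convexHull (vertexAt ∘ remQuot {size} (suc d)) (combine (Inverse.to index s) k))

    Hull⊆body : ∀ s → Hull s ⊆ body polytope
    Hull⊆body s (w , 0≤w , Σw , x≋) = convexHull-≋ (≋-sym x≋)
      (convexHull-mix w (point ∘ σ s) _ 0≤w Σw (λ k → inj₂ (σ∈body s k)))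

    body⊆Inside : body polytope ⊆ Inside
    body⊆Inside x∈ i b = affine-nonNeg-hull (facet-affine i b) _ (λ j → facet-nonNeg _ i b) x∈

    Inside⊆body : Inside ⊆ body polytope
    Inside⊆body x∈ = let (s , x∈s) = cover x∈ in Hull⊆body s (∈ₛ⇒∈Hull s x∈s)

    cubeShape : CubeShape d (body polytope)
    cubeShape = record
      { facet      = facet
      ; affine     = facet-affine
      ; K⊆         = body⊆Inside
      ; ⊆K         = Inside⊆body
      ; corner     = point ∘ vertexOf
      ; corner-on  = λ ε i → subst (λ b → facet i b (point (vertexOf ε)) ≈ 0#) (bit-vertexOf ε i) (facet-on (vertexOf ε) i)
      ; corner-off = λ ε {i} b≢ → facet-off (vertexOf ε) i λ b≡ → b≢ (trans b≡ (bit-vertexOf ε i))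
      ; disjoint   = λ x∈ → facets-disjoint (body⊆Inside x∈)
      }

    isCombinatorialCube : Fin d → IsCombinatorialCube d polytope
    isCombinatorialCube i₀ =
        ( point ∘ σ s₀ , independent s₀ , σ∈body s₀
        , λ {x} _ → (λ k → β s₀ k x) , β-sum s₀ x , β-combination s₀ x)
      , cubeShape-≅ i₀ cubeShape (unitCube-shape d)
      where
      s₀ : Index
      -- Some simplex has to exist to supply an affine basis; the one covering a corner will do.
      s₀ = proj₁ (cover (facet-nonNeg (vertexOf (λ _ → false))))

    -- A facet function that vanishes at `x` vanishes at every vertex carrying weight at `x`. Such a
    -- vertex lies on all facets through `v`, so it has the bits of `v` and equals `v`.
    vertex-unique : ∀ v {x} → x ∈ Inside → (∀ i → facet i (bit v i) x ≈ 0#) → x ≋ point v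
    vertex-unique v {x} x∈ zero-at j = let (s , x∈s) = cover x∈ in begin
        x j                                         ≈⟨ β-combination s x j ⟩
        sum (λ k → β s k x * point (σ s k) j)       ≈⟨ sum-cong (only-v s x∈s) ⟩
        sum (λ k → β s k x * point v j)             ≈⟨ *-distribʳ-sum (point v j) (λ k → β s k x) ⟨
        sum (λ k → β s k x) * point v j             ≈⟨ *-congʳ (β-sum s x) ⟩
        1# * point v j                              ≈⟨ *-identityˡ _ ⟩
        point v j                                   ∎
      where
      open ≈-Reasoning
      only-v : ∀ s → x ∈ₛ s → ∀ k → β s k x * point (σ s k) j ≈ β s k x * point v j
      only-v s x∈s k with em {σ s k ≡ v}
      ... | yes eq = *-congˡ (≡⇒≈ (cong (λ u → point u j) eq))
      ... | no σ≢v = ≈-trans (*-congʳ β≈0) (≈-trans (zeroˡ _) (≈-sym (≈-trans (*-congʳ β≈0) (zeroˡ _))))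
        where
        differ : ∃[ i ] ¬ bit v i ≡ bit (σ s k) i
        differ = ¬∀⇒∃¬ λ same → σ≢v (sym (bit-injective same))
        i = proj₁ differ
        β≈0 : β s k x ≈ 0#
        β≈0 = *-cancelˡ-0 (≉-sym (proj₂ (facet-off (σ s k) i (proj₂ differ)))) (≈-trans (*-comm _ _)
          (sum≈0⇒term≈0 (λ l → *-nonNeg (x∈s l) (facet-nonNeg (σ s l) i (bit v i)))
            (≈-trans (≈-sym (expand-over s (facet-affine i (bit v i)) x)) (zero-at i)) k))

    isVertex : ∀ v → IsVertex (body polytope) (point v)
    isVertex v = zeroFace F-affine F-nonNeg
      , (λ x∈F → let (x∈ , Σ≈0) = proj₁ F-points x∈F in
          vertex-unique v (body⊆Inside x∈) (sum≈0⇒term≈0 (λ i → body⊆Inside x∈ i (bit v i)) Σ≈0))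
      , λ x≋v → proj₂ F-points
          ( convexHull-≋ (≋-sym x≋v) (Inside⊆body (facet-nonNeg v))
          , sum-zero (λ i → ≈-trans (IsAffine.cong-≋ (facet-affine i (bit v i)) x≋v) (facet-on v i)))
      where
      F-affine : IsAffine (λ x → sum (λ i → facet i (bit v i) x))
      F-affine = affine-sum (λ i → facet-affine i (bit v i))
      F-nonNeg : ∀ {x} → x ∈ body polytope → 0# ≤ sum (λ i → facet i (bit v i) x)
      F-nonNeg x∈ = sum-nonNeg (λ i → body⊆Inside x∈ i (bit v i))
      F-points = zeroFace-points F-affine F-nonNeg

    toSimplex : Index → Simplex d d
    toSimplex s = record { vertex = point ∘ σ s ; independent = independent s }

    -- The total weight of the vertices of `s` missing from `t` exposes the intersection:
    -- `compatible` makes it vanish there, and where it vanishes only common vertices carry weight.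
    common-face : ∀ s t → IsFaceOf (Hull s ∩ Hull t) (Hull s)
    common-face s t = zeroFace F-affine F-nonNeg
      , (λ x∈F → let (x∈s , Σ≈0) = proj₁ F-points x∈F in x∈s , in-t x∈s Σ≈0)
      , λ (x∈s , x∈t) → proj₂ F-points (x∈s , sum-zero (λ k →
          χ-*-zero (compatible (∈Hull⇒∈ₛ s x∈s) (∈Hull⇒∈ₛ t x∈t) k)))
      where
      F-affine : IsAffine (λ x → sum (λ k → χ (σ s k ∉ₛ t) * β s k x))
      F-affine = affine-sum (λ k → affine-* (χ (σ s k ∉ₛ t)) (β-affine s k))
      term-nonNeg : ∀ {x} → x ∈ Hull s → ∀ k → 0# ≤ χ (σ s k ∉ₛ t) * β s k x
      term-nonNeg x∈s k = *-nonNeg (χ-nonNeg _) (∈Hull⇒∈ₛ s x∈s k)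
      F-nonNeg : ∀ {x} → x ∈ Hull s → 0# ≤ sum (λ k → χ (σ s k ∉ₛ t) * β s k x)
      F-nonNeg x∈s = sum-nonNeg (term-nonNeg x∈s)
      F-points = zeroFace-points F-affine F-nonNeg
      in-t : ∀ {x} → x ∈ Hull s → sum (λ k → χ (σ s k ∉ₛ t) * β s k x) ≈ 0# → x ∈ Hull t
      in-t {x} x∈s Σ≈0 = convexHull-≋ {p = point ∘ σ t} (≋-sym (β-combination s x))
        (convexHull-mix (λ k → β s k x) (point ∘ σ s) (point ∘ σ t) (∈Hull⇒∈ₛ s x∈s) (β-sum s x) zero-or-common)
        where
        zero-or-common : ∀ k → β s k x ≈ 0# ⊎ point (σ s k) ∈ Hull t
        zero-or-common k with em {∃[ l ] σ s k ≡ σ t l}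
        ... | yes (l , eq) = inj₂ (subst (λ v → point v ∈ Hull t) (sym eq) (generator∈convexHull (point ∘ σ t) l))
        ... | no ∄l = inj₁ (≈-trans (≈-sym (≈-trans (*-congʳ (χ-yes λ l eq → ∄l (l , eq))) (*-identityˡ _)))
                        (sum≈0⇒term≈0 (term-nonNeg x∈s) Σ≈0 k))

    -- A vertex of `s` that `t` lacks has weight 1 at itself, but by `compatible` it would have
    -- weight 0 if the hull of `t` contained it.
    Hull-⊈ : ∀ {s t} → s ≢ t → ¬ (Hull s ⊆ Hull t)
    Hull-⊈ {s} {t} s≢t s⊆t = let (k , k∉t) = distinct s≢t in 0≉1 (≈-trans
      (≈-sym (compatible (vertex∈ₛ s k) (∈Hull⇒∈ₛ t (s⊆t (generator∈convexHull (point ∘ σ s) k))) k k∉t))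
      (≈-trans (β-at-vertex s k k) (χ-yes refl)))

    fromIndex-≢ : ∀ {i j} → i ≢ j → fromIndex i ≢ fromIndex j
    fromIndex-≢ {i} {j} i≢j eq = i≢j (trans (sym (Inverse.strictlyInverseˡ index i))
      (trans (cong (Inverse.to index) eq) (Inverse.strictlyInverseˡ index j)))

    triangulation : Triangulation d polytope
    triangulation = record
      { size             = size
      ; simplex          = toSimplex ∘ fromIndex
      ; distinct         = λ i≢j (i⊆j , _) → Hull-⊈ (fromIndex-≢ i≢j) i⊆j
      ; vertices         = λ i k → isVertex (σ (fromIndex i) k)
      ; union            = (λ (i , x∈) → Hull⊆body (fromIndex i) x∈) , λ {x} x∈ →
          let (s , x∈s) = cover (body⊆Inside x∈) in
          Inverse.to index s , subst (λ s → x ∈ Hull s) (sym (Inverse.strictlyInverseʳ index s)) (∈ₛ⇒∈Hull s x∈s)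
      ; interiorDisjoint = λ {i} {j} i≢j (x , x∈i , x∈j) → Hull-⊈ (fromIndex-≢ i≢j)
          (interior⇒⊆ (toSimplex (fromIndex i)) (common-face (fromIndex i) (fromIndex j)) x∈i (proj₁ x∈j))
      ; commonFace       = λ {i} {j} _ → common-face (fromIndex i) (fromIndex j)
          , let (F , F⊆ , ⊆F) = common-face (fromIndex j) (fromIndex i) in
            F , (λ x∈ → proj₂ (F⊆ x∈) , proj₁ (F⊆ x∈)) , λ (x∈i , x∈j) → ⊆F (x∈j , x∈i)
      }

  -- Weights along lattice paths

  -- The northwest corner rule: the weights supported on the path p whose row
  -- sums are a and whose column sums are b, provided sum a ≈ sum b.
  transport : ∀ {k l n} → Path k l n → Vector Carrier (suc k) → Vector Carrier (suc l) → Vector Carrier (suc n)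
  transport done      a b r       = a r
  transport (right p) a b zero    = a zero
  transport (right p) a b (suc r) = transport p (a ∘ suc) ((b zero - a zero) ∷ (b ∘ suc)) r
  transport (up p)    a b zero    = b zero
  transport (up p)    a b (suc r) = transport p ((a zero - b zero) ∷ (a ∘ suc)) (b ∘ suc) r

  Σ-tail : ∀ {m n} (a : Vector Carrier (suc m)) (b : Vector Carrier (suc n)) → sum a ≈ sum b →
           sum (a ∘ suc) ≈ sum ((b zero - a zero) ∷ (b ∘ suc))
  Σ-tail a b Σa≈Σb =
    ≈-trans (solve 2 (λ a s → s := (a :+ s) :- a) ≈-refl (a zero) (sum (a ∘ suc)))
      (≈-trans (+-congʳ Σa≈Σb)
        (solve 3 (λ b t a → (b :+ t) :- a := (b :- a) :+ t) ≈-refl (b zero) (sum (b ∘ suc)) (a zero)))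

  -- The arbitrary test function `g` lets one statement serve three purposes: constants give the
  -- total weight, indicators the single row sums, and coordinates of vertices the barycentric
  -- identity.
  transport-rows : ∀ {k l n} (p : Path k l n) a b (g : Fin (suc k) → Carrier) → sum a ≈ sum b →
                   sum (λ r → transport p a b r * g (row p r)) ≈ sum (λ i → a i * g i)
  transport-rows done a b g _ = ≈-refl
  transport-rows (right p) a b g Σa≈Σb = +-congˡ (transport-rows p (a ∘ suc) _ (g ∘ suc) (Σ-tail a b Σa≈Σb))
  transport-rows (up p) a b g Σa≈Σb = ≈-trans
    (+-congˡ (transport-rows p ((a zero - b zero) ∷ (a ∘ suc)) (b ∘ suc) g (≈-sym (Σ-tail b a (≈-sym Σa≈Σb)))))
    (solve 4 (λ a b g s → b :* g :+ ((a :- b) :* g :+ s) := a :* g :+ s) ≈-refl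
      (a zero) (b zero) (g zero) (sum (λ i → a (suc i) * g (suc i))))

  transport-cols : ∀ {k l n} (p : Path k l n) a b (g : Fin (suc l) → Carrier) → sum a ≈ sum b →
                   sum (λ r → transport p a b r * g (col p r)) ≈ sum (λ j → b j * g j)
  transport-cols done a b g Σa≈Σb = +-congʳ (*-congʳ
    (≈-trans (≈-sym (+-identityʳ _)) (≈-trans Σa≈Σb (+-identityʳ _))))
  transport-cols (up p) a b g Σa≈Σb = +-congˡ (transport-cols p _ (b ∘ suc) (g ∘ suc) (≈-sym (Σ-tail b a (≈-sym Σa≈Σb))))
  transport-cols (right p) a b g Σa≈Σb = ≈-trans
    (+-congˡ (transport-cols p (a ∘ suc) ((b zero - a zero) ∷ (b ∘ suc)) g (Σ-tail a b Σa≈Σb)))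
    (solve 4 (λ a b g s → a :* g :+ ((b :- a) :* g :+ s) := b :* g :+ s) ≈-refl
      (a zero) (b zero) (g zero) (sum (λ j → b (suc j) * g (suc j))))

  transport-sum : ∀ {k l n} (p : Path k l n) a b → sum a ≈ sum b → sum (transport p a b) ≈ sum a
  transport-sum p a b Σa≈Σb = ≈-trans (sum-cong {f = transport p a b} (λ r → ≈-sym (*-identityʳ _)))
    (≈-trans (transport-rows p a b (λ _ → 1#) Σa≈Σb) (sum-cong (λ i → *-identityʳ (a i))))

  transport-cong : ∀ {k l n} (p : Path k l n) {a a′ b b′} → (∀ i → a i ≈ a′ i) → (∀ j → b j ≈ b′ j) →
                   ∀ r → transport p a b r ≈ transport p a′ b′ r
  transport-cong done      a≈ b≈ r       = a≈ r
  transport-cong (right p) a≈ b≈ zero    = a≈ zero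
  transport-cong (up p)    a≈ b≈ zero    = b≈ zero
  transport-cong (right p) a≈ b≈ (suc r) = transport-cong p (a≈ ∘ suc)
    (λ { zero → +-cong (b≈ zero) (-‿cong (a≈ zero)) ; (suc j) → b≈ (suc j) }) r
  transport-cong (up p)    a≈ b≈ (suc r) = transport-cong p
    (λ { zero → +-cong (a≈ zero) (-‿cong (b≈ zero)) ; (suc i) → a≈ (suc i) }) (b≈ ∘ suc) r

  transport-affine : ∀ {m k l n} (p : Path k l n) (a : Fin (suc k) → Point m → Carrier) (b : Fin (suc l) → Point m → Carrier) →
                     (∀ i → IsAffine (a i)) → (∀ j → IsAffine (b j)) →
                     ∀ r → IsAffine (λ x → transport p (λ i → a i x) (λ j → b j x) r)
  transport-affine done      a b A B r       = A r
  transport-affine (right p) a b A B zero    = A zero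
  transport-affine (up p)    a b A B zero    = B zero
  transport-affine (right p) a b A B (suc r) = affine-≈
    (λ x → transport-cong p (λ _ → ≈-refl) (λ { zero → ≈-refl ; (suc j) → ≈-refl }) r)
    (transport-affine p (a ∘ suc) ((λ x → b zero x - a zero x) ∷ (b ∘ suc)) (A ∘ suc)
      (λ { zero → affine-sub (B zero) (A zero) ; (suc j) → B (suc j) }) r)
  transport-affine (up p) a b A B (suc r) = affine-≈
    (λ x → transport-cong p (λ { zero → ≈-refl ; (suc i) → ≈-refl }) (λ _ → ≈-refl) r)
    (transport-affine p ((λ x → a zero x - b zero x) ∷ (a ∘ suc)) (b ∘ suc)
      (λ { zero → affine-sub (A zero) (B zero) ; (suc i) → A (suc i) }) (B ∘ suc) r)

  -- The smaller of the two leading entries is used up and the path leaves its row or column, so the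
  -- remainders stay nonnegative. Once a single row or column is left, its entry is the sum of the
  -- other side and dominates every entry there.
  transport-cover : ∀ {n} k l → k ℕ.+ l ≡ n → ∀ a b → (∀ i → 0# ≤ a i) → (∀ j → 0# ≤ b j) → sum a ≈ sum b →
                    Σ[ p ∈ Path k l n ] (∀ r → 0# ≤ transport p a b r)
  transport-cover {zero} zero zero _ a b 0≤a 0≤b _ = done , 0≤a
  transport-cover {suc n} (suc k) zero eq a b 0≤a 0≤b Σa≈Σb =
    let (p , 0≤) = transport-cover k zero (ℕ.suc-injective eq) (a ∘ suc) _ (0≤a ∘ suc)
          (λ { zero → ≤⇒0≤ (≤-resp ≈-refl (≈-trans Σa≈Σb (+-identityʳ _)) (term≤sum 0≤a zero)) }) (Σ-tail a b Σa≈Σb)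
    in right p , λ { zero → 0≤a zero ; (suc r) → 0≤ r }
  transport-cover {suc n} zero (suc l) eq a b 0≤a 0≤b Σa≈Σb =
    let (p , 0≤) = transport-cover zero l (ℕ.suc-injective eq) _ (b ∘ suc)
          (λ { zero → ≤⇒0≤ (≤-resp ≈-refl (≈-trans (≈-sym Σa≈Σb) (+-identityʳ _)) (term≤sum 0≤b zero)) })
          (0≤b ∘ suc) (≈-sym (Σ-tail b a (≈-sym Σa≈Σb)))
    in up p , λ { zero → 0≤b zero ; (suc r) → 0≤ r }
  transport-cover {suc n} (suc k) (suc l) eq a b 0≤a 0≤b Σa≈Σb with total (a zero) (b zero)
  ... | inj₁ a≤b =
    let (p , 0≤) = transport-cover k (suc l) (ℕ.suc-injective eq) (a ∘ suc) _ (0≤a ∘ suc)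
          (λ { zero → ≤⇒0≤ a≤b ; (suc j) → 0≤b (suc j) }) (Σ-tail a b Σa≈Σb)
    in right p , λ { zero → 0≤a zero ; (suc r) → 0≤ r }
  ... | inj₂ b≤a =
    let (p , 0≤) = transport-cover (suc k) l (ℕ.suc-injective (trans (cong suc (sym (ℕ.+-suc k l))) eq)) _ (b ∘ suc)
          (λ { zero → ≤⇒0≤ b≤a ; (suc i) → 0≤a (suc i) }) (0≤b ∘ suc) (≈-sym (Σ-tail b a (≈-sym Σa≈Σb)))
    in up p , λ { zero → 0≤b zero ; (suc r) → 0≤ r }

  rowSums : ∀ {k l n} → Path k l n → Vector Carrier (suc n) → Vector Carrier (suc k)
  rowSums done      w = w
  rowSums (right p) w = w zero ∷ rowSums p (w ∘ suc)
  rowSums (up p)    w = (w zero + rowSums p (w ∘ suc) zero) ∷ (rowSums p (w ∘ suc) ∘ suc)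

  colSums : ∀ {k l n} → Path k l n → Vector Carrier (suc n) → Vector Carrier (suc l)
  colSums done      w = w
  colSums (right p) w = (w zero + colSums p (w ∘ suc) zero) ∷ (colSums p (w ∘ suc) ∘ suc)
  colSums (up p)    w = w zero ∷ colSums p (w ∘ suc)

  rowSums-sum : ∀ {k l n} (p : Path k l n) w (g : Fin (suc k) → Carrier) →
                sum (λ i → rowSums p w i * g i) ≈ sum (λ r → w r * g (row p r))
  rowSums-sum done      w g = ≈-refl
  rowSums-sum (right p) w g = +-congˡ (rowSums-sum p (w ∘ suc) (g ∘ suc))
  rowSums-sum (up p)    w g = ≈-trans
    (solve 4 (λ w m g s → (w :+ m) :* g :+ s := w :* g :+ (m :* g :+ s)) ≈-refl
      (w zero) (m zero) (g zero) (sum (λ i → m (suc i) * g (suc i))))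
    (+-congˡ (rowSums-sum p (w ∘ suc) g))
    where m = rowSums p (w ∘ suc)

  colSums-sum : ∀ {k l n} (p : Path k l n) w (g : Fin (suc l) → Carrier) →
                sum (λ j → colSums p w j * g j) ≈ sum (λ r → w r * g (col p r))
  colSums-sum done      w g = ≈-refl
  colSums-sum (up p)    w g = +-congˡ (colSums-sum p (w ∘ suc) (g ∘ suc))
  colSums-sum (right p) w g = ≈-trans
    (solve 4 (λ w m g s → (w :+ m) :* g :+ s := w :* g :+ (m :* g :+ s)) ≈-refl
      (w zero) (m zero) (g zero) (sum (λ j → m (suc j) * g (suc j))))
    (+-congˡ (colSums-sum p (w ∘ suc) g))
    where m = colSums p (w ∘ suc)

  -- The first weight is alone in its row if the path starts to the right, and alone in its column
  -- if it starts upwards. So it vanishes and can be peeled off. This reduces affine independence of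
  -- a staircase to that of the two factors.
  sums-zero : ∀ {k l n} (p : Path k l n) w → (∀ i → rowSums p w i ≈ 0#) → (∀ j → colSums p w j ≈ 0#) → ∀ r → w r ≈ 0#
  sums-zero done      w R C r       = R r
  sums-zero (right p) w R C zero    = R zero
  sums-zero (up p)    w R C zero    = C zero
  sums-zero (right p) w R C (suc r) = sums-zero p (w ∘ suc) (R ∘ suc)
    (λ { zero → ≈-trans (≈-sym (+-identityˡ _)) (≈-trans (+-congʳ (≈-sym (R zero))) (C zero)) ; (suc j) → C (suc j) }) r
  sums-zero (up p)    w R C (suc r) = sums-zero p (w ∘ suc)
    (λ { zero → ≈-trans (≈-sym (+-identityˡ _)) (≈-trans (+-congʳ (≈-sym (C zero))) (R zero)) ; (suc i) → R (suc i) }) (C ∘ suc) r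

  -- Two down-closed subsets of a chain are nested.
  meet-sum : ∀ {n} (w : Vector Carrier n) {A B : Pred (Fin n) 0ℓ} → (∀ r → 0# ≤ w r) →
             (∀ {r r′} → r Fin.≤ r′ → A r′ → A r) → (∀ {r r′} → r Fin.≤ r′ → B r′ → B r) →
             let X = sum (λ r → w r * χ (A r)) ; Y = sum (λ r → w r * χ (B r))
                 Z = sum (λ r → w r * (χ (A r) * χ (B r))) in
             Z ≤ X × Z ≤ Y × (Z ≈ X ⊎ Z ≈ Y)
  meet-sum w {A} {B} 0≤w A↓ B↓ =
      sum-mono (λ r → *-monoˡ-≤ (0≤w r) (≤-resp ≈-refl (*-identityʳ _) (*-monoˡ-≤ (χ-nonNeg (A r)) (χ≤1 (B r)))))
    , sum-mono (λ r → *-monoˡ-≤ (0≤w r) (≤-resp (*-comm _ _) (*-identityʳ _) (*-monoˡ-≤ (χ-nonNeg (B r)) (χ≤1 (A r)))))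
    , nested
    where
    absorb : ∀ {P Q : Set} → (P → Q) → χ P * χ Q ≈ χ P
    absorb {P} {Q} P⇒Q with em {P}
    ... | yes p = ≈-trans (*-identityˡ _) (χ-yes (P⇒Q p))
    ... | no _  = zeroˡ _
    Z = sum (λ r → w r * (χ (A r) * χ (B r)))
    nested : Z ≈ sum (λ r → w r * χ (A r)) ⊎ Z ≈ sum (λ r → w r * χ (B r))
    nested with em {∀ r → A r → B r}
    ... | yes A⊆B = inj₁ (sum-cong (λ r → *-congˡ (absorb (A⊆B r))))
    ... | no A⊈B  = inj₂ (sum-cong (λ r → *-congˡ (≈-trans (*-comm _ _) (absorb (B⊆A r)))))
      where
      B⊆A : ∀ r → B r → A r
      B⊆A r b = by-contradiction λ ¬a → A⊈B λ r′ a′ → case-≤ (ℕ.≤-total (Fin.toℕ r) (Fin.toℕ r′)) ¬a a′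
        where
        case-≤ : ∀ {r′} → r Fin.≤ r′ ⊎ r′ Fin.≤ r → ¬ A r → A r′ → B r′
        case-≤ (inj₁ r≤r′) ¬a a′ = contradiction (A↓ r≤r′ a′) ¬a
        case-≤ (inj₂ r′≤r) _  _  = B↓ r′≤r b

  -- Products of triangulated cubes

  affine-reindex : ∀ {m n} {f : Point m → Carrier} → IsAffine f → (ρ : Fin m → Fin n) → IsAffine (λ x → f (x ∘ ρ))
  affine-reindex F ρ = affine-≈ (λ x → ≈-sym (F.expand (x ∘ ρ)))
    (affine-+ (affine-sum (λ i → affine-* (F.normal i) (affine-coordinate (ρ i)))) (affine-const F.offset))
    where module F = IsAffine F

  module Product {d e m n} (C : TriangulatedCube d m) (D : TriangulatedCube e n) where
    private
      module C = TriangulatedCube C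
      module D = TriangulatedCube D

    fst : Point (d ℕ.+ e) → Point d
    fst x i = x (i ↑ˡ e)

    snd : Point (d ℕ.+ e) → Point e
    snd x j = x (d ↑ʳ j)

    facetₛ : Fin d ⊎ Fin e → Bool → Point (d ℕ.+ e) → Carrier
    facetₛ (inj₁ i) b x = C.facet i b (fst x)
    facetₛ (inj₂ j) b x = D.facet j b (snd x)

    facetₛ-affine : ∀ s b → IsAffine (facetₛ s b)
    facetₛ-affine (inj₁ i) b = affine-reindex (C.facet-affine i b) (_↑ˡ e)
    facetₛ-affine (inj₂ j) b = affine-reindex (D.facet-affine j b) (d ↑ʳ_)

    V : Set
    V = C.V × D.V

    _⊑_ : V → V → Set
    (u , v) ⊑ (u′ , v′) = u C.⊑ u′ × v D.⊑ v′

    module C⊑ = IsPartialOrder C.⊑-isPartialOrder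
    module D⊑ = IsPartialOrder D.⊑-isPartialOrder

    ⊑-isPartialOrder : IsPartialOrder _≡_ _⊑_
    ⊑-isPartialOrder = record
      { isPreorder = record
        { isEquivalence = ≡.isEquivalence
        ; reflexive     = λ { refl → C⊑.refl , D⊑.refl }
        ; trans         = λ (p , q) (p′ , q′) → C⊑.trans p p′ , D⊑.trans q q′ }
      ; antisym = λ (p , q) (p′ , q′) → cong₂ _,_ (C⊑.antisym p p′) (D⊑.antisym q q′) }

    point : V → Point (d ℕ.+ e)
    point (u , v) = C.point u ++ D.point v

    fst-point : ∀ u v → fst (point (u , v)) ≋ C.point u
    fst-point u v i = ≡⇒≈ (lookup-++ˡ (C.point u) (D.point v) i)

    snd-point : ∀ u v → snd (point (u , v)) ≋ D.point v
    snd-point u v j = ≡⇒≈ (lookup-++ʳ (C.point u) (D.point v) j)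

    bitₛ : V → Fin d ⊎ Fin e → Bool
    bitₛ (u , v) = [ C.bit u , D.bit v ]

    bit-injective : ∀ {u v} → (∀ i → bitₛ u (splitAt d i) ≡ bitₛ v (splitAt d i)) → u ≡ v
    bit-injective {u} {v} same = cong₂ _,_ (C.bit-injective (same′ ∘ inj₁)) (D.bit-injective (same′ ∘ inj₂))
      where
      same′ : ∀ s → bitₛ u s ≡ bitₛ v s
      same′ = all-sides same

    vertexOf : (Fin (d ℕ.+ e) → Bool) → V
    vertexOf ε = C.vertexOf (ε ∘ (_↑ˡ e)) , D.vertexOf (ε ∘ (d ↑ʳ_))

    bit-vertexOf : ∀ ε i → bitₛ (vertexOf ε) (splitAt d i) ≡ ε i
    bit-vertexOf ε i = trans (at (splitAt d i)) (cong ε (join-splitAt d e i))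
      where
      at : ∀ s → bitₛ (vertexOf ε) s ≡ ε (join d e s)
      at (inj₁ i) = C.bit-vertexOf _ i
      at (inj₂ j) = D.bit-vertexOf _ j

    facetₛ-on : ∀ v s → facetₛ s (bitₛ v s) (point v) ≈ 0#
    facetₛ-on (u , v) (inj₁ i) = ≈-trans (IsAffine.cong-≋ (C.facet-affine i _) (fst-point u v)) (C.facet-on u i)
    facetₛ-on (u , v) (inj₂ j) = ≈-trans (IsAffine.cong-≋ (D.facet-affine j _) (snd-point u v)) (D.facet-on v j)

    facetₛ-off : ∀ v s {b} → b ≢ bitₛ v s → 0# < facetₛ s b (point v)
    facetₛ-off (u , v) (inj₁ i) b≢ = <-resp ≈-refl
      (≈-sym (IsAffine.cong-≋ (C.facet-affine i _) (fst-point u v))) (C.facet-off u i b≢)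
    facetₛ-off (u , v) (inj₂ j) b≢ = <-resp ≈-refl
      (≈-sym (IsAffine.cong-≋ (D.facet-affine j _) (snd-point u v))) (D.facet-off v j b≢)

    Index : Set
    Index = C.Index × D.Index × Path d e (d ℕ.+ e)

    index : Index ↔ Fin (m ℕ.* (n ℕ.* pathCount d e))
    index = ↔-sym *↔× ↔-∘ (C.index ×-↔ (↔-sym *↔× ↔-∘ (D.index ×-↔ Path↔Fin d e refl)))

    σ : Index → Fin (suc (d ℕ.+ e)) → V
    σ (s , t , p) r = C.σ s (row p r) , D.σ t (col p r)

    β : Index → Fin (suc (d ℕ.+ e)) → Point (d ℕ.+ e) → Carrier
    β (s , t , p) r x = transport p (λ i → C.β s i (fst x)) (λ j → D.β t j (snd x)) r

    β-balanced : ∀ s t x → sum (λ i → C.β s i (fst x)) ≈ sum (λ j → D.β t j (snd x))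
    β-balanced s t x = ≈-trans (C.β-sum s (fst x)) (≈-sym (D.β-sum t (snd x)))

    β-rows : ∀ s t p x (g : Fin (suc d) → Carrier) →
             sum (λ r → β (s , t , p) r x * g (row p r)) ≈ sum (λ i → C.β s i (fst x) * g i)
    β-rows s t p x g = transport-rows p _ _ g (β-balanced s t x)

    β-cols : ∀ s t p x (g : Fin (suc e) → Carrier) →
             sum (λ r → β (s , t , p) r x * g (col p r)) ≈ sum (λ j → D.β t j (snd x) * g j)
    β-cols s t p x g = transport-cols p _ _ g (β-balanced s t x)

    β-combination : ∀ s x → x ≋ combination (λ r → β s r x) (point ∘ σ s)
    β-combination (s , t , p) x i = ≈-trans (≡⇒≈ (cong x (sym (join-splitAt d e i)))) (at (splitAt d i))
      where
      at : ∀ k → x (join d e k) ≈ sum (λ r → β (s , t , p) r x * [ C.point (C.σ s (row p r)) , D.point (D.σ t (col p r)) ] k)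
      at (inj₁ i) = ≈-trans (C.β-combination s (fst x) i) (≈-sym (β-rows s t p x (λ k → C.point (C.σ s k) i)))
      at (inj₂ j) = ≈-trans (D.β-combination t (snd x) j) (≈-sym (β-cols s t p x (λ k → D.point (D.σ t k) j)))

    independent : ∀ s → AffinelyIndependent (point ∘ σ s)
    independent (s , t , p) w Σw comb = sums-zero p w
      (C.independent s (rowSums p w) (total≈0 (rowSums p w) (λ g → rowSums-sum p w (λ _ → g)))
        (λ i → ≈-trans (rowSums-sum p w (λ k → C.point (C.σ s k) i)) (comb′ (inj₁ i))))
      (D.independent t (colSums p w) (total≈0 (colSums p w) (λ g → colSums-sum p w (λ _ → g)))
        (λ j → ≈-trans (colSums-sum p w (λ k → D.point (D.σ t k) j)) (comb′ (inj₂ j))))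
      where
      total≈0 : ∀ {l} (v : Vector Carrier l) → (∀ c → sum (λ i → v i * c) ≈ sum (λ r → w r * c)) → sum v ≈ 0#
      total≈0 v eq = ≈-trans (sum-cong {f = v} (λ i → ≈-sym (*-identityʳ (v i))))
        (≈-trans (eq 1#) (≈-trans (sum-cong (λ r → *-identityʳ (w r))) Σw))
      comb′ : ∀ k → sum (λ r → w r * [ C.point (C.σ s (row p r)) , D.point (D.σ t (col p r)) ] k) ≈ 0#
      comb′ = all-sides comb

    Inside : Pred (Point (d ℕ.+ e)) 0ℓ
    Inside x = ∀ i b → 0# ≤ facetₛ (splitAt d i) b x

    _∈ₛ_ : Point (d ℕ.+ e) → Index → Set
    x ∈ₛ s = ∀ r → 0# ≤ β s r x

    _∉ₛ_ : V → Index → Set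
    v ∉ₛ s = ∀ r → v ≢ σ s r

    Inside-sides : ∀ {x} → x ∈ Inside → ∀ s b → 0# ≤ facetₛ s b x
    Inside-sides x∈ = all-sides x∈

    cover : ∀ {x} → x ∈ Inside → ∃[ s ] x ∈ₛ s
    cover {x} x∈ =
      let (s , 0≤βs) = C.cover (Inside-sides x∈ ∘ inj₁)
          (t , 0≤βt) = D.cover (Inside-sides x∈ ∘ inj₂)
          (p , 0≤) = transport-cover d e refl _ _ 0≤βs 0≤βt (β-balanced s t x)
      in (s , t , p) , 0≤

    -- Each weight in the first factor is a row sum of weights in the product.
    fst∈ₛ : ∀ {s t p x} → x ∈ₛ (s , t , p) → fst x C.∈ₛ s
    fst∈ₛ {s} {t} {p} {x} 0≤β i = ≤-resp ≈-refl
      (≈-trans (β-rows s t p x (λ k → χ (k ≡ i))) (≈-trans (sum-cong {suc d} (λ k → *-comm (C.β s k (fst x)) (χ (k ≡ i)))) (sum-δ (λ k → C.β s k (fst x)) i)))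
      (sum-nonNeg (λ r → *-nonNeg (0≤β r) (χ-nonNeg (row p r ≡ i))))

    snd∈ₛ : ∀ {s t p x} → x ∈ₛ (s , t , p) → snd x D.∈ₛ t
    snd∈ₛ {s} {t} {p} {x} 0≤β j = ≤-resp ≈-refl
      (≈-trans (β-cols s t p x (λ k → χ (k ≡ j))) (≈-trans (sum-cong {suc e} (λ k → *-comm (D.β t k (snd x)) (χ (k ≡ j)))) (sum-δ (λ k → D.β t k (snd x)) j)))
      (sum-nonNeg (λ r → *-nonNeg (0≤β r) (χ-nonNeg (col p r ≡ j))))

    -- The weight of the quadrant A × B: as the vertices of a simplex form a chain,
    -- it is the smaller of the weights of A and of B, hence depends on x only.
    quadrant : Index → Point (d ℕ.+ e) → Pred C.V 0ℓ → Pred D.V 0ℓ → Carrier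
    quadrant s x A B = sum (λ r → β s r x * (χ (A (proj₁ (σ s r))) * χ (B (proj₂ (σ s r)))))

    Down : ∀ {U : Set} → (U → U → Set) → Pred U 0ℓ → Set
    Down _⊑_ A = ∀ {a a′} → a ⊑ a′ → A a′ → A a

    quadrant-unique : ∀ {s s′ x A B} → x ∈ₛ s → x ∈ₛ s′ → Down C._⊑_ A → Down D._⊑_ B →
                      quadrant s x A B ≈ quadrant s′ x A B
    quadrant-unique {s₁@(s , t , p)} {s₂@(s′ , t′ , p′)} {x} {A} {B} x∈ x∈′ A↓ B↓ =
      antisym (below s₁ s₂ (meet s₁ x∈) (meet s₂ x∈′) X≈X′ Y≈Y′)
              (below s₂ s₁ (meet s₂ x∈′) (meet s₁ x∈) (≈-sym X≈X′) (≈-sym Y≈Y′))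
      where
      X Y : Index → Carrier
      X s = sum (λ r → β s r x * χ (A (proj₁ (σ s r))))
      Y s = sum (λ r → β s r x * χ (B (proj₂ (σ s r))))
      Meet : Index → Set
      Meet s = quadrant s x A B ≤ X s × quadrant s x A B ≤ Y s × (quadrant s x A B ≈ X s ⊎ quadrant s x A B ≈ Y s)
      meet : ∀ s → x ∈ₛ s → Meet s
      meet (s , t , p) x∈ = meet-sum (λ r → β (s , t , p) r x) x∈
        (λ r≤r′ → A↓ (C.σ-mono s (row-mono p r≤r′))) (λ r≤r′ → B↓ (D.σ-mono t (col-mono p r≤r′)))
      X≈X′ : X s₁ ≈ X s₂
      X≈X′ = ≈-trans (β-rows s t p x (λ i → χ (A (C.σ s i)))) (≈-trans
        (C.measure-unique (fst∈ₛ {s} {t} {p} {x} x∈) (fst∈ₛ {s′} {t′} {p′} {x} x∈′) (λ u → χ (A u)))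
        (≈-sym (β-rows s′ t′ p′ x (λ i → χ (A (C.σ s′ i))))))
      Y≈Y′ : Y s₁ ≈ Y s₂
      Y≈Y′ = ≈-trans (β-cols s t p x (λ j → χ (B (D.σ t j)))) (≈-trans
        (D.measure-unique (snd∈ₛ {s} {t} {p} {x} x∈) (snd∈ₛ {s′} {t′} {p′} {x} x∈′) (λ v → χ (B v)))
        (≈-sym (β-cols s′ t′ p′ x (λ j → χ (B (D.σ t′ j))))))
      below : ∀ s s′ → Meet s → Meet s′ → X s ≈ X s′ → Y s ≈ Y s′ → quadrant s x A B ≤ quadrant s′ x A B
      below s s′ (Z≤X , _ , _) (_ , _ , inj₁ Z′≈X′) X≈ Y≈ = ≤-resp ≈-refl (≈-trans X≈ (≈-sym Z′≈X′)) Z≤X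
      below s s′ (_ , Z≤Y , _) (_ , _ , inj₂ Z′≈Y′) X≈ Y≈ = ≤-resp ≈-refl (≈-trans Y≈ (≈-sym Z′≈Y′)) Z≤Y

    mass : Index → Point (d ℕ.+ e) → V → Carrier
    mass s x (u , v) = sum (λ r → β s r x * (χ (proj₁ (σ s r) ≡ u) * χ (proj₂ (σ s r) ≡ v)))

    -- A point is the difference of two down-sets, the elements below it and those strictly below
    -- it. Multiplying two such differences expresses the weight of one vertex of the product by
    -- four quadrants.
    χ-≡ : ∀ {U : Set} {_≤ᵤ_ : U → U → Set} → IsPartialOrder _≡_ _≤ᵤ_ → ∀ a u →
          χ (a ≡ u) ≈ χ (a ≤ᵤ u) - χ (a ≤ᵤ u × a ≢ u)
    χ-≡ {_≤ᵤ_ = _≤ᵤ_} po a u with em {a ≡ u} | em {a ≤ᵤ u}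
    ... | yes eq | yes _ = ≈-sym (≈-trans (+-congˡ (-‿cong (χ-no λ (_ , a≢u) → a≢u eq)))
          (solve 0 (:1 :- :0 := :1) ≈-refl))
    ... | yes eq | no a≰u = contradiction (IsPartialOrder.reflexive po eq) a≰u
    ... | no a≢u | yes a≤u = ≈-sym (≈-trans (+-congˡ (-‿cong (χ-yes (a≤u , a≢u)))) (-‿inverseʳ 1#))
    ... | no _   | no a≰u = ≈-sym (≈-trans (+-congˡ (-‿cong (χ-no λ (a≤u , _) → a≰u a≤u))) (-‿inverseʳ 0#))

    mass-quadrants : ∀ s x u v → mass s x (u , v) ≈
        (quadrant s x (C._⊑ u) (D._⊑ v) - quadrant s x (C._⊑ u) (λ b → b D.⊑ v × b ≢ v))
      - (quadrant s x (λ a → a C.⊑ u × a ≢ u) (D._⊑ v) - quadrant s x (λ a → a C.⊑ u × a ≢ u) (λ b → b D.⊑ v × b ≢ v))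
    mass-quadrants s x u v = begin
      mass s x (u , v)
        ≈⟨ sum-cong {suc (d ℕ.+ e)} (λ r → ≈-trans (*-congˡ (*-cong (χ-≡ C.⊑-isPartialOrder (proj₁ (σ s r)) u) (χ-≡ D.⊑-isPartialOrder (proj₂ (σ s r)) v)))
             (solve 5 (λ w a a′ b b′ → w :* ((a :- a′) :* (b :- b′)) := (w :* (a :* b) :- w :* (a :* b′)) :- (w :* (a′ :* b) :- w :* (a′ :* b′)))
               ≈-refl (β s r x) (A r) (A′ r) (B r) (B′ r))) ⟩
      sum (λ r → (w r * (A r * B r) - w r * (A r * B′ r)) - (w r * (A′ r * B r) - w r * (A′ r * B′ r)))
        ≈⟨ sum-sub (λ r → w r * (A r * B r) - w r * (A r * B′ r)) (λ r → w r * (A′ r * B r) - w r * (A′ r * B′ r)) ⟩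
      sum (λ r → w r * (A r * B r) - w r * (A r * B′ r)) - sum (λ r → w r * (A′ r * B r) - w r * (A′ r * B′ r))
        ≈⟨ +-cong (sum-sub (λ r → w r * (A r * B r)) (λ r → w r * (A r * B′ r)))
                  (-‿cong (sum-sub (λ r → w r * (A′ r * B r)) (λ r → w r * (A′ r * B′ r)))) ⟩
      _ ∎
      where
      open ≈-Reasoning
      w A A′ B B′ : Vector Carrier (suc (d ℕ.+ e))
      w r = β s r x
      A r = χ (proj₁ (σ s r) C.⊑ u)
      A′ r = χ (proj₁ (σ s r) C.⊑ u × proj₁ (σ s r) ≢ u)
      B r = χ (proj₂ (σ s r) D.⊑ v)
      B′ r = χ (proj₂ (σ s r) D.⊑ v × proj₂ (σ s r) ≢ v)

    mass-unique : ∀ {s s′ x} → x ∈ₛ s → x ∈ₛ s′ → ∀ v → mass s x v ≈ mass s′ x v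
    mass-unique {s} {s′} {x} x∈ x∈′ (u , v) = ≈-trans (mass-quadrants s x u v) (≈-trans
      (+-cong (+-cong (unique C≤ D≤) (-‿cong (unique C≤ D<)))
              (-‿cong (+-cong (unique C< D≤) (-‿cong (unique C< D<)))))
      (≈-sym (mass-quadrants s′ x u v)))
      where
      unique : ∀ {A B} → Down C._⊑_ A → Down D._⊑_ B → quadrant s x A B ≈ quadrant s′ x A B
      unique {A} {B} = quadrant-unique {s} {s′} {x} {A} {B} x∈ x∈′
      C≤ : Down C._⊑_ (C._⊑ u)
      C≤ = C⊑.trans
      D≤ : Down D._⊑_ (D._⊑ v)
      D≤ = D⊑.trans
      C< : Down C._⊑_ (λ a → a C.⊑ u × a ≢ u)
      C< a⊑a′ (a′⊑u , a′≢u) = C⊑.trans a⊑a′ a′⊑u , λ { refl → a′≢u (C⊑.antisym a′⊑u a⊑a′) }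
      D< : Down D._⊑_ (λ b → b D.⊑ v × b ≢ v)
      D< b⊑b′ (b′⊑v , b′≢v) = D⊑.trans b⊑b′ b′⊑v , λ { refl → b′≢v (D⊑.antisym b′⊑v b⊑b′) }

    -- The mass at the vertex `σ s r` can be computed in either simplex. In `s′` it is 0, as the
    -- vertex does not occur; in `s` it is a sum of nonnegative terms, one of which is the weight in
    -- question.
    compatible : ∀ {s s′ x} → x ∈ₛ s → x ∈ₛ s′ → ∀ r → σ s r ∉ₛ s′ → β s r x ≈ 0#
    compatible {s} {s′} {x} x∈ x∈′ r ∉s′ = ≈-trans (≈-sym at-r)
      (sum≈0⇒term≈0 {f = term s} nonNeg
        (≈-trans (mass-unique {s} {s′} {x} x∈ x∈′ (σ s r)) (sum-zero {f = term s′} off)) r)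
      where
      hit : Index → Fin (suc (d ℕ.+ e)) → Carrier
      hit t r′ = χ (proj₁ (σ t r′) ≡ proj₁ (σ s r)) * χ (proj₂ (σ t r′) ≡ proj₂ (σ s r))
      term : Index → Fin (suc (d ℕ.+ e)) → Carrier
      term t r′ = β t r′ x * hit t r′
      at-r : term s r ≈ β s r x
      at-r = ≈-trans (*-congˡ (≈-trans (*-cong (χ-yes refl) (χ-yes refl)) (*-identityˡ 1#))) (*-identityʳ _)
      nonNeg : ∀ r′ → 0# ≤ term s r′
      nonNeg r′ = *-nonNeg (x∈ r′) (*-nonNeg (χ-nonNeg _) (χ-nonNeg _))
      off : ∀ r′ → term s′ r′ ≈ 0#
      off r′ = ≈-trans (*-congˡ (χ-*-zero λ eq₁ → χ-no λ eq₂ → ∉s′ r′ (sym (cong₂ _,_ eq₁ eq₂)))) (zeroʳ _)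

    distinct : ∀ {s s′} → s ≢ s′ → ∃[ r ] σ s r ∉ₛ s′
    distinct {s , t , p} {s′ , t′ , p′} ≢ with em {s ≡ s′} | em {t ≡ t′}
    ... | no s≢s′ | _ =
      let (k , ∉s′) = C.distinct s≢s′ ; (r , eq) = row-surjective p k in
      r , λ r′ e → ∉s′ (row p′ r′) (trans (cong (C.σ s) (sym eq)) (cong proj₁ e))
    ... | yes _ | no t≢t′ =
      let (k , ∉t′) = D.distinct t≢t′ ; (r , eq) = col-surjective p k in
      r , λ r′ e → ∉t′ (col p′ r′) (trans (cong (D.σ t) (sym eq)) (cong proj₂ e))
    ... | yes refl | yes refl =
      let (r , off) = path-distinct {p = p} {p′} (λ { refl → ≢ refl }) in
      r , λ r′ e → off r′ (C.σ-injective s (cong proj₁ e)) (D.σ-injective t (cong proj₂ e))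

    product : TriangulatedCube (d ℕ.+ e) (m ℕ.* (n ℕ.* pathCount d e))
    product = record
      { facet            = λ i → facetₛ (splitAt d i)
      ; facet-affine     = λ i → facetₛ-affine (splitAt d i)
      ; V                = V
      ; _⊑_              = _⊑_
      ; ⊑-isPartialOrder = ⊑-isPartialOrder
      ; point            = point
      ; bit              = λ v i → bitₛ v (splitAt d i)
      ; bit-injective    = bit-injective
      ; vertexOf         = vertexOf
      ; bit-vertexOf     = bit-vertexOf
      ; facet-on         = λ v i → facetₛ-on v (splitAt d i)
      ; facet-off        = λ v i → facetₛ-off v (splitAt d i)
      ; Index            = Index
      ; index            = index
      ; σ                = σ
      ; σ-mono           = λ (s , t , p) r≤r′ → C.σ-mono s (row-mono p r≤r′) , D.σ-mono t (col-mono p r≤r′)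
      ; σ-injective      = λ (s , t , p) eq → rowcol-injective p
                             (C.σ-injective s (cong proj₁ eq)) (D.σ-injective t (cong proj₂ eq))
      ; β                = β
      ; β-affine         = λ (s , t , p) → transport-affine p _ _
                             (λ i → affine-reindex (C.β-affine s i) (_↑ˡ e)) (λ j → affine-reindex (D.β-affine t j) (d ↑ʳ_))
      ; β-sum            = λ (s , t , p) x → ≈-trans (transport-sum p _ _ (β-balanced s t x)) (C.β-sum s (fst x))
      ; β-combination    = β-combination
      ; independent      = independent
      ; cover            = cover
      ; compatible       = λ {s} {s′} {x} → compatible {s} {s′} {x}
      ; distinct         = distinct
      }

  -- From integral certificates to triangulated cubes

  ι-sum : ∀ {n} (f : Fin n → ℤ) → ι (sumℤ f) ≈ sum (λ i → ι (f i))
  ι-sum {zero}  f = ≈-refl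
  ι-sum {suc n} f = ≈-trans (ι-+ (f zero) (sumℤ (f ∘ suc))) (+-congˡ (ι-sum (f ∘ suc)))

  ι-pos : ∀ {i} → pos 0 ℤ.< i → 0# < ι i
  ι-pos {pos (suc n)} _ = fromℕ-pos n
  ι-pos {pos zero} (ℤ.+<+ ())

  ι-mono-< : ∀ {i j} → i ℤ.< j → ι i < ι j
  ι-mono-< {i} {j} i<j = <-resp (+-identityʳ (ι i))
    (≈-trans (≈-sym (ι-+ i (j ℤ.- i))) (≡⇒≈ (cong ι i+[j-i]≡j)))
    (+-monoʳ-< (ι i) (ι-pos (subst (ℤ._< j ℤ.- i) (ℤ.+-inverseʳ i) (ℤ.+-monoˡ-< (ℤ.- i) i<j))))
    where
    i+[j-i]≡j : i ℤ.+ (j ℤ.- i) ≡ j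
    i+[j-i]≡j = trans (ℤ.+-comm i (j ℤ.- i)) (trans (ℤ.+-assoc j (ℤ.- i) i)
      (trans (cong (λ z → j ℤ.+ z) (ℤ.+-inverseˡ i)) (ℤ.+-identityʳ j)))

  ⟦_⟧ : ∀ {d} → Form d → Point d → Carrier
  ⟦ a , c ⟧ x = (λ i → ι (lookup a i)) ∙ x + ι c

  ⟦⟧-affine : ∀ {d} (f : Form d) → IsAffine ⟦ f ⟧
  ⟦⟧-affine (a , c) = record { normal = λ i → ι (lookup a i) ; offset = ι c ; expand = λ x → ≈-refl }

  ⟦⟧-ι : ∀ {d} (f : Form d) x → ⟦ f ⟧ (ι ∘ x) ≈ ι (eval f x)
  ⟦⟧-ι (a , c) x = ≈-sym (≈-trans (ι-+ (sumℤ (λ i → lookup a i ℤ.* x i)) c)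
    (+-congʳ (≈-trans (ι-sum (λ i → lookup a i ℤ.* x i)) (sum-cong (λ i → ι-* (lookup a i) (x i))))))

  -- The coefficients of an integral combination of forms are computed in ℤ, so finitely many
  -- integer equations yield an identity at every real point.
  ⟦⟧-weighted : ∀ {d m} (v : Fin m → ℤ) (F : Fin m → Form d) x →
    sum (λ k → ι (v k) * ⟦ F k ⟧ x) ≈
    sum (λ i → ι (sumℤ (λ k → v k ℤ.* lookup (proj₁ (F k)) i)) * x i) + ι (sumℤ (λ k → v k ℤ.* proj₂ (F k)))
  ⟦⟧-weighted {d} {m} v F x = begin
    sum (λ k → ι (v k) * (sum (λ i → a k i * x i) + ι (proj₂ (F k))))
      ≈⟨ sum-cong (λ k → ≈-trans (distribˡ (ι (v k)) _ _) (+-congˡ (≈-sym (ι-* (v k) (proj₂ (F k)))))) ⟩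
    sum (λ k → ι (v k) * sum (λ i → a k i * x i) + ι (v k ℤ.* proj₂ (F k)))
      ≈⟨ ∑-distrib-+ (λ k → ι (v k) * sum (λ i → a k i * x i)) (λ k → ι (v k ℤ.* proj₂ (F k))) ⟩
    sum (λ k → ι (v k) * sum (λ i → a k i * x i)) + sum (λ k → ι (v k ℤ.* proj₂ (F k)))
      ≈⟨ +-cong
           (≈-trans (sum-cong (λ k → *-congˡ (sum-cong (λ i → *-comm (a k i) (x i)))))
             (≈-trans (≈-sym (sum-comm-* x (ι ∘ v) a)) (sum-cong (λ i → *-comm (x i) _))))
           (≈-sym (ι-sum (λ k → v k ℤ.* proj₂ (F k)))) ⟩
    sum (λ i → sum (λ k → ι (v k) * a k i) * x i) + ι (sumℤ (λ k → v k ℤ.* proj₂ (F k)))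
      ≈⟨ +-congʳ (sum-cong (λ i → *-congʳ (≈-trans (sum-cong (λ k → ≈-sym (ι-* (v k) (lookup (proj₁ (F k)) i))))
           (≈-sym (ι-sum (λ k → v k ℤ.* lookup (proj₁ (F k)) i)))))) ⟩
    _ ∎
    where
    open ≈-Reasoning
    a : Fin m → Fin d → Carrier
    a k i = ι (lookup (proj₁ (F k)) i)

  maximum : ∀ {n} (f : Fin (suc n) → Carrier) → ∃[ s ] ∀ t → f t ≤ f s
  maximum {zero}  f = zero , λ { zero → ≤-refl }
  maximum {suc n} f with maximum (f ∘ suc)
  ... | s , f≤fs with total (f zero) (f (suc s))
  ...   | inj₁ f0≤fs = suc s , λ { zero → f0≤fs ; (suc t) → f≤fs t }
  ...   | inj₂ fs≤f0 = zero , λ { zero → ≤-refl ; (suc t) → ≤-trans (f≤fs t) fs≤f0 }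

  module Lattice {d n} (L : LatticeCube d (suc n)) (regular : LatticeCube.IsRegular L) where
    open LatticeCube L
    open IsRegular regular

    point : Fin (2 ℕ.^ d) → Point d
    point v i = ι (corner v i)

    vertexₗ : Fin (suc n) → Fin (suc d) → Point d
    vertexₗ s k = point (simplex s k)

    β : Fin (suc n) → Fin (suc d) → Point d → Carrier
    β s k x = ½ * ⟦ 2β s k ⟧ x

    β-affine : ∀ s k → IsAffine (β s k)
    β-affine s k = affine-* ½ (⟦⟧-affine (2β s k))

    β-weighted : ∀ s (v : Fin (suc d) → ℤ) x → sum (λ k → ι (v k) * β s k x) ≈
      ½ * (sum (λ i → ι (sumℤ (λ k → v k ℤ.* lookup (proj₁ (2β s k)) i)) * x i) + ι (sumℤ (λ k → v k ℤ.* proj₂ (2β s k))))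
    β-weighted s v x = ≈-trans
      (sum-cong {suc d} (λ k → solve 3 (λ v h b → v :* (h :* b) := h :* (v :* b)) ≈-refl (ι (v k)) ½ (⟦ 2β s k ⟧ x)))
      (≈-trans (≈-sym (*-distribˡ-sum ½ (λ k → ι (v k) * ⟦ 2β s k ⟧ x))) (*-congˡ (⟦⟧-weighted v (2β s) x)))

    β-sum : ∀ s x → sum (λ k → β s k x) ≈ 1#
    β-sum s x = ≈-trans
      (sum-cong {suc d} (λ k → ≈-sym (≈-trans (*-congʳ (+-identityʳ 1#)) (*-identityˡ (β s k x)))))
      (≈-trans (β-weighted s (λ _ → pos 1) x) (≈-trans
        (*-congˡ (≈-trans (+-cong (sum-zero (λ i → ≈-trans (*-congʳ (≡⇒≈ (cong ι (2β-sum s i)))) (zeroˡ (x i))))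
                                  (≡⇒≈ (cong ι (2β-sum₀ s)))) (+-identityˡ _)))
        ½*2≈1))

    β-combination : ∀ s x → x ≋ combination (λ k → β s k x) (vertexₗ s)
    β-combination s x j = ≈-sym (≈-trans
      (sum-cong {suc d} (λ k → *-comm (β s k x) (point (simplex s k) j)))
      (≈-trans (β-weighted s (λ k → corner (simplex s k) j) x) (≈-trans
        (*-congˡ (≈-trans (+-cong
            (≈-trans (sum-single j (λ i i≢j → ≈-trans (*-congʳ (≡⇒≈ (cong ι (2β-corner-off s i j i≢j)))) (zeroˡ (x i))))
              (*-congʳ (≡⇒≈ (cong ι (2β-corner-on s j)))))
            (≡⇒≈ (cong ι (2β-corner₀ s j)))) (+-identityʳ _)))
        (≈-trans (≈-sym (*-assoc _ _ _)) (≈-trans (*-congʳ ½*2≈1) (*-identityˡ (x j)))))))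

    β-at-vertex : ∀ s k l → β s k (vertexₗ s l) ≈ χ (k ≡ l)
    β-at-vertex s k l with em {k ≡ l}
    ... | yes refl = ≈-trans (*-congˡ (≈-trans (⟦⟧-ι (2β s k) _) (≡⇒≈ (cong ι (2β-on s k))))) ½*2≈1
    ... | no k≢l   = ≈-trans (*-congˡ (≈-trans (⟦⟧-ι (2β s k) _) (≡⇒≈ (cong ι (2β-off s k l k≢l))))) (zeroʳ ½)

    expand-over : ∀ s {f} → IsAffine f → ∀ x → f x ≈ sum (λ k → β s k x * f (vertexₗ s k))
    expand-over s F x = ≈-trans (IsAffine.cong-≋ F (β-combination s x))
      (on-combination F (λ k → β s k x) (vertexₗ s) (β-sum s x))

    -- The functions `β s k` are dual to the vertices: applied to an affine dependence, `β s k`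
    -- leaves only `w k`.
    independent : ∀ s → AffinelyIndependent (vertexₗ s)
    independent s w Σw comb k = begin
      w k
        ≈⟨ sum-δ w k ⟨
      sum (λ l → χ (l ≡ k) * w l)
        ≈⟨ sum-cong {suc d} (λ l → ≈-trans (*-comm (χ (l ≡ k)) (w l)) (*-congˡ {w l} (≈-trans (χ-sym l k) (≈-sym (β-at-vertex s k l))))) ⟩
      sum (λ l → w l * β s k (vertexₗ s l))
        ≈⟨ B.on-combination′ w (vertexₗ s) ⟨
      B.normal ∙ combination w (vertexₗ s) + sum w * B.offset
        ≈⟨ +-cong (sum-zero (λ i → ≈-trans (*-congˡ (comb i)) (zeroʳ _))) (≈-trans (*-congʳ Σw) (zeroˡ _)) ⟩
      0# + 0#
        ≈⟨ +-identityʳ 0# ⟩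
      0# ∎
      where
      open ≈-Reasoning
      module B = IsAffine (β-affine s k)
      χ-sym : ∀ l k → χ (l ≡ k) ≈ χ (k ≡ l)
      χ-sym l k with em {l ≡ k}
      ... | yes refl = ≈-sym (χ-yes refl)
      ... | no l≢k   = ≈-sym (χ-no (l≢k ∘ sym))

    lift : Fin (suc n) → Point d → Carrier
    lift s x = sum (λ k → ι (height (simplex s k)) * β s k x)

    lift-affine : ∀ s → IsAffine (lift s)
    lift-affine s = affine-sum (λ k → affine-* (ι (height (simplex s k))) (β-affine s k))

    -- The height of a corner above the affine interpolation on `s`. Regularity makes it 0 at the
    -- vertices of `s` and positive at all other corners.
    gap : Fin (suc n) → Fin (2 ℕ.^ d) → Carrier
    gap s v = ι (height v) - lift s (point v)

    gap-on : ∀ s k → gap s (simplex s k) ≈ 0#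
    gap-on s k = ≈-trans (+-congˡ (-‿cong (≈-trans
        (sum-cong {suc d} (λ l → ≈-trans (*-congˡ {ι (height (simplex s l))} (β-at-vertex s l k)) (*-comm _ _)))
        (sum-δ (λ l → ι (height (simplex s l))) k))))
      (-‿inverseʳ _)

    gap-off : ∀ s v → v ∉ˢ s → 0# < gap s v
    gap-off s v v∉s = <-resp (-‿inverseˡ (lift s (point v))) (+-comm _ _)
      (+-monoʳ-< (- lift s (point v)) lift<)
      where
      lift≈ : lift s (point v) ≈ ½ * ι (2lift s (corner v))
      lift≈ = ≈-trans
        (sum-cong {suc d} (λ k → ≈-trans (solve 3 (λ v h b → v :* (h :* b) := h :* (v :* b)) ≈-refl (ι (height (simplex s k))) ½ (⟦ 2β s k ⟧ (point v)))
          (*-congˡ (≈-trans (*-congˡ (⟦⟧-ι (2β s k) (corner v))) (≈-sym (ι-* (height (simplex s k)) (eval (2β s k) (corner v))))))))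
        (≈-trans (≈-sym (*-distribˡ-sum ½ (λ k → ι (height (simplex s k) ℤ.* eval (2β s k) (corner v)))))
          (*-congˡ (≈-sym (ι-sum (λ k → height (simplex s k) ℤ.* eval (2β s k) (corner v))))))
      lift< : lift s (point v) < ι (height v)
      lift< = <-resp (≈-sym lift≈)
        (≈-trans (*-congˡ (ι-* (pos 2) (height v))) (≈-trans (≈-sym (*-assoc ½ (fromℕ 2) (ι (height v))))
          (≈-trans (*-congʳ ½*2≈1) (*-identityˡ _))))
        (*-monoˡ-< 0<½ (ι-mono-< (2lift-below s v v∉s)))

    gap-nonNeg : ∀ s v → 0# ≤ gap s v
    gap-nonNeg s v with em {∃[ k ] v ≡ simplex s k}
    ... | yes (k , refl) = ≤-reflexive (≈-sym (gap-on s k))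
    ... | no ∄k          = proj₁ (gap-off s v λ k eq → ∄k (k , eq))

    lift-difference : ∀ s t x → lift s x - lift t x ≈ sum (λ k → β s k x * gap t (simplex s k))
    lift-difference s t x = ≈-trans (expand-over s (affine-sub (lift-affine s) (lift-affine t)) x)
      (sum-cong {suc d} (λ k → *-congˡ {β s k x} (+-congʳ { - lift t (vertexₗ s k)} (at-own k))))
      where
      at-own : ∀ k → lift s (vertexₗ s k) ≈ ι (height (simplex s k))
      at-own k = ≈-trans (solve 2 (λ a b → a := b :- (b :- a)) ≈-refl (lift s (vertexₗ s k)) (ι (height (simplex s k))))
        (≈-trans (+-congˡ (≈-trans (-‿cong (gap-on s k)) -0≈0)) (+-identityʳ _))
        where
        -0≈0 : - 0# ≈ 0#
        -0≈0 = solve 0 (:- :0 := :0) ≈-refl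

    -- Over a point of `s` the interpolation on `s` is at least that on `t`, and conversely; at a
    -- common point they agree. Their difference is a sum of nonnegative products of weight and gap,
    -- so a vertex with positive gap has weight 0.
    compatible : ∀ {s t x} → (∀ k → 0# ≤ β s k x) → (∀ k → 0# ≤ β t k x) → ∀ k → simplex s k ∉ˢ t → β s k x ≈ 0#
    compatible {s} {t} {x} x∈s x∈t k ∉t = *-cancelˡ-0 (≉-sym (proj₂ (gap-off t (simplex s k) ∉t)))
      (≈-trans (*-comm _ _) (sum≈0⇒term≈0 {f = λ k → β s k x * gap t (simplex s k)}
        (λ k → *-nonNeg (x∈s k) (gap-nonNeg t (simplex s k)))
        (≈-trans (≈-sym (lift-difference s t x)) difference≈0) k))
      where
      difference-nonNeg : ∀ s t → (∀ k → 0# ≤ β s k x) → 0# ≤ lift s x - lift t x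
      difference-nonNeg s t x∈s = ≤-resp ≈-refl (≈-sym (lift-difference s t x))
        (sum-nonNeg {f = λ k → β s k x * gap t (simplex s k)} (λ k → *-nonNeg (x∈s k) (gap-nonNeg t (simplex s k))))
      difference≈0 : lift s x - lift t x ≈ 0#
      difference≈0 = ≈-trans (+-congʳ (antisym (0≤⇒≤ (difference-nonNeg t s x∈t)) (0≤⇒≤ (difference-nonNeg s t x∈s)))) (-‿inverseʳ _)

    facet-off′ : ∀ v i {b} → b ≢ bits {d} v i → 0# < ⟦ facet i b ⟧ (point v)
    facet-off′ v i {b} b≢ = subst (λ b → 0# < ⟦ facet i b ⟧ (point v)) (sym (Bool.¬-not b≢))
      (<-resp ≈-refl (≈-sym (⟦⟧-ι (facet i (not (bits {d} v i))) (corner v))) (ι-pos (facet-off v i)))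

    facet-on′ : ∀ v i → ⟦ facet i (bits {d} v i) ⟧ (point v) ≈ 0#
    facet-on′ v i = ≈-trans (⟦⟧-ι (facet i (bits {d} v i)) (corner v)) (≡⇒≈ (cong ι (facet-on v i)))

    Inside : Pred (Point d) 0ℓ
    Inside x = ∀ i b → 0# ≤ ⟦ facet i b ⟧ x

    -- The simplex whose lift is largest at x contains x.
    cover : ∀ {x} → x ∈ Inside → ∃[ s ] ∀ k → 0# ≤ β s k x
    cover {x} x∈ = s , nonNeg
      where
      best = maximum (λ s → lift s x)
      s = proj₁ best
      only : ∀ k (f : Fin (suc d) → Carrier) → (∀ l → l ≢ k → f l ≈ 0#) → sum (λ l → β s l x * f l) ≈ f k * β s k x
      only k f f≈0 = ≈-trans
        (sum-single {f = λ l → β s l x * f l} k (λ l l≢k → ≈-trans (*-congˡ (f≈0 l l≢k)) (zeroʳ (β s l x))))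
        (*-comm (β s k x) (f k))
      -- The facet function vanishes at all vertices of `s` but the `k`-th, where it is positive. At
      -- `x` it is thus a positive multiple of `β s k`.
      wall : ∀ k {i b} → Wall s k i b → 0# ≤ β s k x
      wall k {i} {b} (on-wall , off-wall) = *-cancelˡ-0≤ (facet-off′ (simplex s k) i (off-wall ∘ sym))
        (≤-resp ≈-refl (≈-trans (expand-over s (⟦⟧-affine (facet i b)) x)
          (only k (λ l → ⟦ facet i b ⟧ (vertexₗ s l)) (λ l l≢k → on l (on-wall l l≢k)))) (x∈ i b))
        where
        on : ∀ l → bits {d} (simplex s l) i ≡ b → ⟦ facet i b ⟧ (vertexₗ s l) ≈ 0#
        on l refl = facet-on′ (simplex s l) i
      nonNeg : ∀ k → 0# ≤ β s k x
      nonNeg k with adjacent s k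
      ... | inj₁ (i , w)        = wall k w
      ... | inj₂ (inj₁ (i , w)) = wall k w
      -- The difference of the lifts of `s` and `t` plays the part of the facet function; it is
      -- nonnegative at `x` because the lift of `s` is maximal.
      ... | inj₂ (inj₂ (t , shared , ∉t)) = *-cancelˡ-0≤ (gap-off t (simplex s k) ∉t)
        (≤-resp ≈-refl (≈-trans (lift-difference s t x)
          (only k (λ l → gap t (simplex s l)) (λ l l≢k → on l (shared l l≢k))))
          (≤⇒0≤ (proj₂ best t)))
        where
        on : ∀ l → (∃[ m ] simplex s l ≡ simplex t m) → gap t (simplex s l) ≈ 0#
        on l (m , eq) = subst (λ v → gap t v ≈ 0#) (sym eq) (gap-on t m)

    triangulatedCube : TriangulatedCube d (suc n)
    triangulatedCube = record
      { facet            = λ i b → ⟦ facet i b ⟧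
      ; facet-affine     = λ i b → ⟦⟧-affine (facet i b)
      ; V                = Fin (2 ℕ.^ d)
      ; _⊑_              = Fin._≤_
      ; ⊑-isPartialOrder = Fin.≤-isPartialOrder
      ; point            = point
      ; bit              = bits {d}
      ; bit-injective    = bits-injective d
      ; vertexOf         = fromBits
      ; bit-vertexOf     = bits-fromBits
      ; facet-on         = facet-on′
      ; facet-off        = facet-off′
      ; Index            = Fin (suc n)
      ; index            = ↔-id _
      ; σ                = simplex
      ; σ-mono           = λ s {k} {l} → simplex-mono s k l
      ; σ-injective      = λ s {k} {l} → simplex-injective s k l
      ; β                = β
      ; β-affine         = β-affine
      ; β-sum            = β-sum
      ; β-combination    = β-combination
      ; independent      = independent
      ; cover            = cover
      ; compatible       = compatible
      ; distinct         = λ {s} {t} → simplex-distinct s t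
      }

  -- Combinatorial cubes have boundedly many simplices in a triangulation

  points-≋ : ∀ {d} (G : Face (unitCube d)) {x y} → x ≋ y → x ∈ points G → y ∈ points G
  points-≋ G x≋y (x∈ , tight) =
      (λ i → ≤-resp ≈-refl (x≋y i) (proj₁ (x∈ i)) , ≤-resp (x≋y i) ≈-refl (proj₂ (x∈ i)))
    , ≈-trans (∙-cong (Face.normal G) (≋-sym x≋y)) tight

  cubeCorner : ∀ {d} → (Fin d → Bool) → Point d
  cubeCorner ε i = if ε i then 1# else 0#

  signs : ∀ {d} → Face (unitCube d) → Fin d → Bool
  signs G i = ⌊ em {0# ≤ Face.normal G i} ⌋

  -- Linear functionals are maximised on the cube by their sign vectors.
  signs∈points : ∀ {d} (G : Face (unitCube d)) → ∃ (points G) → cubeCorner (signs G) ∈ points G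
  signs∈points {d} G (x , x∈ , tight) = c∈ , antisym (G.valid c c∈)
    (≤-resp tight ≈-refl (sum-mono (λ i → larger i)))
    where
    module G = Face G
    c : Point d
    c = cubeCorner (signs G)
    c∈ : c ∈ unitCube d
    c∈ i with em {0# ≤ G.normal i}
    ... | yes _ = 0≤1 , ≤-refl
    ... | no  _ = ≤-refl , 0≤1
    larger : ∀ i → G.normal i * x i ≤ G.normal i * c i
    larger i with em {0# ≤ G.normal i}
    ... | yes 0≤a = *-monoˡ-≤ 0≤a (proj₂ (x∈ i))
    ... | no  0≰a = ≤-by (*-nonNeg (0≤-neg a≤0) (proj₁ (x∈ i)))
          (solve 2 (λ a x → :- a :* x := a :* :0 :- a :* x) ≈-refl (G.normal i) (x i))
      where
      a≤0 : G.normal i ≤ 0#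
      a≤0 = by-contradiction λ a≰0 → contradiction (total 0# (G.normal i)) λ
        { (inj₁ 0≤a) → 0≰a 0≤a ; (inj₂ a≤0) → a≰0 a≤0 }

  -- The zero set of the constant 1. Being the least face, it lets an order isomorphism detect
  -- emptiness.
  noFace : ∀ {n} (K : Pred (Point n) 0ℓ) → ∃[ E ] ∀ x → ¬ (x ∈ points {K = K} E)
  noFace K = zeroFace (affine-const 1#) (λ _ → 0≤1) , λ x x∈ →
    0≉1 (≈-sym (proj₂ (proj₁ (zeroFace-points {K = K} (affine-const 1#) (λ _ → 0≤1)) {x} x∈)))

  intersectFaces : ∀ {n} {K : Pred (Point n) 0ℓ} (F G : Face K) → ∃[ H ] points {K = K} H ≐ points F ∩ points G
  intersectFaces {K = K} F G = zeroFace slack-affine slack-nonNeg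
    , (λ {x} x∈H → let (x∈K , Σ≈0) = proj₁ H-points x∈H ; (e₁ , e₂) = nonNeg-sum≈0 (slack₁ x∈K) (slack₂ x∈K) Σ≈0 in
        (x∈K , tight e₁) , (x∈K , tight e₂))
    , λ ((x∈K , e₁) , (_ , e₂)) → proj₂ H-points (x∈K , ≈-trans (+-cong (slack e₁) (slack e₂)) (+-identityʳ 0#))
    where
    module F = Face F
    module G = Face G
    slack-affine : IsAffine (λ x → (F.offset - F.normal ∙ x) + (G.offset - G.normal ∙ x))
    slack-affine = affine-+ (affine-sub (affine-const F.offset) (∙-affine F.normal))
                            (affine-sub (affine-const G.offset) (∙-affine G.normal))
    slack₁ : ∀ {x} → x ∈ K → 0# ≤ F.offset - F.normal ∙ x
    slack₁ x∈K = ≤⇒0≤ (F.valid _ x∈K)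
    slack₂ : ∀ {x} → x ∈ K → 0# ≤ G.offset - G.normal ∙ x
    slack₂ x∈K = ≤⇒0≤ (G.valid _ x∈K)
    slack-nonNeg : ∀ {x} → x ∈ K → 0# ≤ (F.offset - F.normal ∙ x) + (G.offset - G.normal ∙ x)
    slack-nonNeg x∈K = +-nonNeg (slack₁ x∈K) (slack₂ x∈K)
    H-points = zeroFace-points slack-affine slack-nonNeg
    tight : ∀ {c a} → c - a ≈ 0# → a ≈ c
    tight {c} {a} e = ≈-trans (solve 2 (λ c a → a := c :- (c :- a)) ≈-refl c a)
      (≈-trans (+-congˡ (-‿cong e)) (solve 1 (λ c → c :- :0 := c) ≈-refl c))
    slack : ∀ {c a} → a ≈ c → c - a ≈ 0#
    slack {c} a≈c = ≈-trans (+-congˡ (-‿cong a≈c)) (-‿inverseʳ c)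

  convexHull-⊆ : ∀ {m n} {p q : Vector (Point n) m} → (∀ k → p k ≋ q k) → convexHull p ⊆ convexHull q
  convexHull-⊆ p≋q (w , 0≤w , Σw , x≋) =
    w , 0≤w , Σw , λ j → ≈-trans (x≋ j) (sum-cong (λ k → *-congˡ (p≋q k j)))

  module _ {n d} {C : Polytope n} (isCube : IsCombinatorialCube d C) where
    private
      φ : Face (body C) → Face (unitCube d)
      φ = proj₁ (proj₂ isCube)
      open IsOrderIsomorphism (proj₂ (proj₂ isCube)) using (cancel; mono; surjective)

    -- An empty image would lie below the image of the empty face, and as the isomorphism reflects
    -- the order, F would be empty too.
    φ-nonempty : ∀ F → ∃ (points F) → ∃ (points (φ F))
    φ-nonempty F (x , x∈F) = by-contradiction λ ∄ →
      proj₂ (noFace (body C)) x (cancel {F} {proj₁ (noFace (body C))} (λ {y} y∈ → contradiction (y , y∈) ∄) {x} x∈F)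

    φ-nonempty⁻ : ∀ F → ∃ (points (φ F)) → ∃ (points F)
    φ-nonempty⁻ F (y , y∈) = by-contradiction λ ∄ →
      let (E , φE) = surjective (proj₁ (noFace (unitCube d))) in
      proj₂ (noFace (unitCube d)) y (proj₁ (φE {E} ((λ z → z) , (λ z → z))) {y} (mono {F} {E} (λ {x} x∈ → contradiction (x , x∈) ∄) {y} y∈))

    -- A corner of the unit cube on the image of the vertex, read off from the normal of a
    -- supporting inequality.
    vertex-code : ∀ {v} → IsVertex (body C) v → Fin d → Bool
    vertex-code (F , _) = signs (φ F)

    -- If the images of two vertices share a corner, their intersection is a nonempty face. It is
    -- the image of a nonempty face that lies in both vertices, so these coincide.
    vertex-code-injective : ∀ {v v′} (V : IsVertex (body C) v) (V′ : IsVertex (body C) v′) →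
                            (∀ i → vertex-code V i ≡ vertex-code V′ i) → v ≋ v′
    vertex-code-injective {v} {v′} (F , F⊆ , ⊆F) (F′ , F′⊆ , ⊆F′) same =
      let (H , H⊆ , ⊆H) = intersectFaces (φ F) (φ F′)
          (G , φG) = surjective H
          (φG⊆H , H⊆φG) = φG {G} ((λ z → z) , (λ z → z))
          c∈ = signs∈points (φ F) (φ-nonempty F (v , ⊆F (λ i → ≈-refl)))
          c∈′ = points-≋ (φ F′) (λ i → ≡⇒≈ (cong (λ b → if b then 1# else 0#) (sym (same i))))
                  (signs∈points (φ F′) (φ-nonempty F′ (v′ , ⊆F′ (λ i → ≈-refl))))
          (y , y∈G) = φ-nonempty⁻ G (_ , H⊆φG (⊆H (c∈ , c∈′)))
          y∈F = cancel {G} {F} (λ z → proj₁ (H⊆ (φG⊆H z))) y∈G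
          y∈F′ = cancel {G} {F′} (λ z → proj₂ (H⊆ (φG⊆H z))) y∈G
      in ≋-trans (≋-sym (F⊆ y∈F)) (F′⊆ y∈F′)

    -- The codes of its `d + 1` vertices determine the hull of a simplex, and distinct simplices
    -- have distinct hulls. So simplices inject into words of length `d + 1` over the `2 ^ d`
    -- corners.
    size-bounded : (T : Triangulation d C) → size T ℕ.≤ (2 ℕ.^ d) ℕ.^ suc d
    size-bounded T = injective⇒≤ {f = encode} λ {i} {j} eq → by-contradiction λ i≢j →
      T.distinct i≢j
        ( convexHull-⊆ (λ k → same-vertex i j eq k)
        , convexHull-⊆ (λ k → ≋-sym (same-vertex i j eq k)))
      where
      module T = Triangulation T
      corner-code : Fin T.size → Fin (suc d) → Fin (2 ℕ.^ d)
      corner-code i k = fromBits (vertex-code (T.vertices i k))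
      encode : Fin T.size → Fin ((2 ℕ.^ d) ℕ.^ suc d)
      encode i = funToFin (corner-code i)
      same-vertex : ∀ i j → encode i ≡ encode j → ∀ k → Simplex.vertex (T.simplex i) k ≋ Simplex.vertex (T.simplex j) k
      same-vertex i j eq k = vertex-code-injective (T.vertices i k) (T.vertices j k) λ l →
        trans (sym (bits-fromBits (vertex-code (T.vertices i k)) l))
          (trans (cong (λ c → bits {d} c l) same-code) (bits-fromBits (vertex-code (T.vertices j k)) l))
        where
        same-code : corner-code i k ≡ corner-code j k
        same-code = trans (sym (finToFun-funToFin (corner-code i) k))
          (trans (cong (λ z → finToFun z k) eq) (finToFun-funToFin (corner-code j) k))

  greatest : (P : ℕ → Set) → ∀ N → ∃ P → (∀ {m} → P m → m ℕ.≤ N) → ∃[ m ] P m × (∀ {m′} → P m′ → m′ ℕ.≤ m)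
  greatest P N ∃P bound with em {P N}
  ... | yes PN = N , PN , bound
  greatest P zero    (m , Pm) bound | no ¬P0 = contradiction (subst P (ℕ.n≤0⇒n≡0 (bound Pm)) Pm) ¬P0
  greatest P (suc N) ∃P bound | no ¬PN = greatest P N ∃P λ Pm →
    ℕ.≤-pred (ℕ.≤∧≢⇒< (bound Pm) λ { refl → ¬PN Pm })

  maximum-exists : ∀ {d s} → Fin d → TriangulatedCube d s → ∃ (IsMaxTriangulationSize d)
  maximum-exists {d} {s} i₀ C =
    let (m , attained , largest) = greatest Attained ((2 ℕ.^ d) ℕ.^ suc d)
          (s , d , C.polytope , C.isCombinatorialCube i₀ , C.triangulation , refl)
          (λ { (_ , P , isCube , T , refl) → size-bounded {C = P} isCube T })
    in m , attained , λ P isCube T → largest (_ , P , isCube , T , refl)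
    where
    module C = TriangulatedCube C
    Attained : ℕ → Set
    Attained m = ∃[ n ] ∃[ P ] IsCombinatorialCube {n} d P × (Σ[ T ∈ Triangulation d P ] size T ≡ m)

  -- Cubes with many simplices

  -- Write `c` for `A / B`. Multiplying `c ^ 3 * 3! ≤ s` with the bound in dimension `d` gives the
  -- bound in dimension `d + 3`, because `N`, the number of lattice paths, converts `3! * d!` into
  -- `(3 + d)!`.
  step-bound : ∀ A B n s N d → A ℕ.* A ℕ.* A ℕ.* 6 ℕ.≤ B ℕ.* B ℕ.* B ℕ.* s → A ℕ.^ d ℕ.* d ! ℕ.≤ B ℕ.^ d ℕ.* n →
               N ℕ.* (6 ℕ.* d !) ≡ (3 ℕ.+ d) ! →
               A ℕ.^ (3 ℕ.+ d) ℕ.* (3 ℕ.+ d) ! ℕ.≤ B ℕ.^ (3 ℕ.+ d) ℕ.* (s ℕ.* (n ℕ.* N))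
  step-bound A B n s N d cube bound N! = begin
    A ℕ.^ (3 ℕ.+ d) ℕ.* (3 ℕ.+ d) !
      ≡⟨ cong (A ℕ.^ (3 ℕ.+ d) ℕ.*_) N! ⟨
    A ℕ.^ (3 ℕ.+ d) ℕ.* (N ℕ.* (6 ℕ.* d !))
      ≡⟨ ℕsolve 5 (λ A P N k f → A ∶* (A ∶* (A ∶* P)) ∶* (N ∶* (k ∶* f)) ∶= A ∶* A ∶* A ∶* k ∶* (P ∶* f) ∶* N)
           refl A (A ℕ.^ d) N 6 (d !) ⟩
    A ℕ.* A ℕ.* A ℕ.* 6 ℕ.* (A ℕ.^ d ℕ.* d !) ℕ.* N
      ≤⟨ ℕ.*-monoˡ-≤ N (ℕ.*-mono-≤ cube bound) ⟩
    B ℕ.* B ℕ.* B ℕ.* s ℕ.* (B ℕ.^ d ℕ.* n) ℕ.* N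
      ≡⟨ ℕsolve 5 (λ B P N s n → B ∶* B ∶* B ∶* s ∶* (P ∶* n) ∶* N ∶= B ∶* (B ∶* (B ∶* P)) ∶* (s ∶* (n ∶* N)))
           refl B (B ℕ.^ d) N s n ⟩
    B ℕ.^ (3 ℕ.+ d) ℕ.* (s ℕ.* (n ℕ.* N))
      ∎
    where
    open ℕ.≤-Reasoning
    open ℕSolver.+-*-Solver using () renaming (solve to ℕsolve; _:*_ to _∶*_; _:=_ to _∶=_)

  -- The inequality says `1.031 ^ d * d! ≤ s`, cleared of denominators so that small dimensions are
  -- settled by evaluation in ℕ.
  LargeCube : ℕ → Set₁
  LargeCube d = ∃[ s ] TriangulatedCube d s × 1031 ℕ.^ d ℕ.* d ! ℕ.≤ 1000 ℕ.^ d ℕ.* s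

  prism₃ : TriangulatedCube 3 7
  prism₃ = Lattice.triangulatedCube trapezoidalPrism trapezoidalPrism-regular

  interval₁ : TriangulatedCube 1 1
  interval₁ = Lattice.triangulatedCube interval interval-regular

  largeCube : ∀ k → LargeCube (3 ℕ.+ k)
  largeCube 0 = _ , prism₃ , ℕ.≤ᵇ⇒≤ _ _ _
  largeCube 1 = _ , Product.product interval₁ prism₃ , ℕ.≤ᵇ⇒≤ _ _ _
  -- The product has 7 · 4 · 5 = 140 simplices, and 140 / 5! is still 7/6, while `1.031 ^ 5` is
  -- already 1.1649...; this is the tightest of the three base cases.
  largeCube 2 = _ , Product.product interval₁ (Product.product interval₁ prism₃) , ℕ.≤ᵇ⇒≤ _ _ _
  largeCube (suc (suc (suc k))) =
    let (n , C , bound) = largeCube k in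
    _ , Product.product prism₃ C
      , step-bound 1031 1000 n 7 (pathCount 3 (3 ℕ.+ k)) (3 ℕ.+ k) (ℕ.≤ᵇ⇒≤ _ _ _) bound (pathCount-! 3 (3 ℕ.+ k))

  -- The real constant and the maximal size

  fromℕ-^ : ∀ p d → fromℕ (p ℕ.^ d) ≈ fromℕ p ^ d
  fromℕ-^ p zero    = +-identityʳ 1#
  fromℕ-^ p (suc d) = ≈-trans (fromℕ-* p (p ℕ.^ d)) (*-congˡ (fromℕ-^ p d))

  ^-cong : ∀ {x y} d → x ≈ y → x ^ d ≈ y ^ d
  ^-cong zero    x≈y = ≈-refl
  ^-cong (suc d) x≈y = *-cong x≈y (^-cong d x≈y)

  ^-distrib-* : ∀ x y d → (x * y) ^ d ≈ x ^ d * y ^ d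
  ^-distrib-* x y zero    = ≈-sym (*-identityˡ 1#)
  ^-distrib-* x y (suc d) = ≈-trans (*-congˡ (^-distrib-* x y d))
    (solve 4 (λ x y p q → x :* y :* (p :* q) := x :* p :* (y :* q)) ≈-refl x y (x ^ d) (y ^ d))

  ^-pos : ∀ {x} d → 0# < x → 0# < x ^ d
  ^-pos zero    0<x = 0<1
  ^-pos (suc d) 0<x = *-pos 0<x (^-pos d 0<x)

  -- The witness is the quotient of `p` by `suc q`. The successor keeps the denominator positive, so
  -- 1000 enters as 999.
  rational-bound : ∀ p q (D : ℕ → Set) (f : ℕ → ℕ) →
                   (∀ d → D d → p ℕ.^ d ℕ.* d ! ℕ.≤ suc q ℕ.^ d ℕ.* f d) →
                   Σ[ c ∈ Carrier ] fromℕ p ≤ fromℕ (suc q) * c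
                     × (∀ d → D d → (c ^ d) * fromℕ (d !) ≤ fromℕ (f d))
  rational-bound p q D f bound = c , ≤-reflexive (≈-sym Qc≈p) , λ d Dd → *-cancelˡ-≤ (^-pos d 0<Q) (≤-resp
      (begin
        fromℕ (p ℕ.^ d ℕ.* d !)           ≈⟨ fromℕ-* (p ℕ.^ d) (d !) ⟩
        fromℕ (p ℕ.^ d) * fromℕ (d !)     ≈⟨ *-congʳ (fromℕ-^ p d) ⟩
        fromℕ p ^ d * fromℕ (d !)         ≈⟨ *-congʳ (^-cong d Qc≈p) ⟨
        (Q * c) ^ d * fromℕ (d !)         ≈⟨ *-congʳ (^-distrib-* Q c d) ⟩
        Q ^ d * c ^ d * fromℕ (d !)       ≈⟨ *-assoc (Q ^ d) (c ^ d) _ ⟩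
        Q ^ d * (c ^ d * fromℕ (d !))     ∎)
      (≈-trans (fromℕ-* (suc q ℕ.^ d) (f d)) (*-congʳ (fromℕ-^ (suc q) d)))
      (fromℕ-mono (bound d Dd)))
    where
    open ≈-Reasoning
    Q = fromℕ (suc q)
    0<Q = fromℕ-pos q
    Q⁻¹ = pos-inverse 0<Q
    c = fromℕ p * proj₁ Q⁻¹
    Qc≈p : Q * c ≈ fromℕ p
    Qc≈p = ≈-trans (solve 3 (λ Q p y → Q :* (p :* y) := p :* (Q :* y)) ≈-refl Q (fromℕ p) (proj₁ Q⁻¹))
      (≈-trans (*-congˡ (proj₂ (proj₂ Q⁻¹))) (*-identityʳ (fromℕ p)))

  -- The function has to be total, so a dimension without a maximum would receive the default 0. For
  -- `d > 2` the large cubes show that the set of attained sizes is nonempty, and the maximum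
  -- exists.
  maxSize : ℕ → ℕ
  maxSize d with em {∃ (IsMaxTriangulationSize d)}
  ... | yes (m , _) = m
  ... | no _        = 0

  maxSize-correct : ∀ d → ∃ (IsMaxTriangulationSize d) → IsMaxTriangulationSize d (maxSize d)
  maxSize-correct d ∃max with em {∃ (IsMaxTriangulationSize d)}
  ... | yes (_ , isMax) = isMax
  ... | no ∄            = contradiction ∃max ∄

  maxSize-isMax : ∀ d → d ℕ.> 2 → IsMaxTriangulationSize d (maxSize d)
  maxSize-isMax _ (ℕ.s≤s (ℕ.s≤s (ℕ.s≤s (ℕ.z≤n {k})))) =
    maxSize-correct (3 ℕ.+ k) (maximum-exists zero (proj₁ (proj₂ (largeCube k))))

  maxSize-large : ∀ d → d ℕ.> 2 → 1031 ℕ.^ d ℕ.* d ! ℕ.≤ 1000 ℕ.^ d ℕ.* maxSize d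
  maxSize-large _ d>2@(ℕ.s≤s (ℕ.s≤s (ℕ.s≤s (ℕ.z≤n {k})))) =
    let (_ , C , bound) = largeCube k in
    ℕ.≤-trans bound (ℕ.*-monoʳ-≤ (1000 ℕ.^ (3 ℕ.+ k))
      (proj₂ (maxSize-isMax (3 ℕ.+ k) d>2) (TriangulatedCube.polytope C)
        (TriangulatedCube.isCombinatorialCube C zero) (TriangulatedCube.triangulation C)))

proposition4p1 : ExcludedMiddle 0ℓ →
    (ℝ : CompleteOrderedField) →
    let open CompleteOrderedField ℝ
        open Polytopes ℝ in
    Σ[ f ∈ (ℕ → ℕ) ]
      (∀ d → d > 2 → IsMaxTriangulationSize d (f d))
      × (Σ[ c ∈ Carrier ]
          fromℕ 1031 ≤ fromℕ 1000 * c
          × (∀ d → d > 2 → (c ^ d) * fromℕ (d !) ≤ fromℕ (f d)))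
proposition4p1 em ℝ = maxSize , maxSize-isMax , rational-bound 1031 999 (_> 2) maxSize maxSize-large
  where open Construction em ℝ
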